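{- Let $\mathbf{c}\in\mathbb{F}_{q^2}^4$ with $\mathbf{c}\neq0$. If $g_{\mathbf{c}}$ is non-constant and $A_{\mathbf{c}}(X)$ has no roots in $\mu_{q+1}$, then $f_{\mathbf{c}}$ is linear equivalent to one of the following functions: \begin{enumerate} \item $P_0(x,y)=(x^{Q+1},y^{Q+1}):\mathbb{F}_q^2\to\mathbb{F}_q^2$; \item $f_0(X)=X^{Q+1}$ on $\mathbb{F}_{q^2}$; \item $f_1(X)=X^{Q+q}$ on $\mathbb{F}_{q^2}$; \item $P_1(x,y)=(x^{Q+1},xy^Q+y^{Q+1}):\mathbb{F}_q^2\to\mathbb{F}_q^2$; \item $P_2(x,y)=(x^Qy,x^{Q+1}+\varepsilon y^{Q+1}):\mathbb{F}_q^2\to\mathbb{F}_q^2$ for some $\varepsilon\in\mathbb{F}_q^*$; \item $P_3(x,y)=(x^{Q+1}-x^Qy,xy^Q+\varepsilon y^{Q+1}):\mathbb{F}_q^2\to\mathbb{F}_q^2$ for some $\varepsilon\in\mathbb{F}_q^*\setminus\{ -1\}$; \item $f_2(X)=X^{Q+q}+\varepsilon X^{Q+1}$ on $\mathbb{F}_{q^2}$ for some $\varepsilon\in\mathbb{F}_{q^2}^*\setminus\mu_{q+1}$. \end{enumerate}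
   Context: Let $p$ be an odd prime, $k,\ell$ positive integers, $q=p^k$, $Q=p^\ell$; for $c\in\mathbb{F}_{q^2}$ write $\bar c=c^q$; $\mu_{q+1}$ is the set of $(q+1)$-th roots of unity in $\overline{\mathbb{F}}_q$. For $\mathbf{c}=(c_0,c_1,c_2,c_3)\in\mathbb{F}_{q^2}^4$ define $f_{\mathbf{c}}(X)=c_0X^{qQ+q}+c_1X^{qQ+1}+c_2X^{Q+q}+c_3X^{Q+1}$, $A_{\mathbf{c}}(X)=c_0X^{Q+1}+c_1X^Q+c_2X+c_3$, $B_{\mathbf{c}}(X)=\bar c_3X^{Q+1}+\bar c_2X^Q+\bar c_1X+\bar c_0$, and (for $\mathbf{c}\ne0$) the rational function $g_{\mathbf{c}}=B_{\mathbf{c}}/A_{\mathbf{c}}$. Two maps $F:V\to V$, $F':V'\to V'$ with $V,V'\in\{\mathbb{F}_{q^2},\mathbb{F}_q^2\}$ are linear equivalent if $F'=L_1\circ F\circ L_2$ for some $\mathbb{F}_p$-linear bijections $L_2:V'\to V$, $L_1:V\to V'$. -}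

module Defs where

open import Level using (0ℓ)
open import Data.Nat using (ℕ; zero; suc; _+_; _*_; _^_)
open import Data.Nat.Primality using (Prime)
open import Data.Fin using (Fin)
open import Data.Product using (_×_; _,_; Σ; ∃; ∃-syntax)
open import Data.Sum using (_⊎_)
open import Function using (_∘_; _↔_)
open import Function.Definitions using (Bijective)
open import Relation.Binary.PropositionalEquality using (_≡_)
open import Relation.Nullary using (¬_)

record Field : Set₁ where
  infixl 6 _+F_
  infixl 7 _*F_
  field
    Carrier : Set
    _+F_ _*F_ : Carrier → Carrier → Carrier
    -F_ : Carrier → Carrier
    0F 1F : Carrier
    inv : Carrier → Carrier
    +-assoc : ∀ x y z → (x +F y) +F z ≡ x +F (y +F z)
    +-comm : ∀ x y → x +F y ≡ y +F x
    +-idʳ : ∀ x → x +F 0F ≡ x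
    +-invʳ : ∀ x → x +F (-F x) ≡ 0F
    *-assoc : ∀ x y z → (x *F y) *F z ≡ x *F (y *F z)
    *-comm : ∀ x y → x *F y ≡ y *F x
    *-idʳ : ∀ x → x *F 1F ≡ x
    distribˡ : ∀ x y z → x *F (y +F z) ≡ (x *F y) +F (x *F z)
    0≢1 : ¬ (0F ≡ 1F)
    *-invʳ : ∀ x → ¬ (x ≡ 0F) → x *F inv x ≡ 1F

HasSize : Field → ℕ → Set
HasSize F n = Field.Carrier F ↔ Fin n

module _ (F : Field) where
  open Field F

  pow : Carrier → ℕ → Carrier
  pow x zero = 1F
  pow x (suc n) = x *F pow x n

  -- n-fold sum (action of the prime field by natural numbers)
  times : ℕ → Carrier → Carrier
  times zero x = 0F
  times (suc n) x = x +F times n x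

-- Spaces V ∈ {F_{q^2}, F_q^2} are modelled as additive groups with
-- an ℕ-action (the F_p-vector space structure).
record AddSpace : Set₁ where
  field
    V : Set
    _⊕_ : V → V → V
    _·_ : ℕ → V → V

FieldSpace : Field → AddSpace
FieldSpace F = record { V = Field.Carrier F ; _⊕_ = Field._+F_ F ; _·_ = times F }

PairSpace : Field → AddSpace
PairSpace F = record
  { V = Field.Carrier F × Field.Carrier F
  ; _⊕_ = λ { (a , b) (c , d) → (Field._+F_ F a c , Field._+F_ F b d) }
  ; _·_ = λ { n (a , b) → (times F n a , times F n b) }
  }

IsFpLinearBij : (S T : AddSpace) → (AddSpace.V S → AddSpace.V T) → Set
IsFpLinearBij S T L =
  (∀ x y → L (AddSpace._⊕_ S x y) ≡ AddSpace._⊕_ T (L x) (L y)) ×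
  (∀ (n : ℕ) x → L (AddSpace._·_ S n x) ≡ AddSpace._·_ T n (L x)) ×
  Bijective _≡_ _≡_ L

LinEquiv : (S T : AddSpace) → (AddSpace.V S → AddSpace.V S) →
           (AddSpace.V T → AddSpace.V T) → Set
LinEquiv S T F F' =
  Σ (AddSpace.V S → AddSpace.V T) λ L1 →
  Σ (AddSpace.V T → AddSpace.V S) λ L2 →
  IsFpLinearBij S T L1 × IsFpLinearBij T S L2 ×
  (∀ x → F' x ≡ L1 (F (L2 x)))

module Paper (K : Field) (Fq : Field) (q Q : ℕ) where
  open Field K

  private
    _^K_ = pow K

  conj : Carrier → Carrier
  conj c = c ^K q

  -- μ_{q+1} (contained in F_{q^2} since q+1 ∣ q^2-1)
  inMu : Carrier → Set
  inMu x = x ^K (q + 1) ≡ 1F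

  fc : Carrier → Carrier → Carrier → Carrier → Carrier → Carrier
  fc c0 c1 c2 c3 X =
    c0 *F (X ^K (q * Q + q)) +F c1 *F (X ^K (q * Q + 1)) +F
    c2 *F (X ^K (Q + q)) +F c3 *F (X ^K (Q + 1))

  Ac : Carrier → Carrier → Carrier → Carrier → Carrier → Carrier
  Ac c0 c1 c2 c3 X =
    c0 *F (X ^K (Q + 1)) +F c1 *F (X ^K Q) +F c2 *F X +F c3

  NonZeroVec : Carrier → Carrier → Carrier → Carrier → Set
  NonZeroVec c0 c1 c2 c3 = ¬ (c0 ≡ 0F × c1 ≡ 0F × c2 ≡ 0F × c3 ≡ 0F)

  -- g_c = B_c / A_c is constant (A_c ≠ 0 as a polynomial since c ≠ 0):
  -- B_c = λ A_c as polynomials in the monomials X^{Q+1}, X^Q, X, 1.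
  gConstant : Carrier → Carrier → Carrier → Carrier → Set
  gConstant c0 c1 c2 c3 = Σ Carrier λ l →
    conj c3 ≡ l *F c0 × conj c2 ≡ l *F c1 ×
    conj c1 ≡ l *F c2 × conj c0 ≡ l *F c3

  ANoRootsInMu : Carrier → Carrier → Carrier → Carrier → Set
  ANoRootsInMu c0 c1 c2 c3 = ∀ x → inMu x → ¬ (Ac c0 c1 c2 c3 x ≡ 0F)

  f0 f1 : Carrier → Carrier
  f0 X = X ^K (Q + 1)
  f1 X = X ^K (Q + q)

  f2 : Carrier → Carrier → Carrier
  f2 ε X = X ^K (Q + q) +F ε *F (X ^K (Q + 1))

  module Q' = Field Fq
  private
    _^q_ = pow Fq

  P0 P1 : Q'.Carrier × Q'.Carrier → Q'.Carrier × Q'.Carrier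
  P0 (x , y) = (x ^q (Q + 1) , y ^q (Q + 1))
  P1 (x , y) = (x ^q (Q + 1) , x Q'.*F (y ^q Q) Q'.+F y ^q (Q + 1))

  P2 P3 : Q'.Carrier → Q'.Carrier × Q'.Carrier → Q'.Carrier × Q'.Carrier
  P2 ε (x , y) = ((x ^q Q) Q'.*F y , x ^q (Q + 1) Q'.+F ε Q'.*F (y ^q (Q + 1)))
  P3 ε (x , y) = (x ^q (Q + 1) Q'.+F Q'.-F ((x ^q Q) Q'.*F y) ,
                  x Q'.*F (y ^q Q) Q'.+F ε Q'.*F (y ^q (Q + 1)))

  VK = FieldSpace K
  V2 = PairSpace Fq

  Conclusion : Carrier → Carrier → Carrier → Carrier → Set
  Conclusion c0 c1 c2 c3 =
    let f = fc c0 c1 c2 c3 in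
    LinEquiv VK V2 f P0 ⊎
    LinEquiv VK VK f f0 ⊎
    LinEquiv VK VK f f1 ⊎
    LinEquiv VK V2 f P1 ⊎
    (Σ Q'.Carrier λ ε → ¬ (ε ≡ Q'.0F) × LinEquiv VK V2 f (P2 ε)) ⊎
    (Σ Q'.Carrier λ ε → ¬ (ε ≡ Q'.0F) × ¬ (ε ≡ Q'.-F Q'.1F) ×
        LinEquiv VK V2 f (P3 ε)) ⊎
    (Σ Carrier λ ε → ¬ (ε ≡ 0F) × ¬ inMu ε × LinEquiv VK VK f (f2 ε))

{-# OPTIONS --safe #-}

-- With X̄ = X^q we have f(X) = c₀ X̄^Q X̄ + c₁ X̄^Q X + c₂ X^Q X̄ + c₃ X^Q X, so in coordinates over F_q
-- the map f is a pair (M, N) of forms in x^Q x, x^Q y, y^Q x, y^Q y, that is, a pencil of 2×2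
-- matrices.  That A has no root in μ means that f vanishes only at 0; that g is non-constant means
-- that M and N are linearly independent.  Since p is odd, elements of F_q are squares in F_{q²}, so
-- det (u M + v N) = 0 has a solution over F_{q²}.  If it has one over F_q, then some combination of M
-- and N is α^Q β with linear forms α, β over F_q; taking α and β (or α and a complement, when they
-- are proportional) as coordinates leaves P₀, P₁, P₂ and P₃.  Otherwise some M + v N with v outside
-- F_q is α^Q β over F_{q²}; as a map to F_{q²} it is linear equivalent to f, and α is a bijection
-- from F_q² to F_{q²}, in terms of which f becomes X^Q (a X + b X̄), hence f₀, f₁ or f₂.
-- The abstract F_q is first embedded into F_{q²}.

module Submission where

open import Defs
open import Data.Nat using (ℕ; _^_; _*_)
open import Data.Nat.Primality using (Prime)
open import Relation.Binary.PropositionalEquality using (_≡_)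
open import Relation.Nullary using (¬_)

open import Algebra.Bundles using (CommutativeRing; CommutativeSemiring)
import Algebra.Definitions.RawSemiring as RawSemiring
import Algebra.Properties.CommutativeMonoid.Sum as CMSum
import Algebra.Properties.CommutativeSemiring.Binomial as Binomial
import Algebra.Solver.Ring
open import Algebra.Solver.Ring.AlmostCommutativeRing using (AlmostCommutativeRing; fromCommutativeRing; _-Raw-AlmostCommutative⟶_)
open import Data.Empty using (⊥; ⊥-elim)
open import Data.Fin as Fin using (Fin; zero; suc; toℕ; fromℕ; inject₁; punchIn)
open import Data.Fin.Permutation using (Permutation′)
import Data.Fin.Properties as Fin
open import Data.Integer as ℤ using (ℤ; +_; -[1+_]; _⊖_; _◃_)
import Data.Integer.Properties as ℤ
open import Data.List using (List; []; _∷_; tabulate)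
open import Data.List.Membership.Propositional using (_∈_)
open import Data.List.Membership.Propositional.Properties using (∈-tabulate⁺)
open import Data.List.Relation.Unary.All as All using (All; []; _∷_)
import Data.Maybe as Maybe
open import Data.Nat as ℕ using (zero; suc; _!; _∸_; NonZero)
open import Data.Nat.Combinatorics using (nCk≡n!/k![n-k]!; k![n∸k]!∣n!; nCn≡1) renaming (_C_ to _choose_)
open import Data.Nat.Coprimality using (prime⇒coprime; coprime-Bézout)
open import Data.Nat.Divisibility as ∣ using (_∣_; _∤_; divides)
open import Data.Nat.DivMod using (_/_; _%_; m/n*n≡m; m≡m%n+[m/n]*n; m%n<n)
open import Data.Nat.GCD using (module Bézout)
open import Data.Nat.Primality using (euclidsLemma; prime⇒nonZero; prime⇒nonTrivial)
import Data.Nat.Properties as ℕ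
open import Data.Product using (Σ; ∃; _×_; _,_; proj₁; proj₂)
open import Data.Product.Function.NonDependent.Propositional using (_×-↔_)
open import Data.Sign as Sign using (Sign)
open import Data.Sum using (_⊎_; inj₁; inj₂)
open import Data.Vec using (Vec; []; _∷_; replicate; zipWith)
open import Function.Base using (_∘_; id)
open import Function.Bundles using (_↔_; Inverse; mk↔ₛ′)
open import Function.Construct.Composition using (_↔-∘_)
open import Function.Construct.Symmetry using (↔-sym)
open import Function.Definitions using (Injective; Surjective)
open import Relation.Binary.Definitions using (DecidableEquality)
open import Relation.Binary.PropositionalEquality using (_≢_; refl; sym; trans; cong; cong₂; subst; isEquivalence; module ≡-Reasoning)
open import Relation.Nullary using (Dec; yes; no; ¬?)
open import Relation.Nullary.Decidable using (map′; dec⇒maybe; decidable-stable)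
open import Relation.Unary using (Pred; Decidable)

-- Both fields are given only by their sizes, so everything about them rests on two counting
-- principles: a monic polynomial of degree n has at most n roots, and an injection between finite
-- sets of equal size is onto. In particular, a linear bijection is always obtained from an additive
-- map with trivial kernel. A form is handled through its coefficient matrix, with rows indexed by
-- the Q-th powers. A singular matrix is a column times a row, and the entries of the column are
-- Q-th powers because Frobenius is onto; this is where the product α^Q β comes from. Vanishing only
-- at 0 survives every linear equivalence. Evaluated at suitable points of an intermediate form, it
-- yields conditions such as invertible coefficients, ε ≠ -1 and ε ∉ μ, and the bijectivity of α.
-- When v lies outside F_q, the single map M + v N is as good as the pair because 1, v is a basis of
-- F_{q²} over F_q. The discriminant is a square in F_q or d times one, where d = θ² and θ̄ = -θ, so
-- that 1, θ serves as the basis throughout.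

-- The ring solver over a field

module FieldRing (F : Field) where
  open Field F

  +-idˡ : ∀ x → 0F +F x ≡ x
  +-idˡ x = trans (+-comm 0F x) (+-idʳ x)

  *-idˡ : ∀ x → 1F *F x ≡ x
  *-idˡ x = trans (*-comm 1F x) (*-idʳ x)

  distribʳ : ∀ x y z → (y +F z) *F x ≡ y *F x +F z *F x
  distribʳ x y z = trans (*-comm _ _) (trans (distribˡ x y z) (cong₂ _+F_ (*-comm x y) (*-comm x z)))

  commutativeRing : CommutativeRing _ _
  commutativeRing = record
    { Carrier = Carrier ; _≈_ = _≡_ ; _+_ = _+F_ ; _*_ = _*F_ ; -_ = -F_ ; 0# = 0F ; 1# = 1F
    ; isCommutativeRing = record
      { isRing = record
        { +-isAbelianGroup = record
          { isGroup = record
            { isMonoid = record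
              { isSemigroup = record
                { isMagma = record { isEquivalence = isEquivalence ; ∙-cong = cong₂ _+F_ }
                ; assoc = +-assoc }
              ; identity = +-idˡ , +-idʳ }
            ; inverse = (λ x → trans (+-comm (-F x) x) (+-invʳ x)) , +-invʳ
            ; ⁻¹-cong = cong -F_ }
          ; comm = +-comm }
        ; *-cong = cong₂ _*F_
        ; *-assoc = *-assoc
        ; *-identity = *-idˡ , *-idʳ
        ; distrib = distribˡ , distribʳ }
      ; *-comm = *-comm } }

  open import Algebra.Properties.Ring (CommutativeRing.ring commutativeRing) public
    using (-‿involutive; -0#≈0#; -‿distribˡ-*; -‿distribʳ-*; -‿+-comm)

  private
    -- The literals 0 and 1 must denote 0F and 1F on the nose for the solver's goals to match.
    ⟦_⟧ℕ : ℕ → Carrier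
    ⟦ 0 ⟧ℕ = 0F
    ⟦ 1 ⟧ℕ = 1F
    ⟦ suc (suc n) ⟧ℕ = 1F +F ⟦ suc n ⟧ℕ

    ⟦_⟧ℤ : ℤ → Carrier
    ⟦ + n ⟧ℤ = ⟦ n ⟧ℕ
    ⟦ -[1+ n ] ⟧ℤ = -F ⟦ suc n ⟧ℕ

    ⟦suc⟧ : ∀ n → ⟦ suc n ⟧ℕ ≡ 1F +F ⟦ n ⟧ℕ
    ⟦suc⟧ zero = sym (+-idʳ 1F)
    ⟦suc⟧ (suc n) = refl

    ⟦+⟧ℕ : ∀ m n → ⟦ m ℕ.+ n ⟧ℕ ≡ ⟦ m ⟧ℕ +F ⟦ n ⟧ℕ
    ⟦+⟧ℕ zero n = sym (+-idˡ _)
    ⟦+⟧ℕ (suc m) n = begin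
      ⟦ suc (m ℕ.+ n) ⟧ℕ          ≡⟨ ⟦suc⟧ (m ℕ.+ n) ⟩
      1F +F ⟦ m ℕ.+ n ⟧ℕ          ≡⟨ cong (1F +F_) (⟦+⟧ℕ m n) ⟩
      1F +F (⟦ m ⟧ℕ +F ⟦ n ⟧ℕ)    ≡⟨ +-assoc _ _ _ ⟨
      1F +F ⟦ m ⟧ℕ +F ⟦ n ⟧ℕ      ≡⟨ cong (_+F ⟦ n ⟧ℕ) (⟦suc⟧ m) ⟨
      ⟦ suc m ⟧ℕ +F ⟦ n ⟧ℕ ∎
      where open ≡-Reasoning

    ⟦*⟧ℕ : ∀ m n → ⟦ m ℕ.* n ⟧ℕ ≡ ⟦ m ⟧ℕ *F ⟦ n ⟧ℕ
    ⟦*⟧ℕ zero n = sym (CommutativeRing.zeroˡ commutativeRing ⟦ n ⟧ℕ)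
    ⟦*⟧ℕ (suc m) n = begin
      ⟦ n ℕ.+ m ℕ.* n ⟧ℕ                 ≡⟨ ⟦+⟧ℕ n (m ℕ.* n) ⟩
      ⟦ n ⟧ℕ +F ⟦ m ℕ.* n ⟧ℕ             ≡⟨ cong₂ _+F_ (sym (*-idˡ _)) (⟦*⟧ℕ m n) ⟩
      1F *F ⟦ n ⟧ℕ +F ⟦ m ⟧ℕ *F ⟦ n ⟧ℕ   ≡⟨ distribʳ _ _ _ ⟨
      (1F +F ⟦ m ⟧ℕ) *F ⟦ n ⟧ℕ           ≡⟨ cong (_*F ⟦ n ⟧ℕ) (⟦suc⟧ m) ⟨
      ⟦ suc m ⟧ℕ *F ⟦ n ⟧ℕ ∎
      where open ≡-Reasoning

    ⟦-⟧ℤ : ∀ i → ⟦ ℤ.- i ⟧ℤ ≡ -F ⟦ i ⟧ℤ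
    ⟦-⟧ℤ (+ zero) = sym -0#≈0#
    ⟦-⟧ℤ (+ suc n) = refl
    ⟦-⟧ℤ (-[1+ n ]) = sym (-‿involutive _)

    cancel-1 : ∀ x y → x +F -F y ≡ (1F +F x) +F -F (1F +F y)
    cancel-1 x y = sym (begin
      (1F +F x) +F -F (1F +F y)      ≡⟨ cong₂ _+F_ (+-comm 1F x) (sym (-‿+-comm 1F y)) ⟩
      (x +F 1F) +F (-F 1F +F -F y)   ≡⟨ +-assoc _ _ _ ⟩
      x +F (1F +F (-F 1F +F -F y))   ≡⟨ cong (x +F_) (+-assoc _ _ _) ⟨
      x +F ((1F +F -F 1F) +F -F y)   ≡⟨ cong (λ z → x +F (z +F -F y)) (+-invʳ 1F) ⟩
      x +F (0F +F -F y)              ≡⟨ cong (x +F_) (+-idˡ _) ⟩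
      x +F -F y ∎)
      where open ≡-Reasoning

    ⟦⊖⟧ : ∀ m n → ⟦ m ⊖ n ⟧ℤ ≡ ⟦ m ⟧ℕ +F -F ⟦ n ⟧ℕ
    ⟦⊖⟧ m zero = sym (trans (cong (⟦ m ⟧ℕ +F_) -0#≈0#) (+-idʳ _))
    ⟦⊖⟧ zero (suc n) = sym (+-idˡ _)
    ⟦⊖⟧ (suc m) (suc n) = begin
      ⟦ suc m ⊖ suc n ⟧ℤ                       ≡⟨ cong ⟦_⟧ℤ (ℤ.[1+m]⊖[1+n]≡m⊖n m n) ⟩
      ⟦ m ⊖ n ⟧ℤ                               ≡⟨ ⟦⊖⟧ m n ⟩
      ⟦ m ⟧ℕ +F -F ⟦ n ⟧ℕ                      ≡⟨ cancel-1 _ _ ⟩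
      (1F +F ⟦ m ⟧ℕ) +F -F (1F +F ⟦ n ⟧ℕ)      ≡⟨ cong₂ (λ x y → x +F -F y) (⟦suc⟧ m) (⟦suc⟧ n) ⟨
      ⟦ suc m ⟧ℕ +F -F ⟦ suc n ⟧ℕ ∎
      where open ≡-Reasoning

    ⟦+⟧ℤ : ∀ i j → ⟦ i ℤ.+ j ⟧ℤ ≡ ⟦ i ⟧ℤ +F ⟦ j ⟧ℤ
    ⟦+⟧ℤ (+ m) (+ n) = ⟦+⟧ℕ m n
    ⟦+⟧ℤ (+ m) (-[1+ n ]) = ⟦⊖⟧ m (suc n)
    ⟦+⟧ℤ (-[1+ m ]) (+ n) = trans (⟦⊖⟧ n (suc m)) (+-comm _ _)
    ⟦+⟧ℤ (-[1+ m ]) (-[1+ n ]) = begin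
      -F ⟦ suc (suc (m ℕ.+ n)) ⟧ℕ         ≡⟨ cong (λ k → -F ⟦ suc k ⟧ℕ) (ℕ.+-suc m n) ⟨
      -F ⟦ suc m ℕ.+ suc n ⟧ℕ             ≡⟨ cong -F_ (⟦+⟧ℕ (suc m) (suc n)) ⟩
      -F (⟦ suc m ⟧ℕ +F ⟦ suc n ⟧ℕ)       ≡⟨ -‿+-comm _ _ ⟨
      -F ⟦ suc m ⟧ℕ +F -F ⟦ suc n ⟧ℕ ∎
      where open ≡-Reasoning

    ⟦◃+⟧ : ∀ n → ⟦ Sign.+ ◃ n ⟧ℤ ≡ ⟦ n ⟧ℕ
    ⟦◃+⟧ zero = refl
    ⟦◃+⟧ (suc n) = refl

    ⟦◃-⟧ : ∀ n → ⟦ Sign.- ◃ n ⟧ℤ ≡ -F ⟦ n ⟧ℕ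
    ⟦◃-⟧ zero = sym -0#≈0#
    ⟦◃-⟧ (suc n) = refl

    ⟦*⟧ℤ : ∀ i j → ⟦ i ℤ.* j ⟧ℤ ≡ ⟦ i ⟧ℤ *F ⟦ j ⟧ℤ
    ⟦*⟧ℤ (+ m) (+ n) = trans (⟦◃+⟧ (m ℕ.* n)) (⟦*⟧ℕ m n)
    ⟦*⟧ℤ (+ m) (-[1+ n ]) =
      trans (⟦◃-⟧ (m ℕ.* suc n)) (trans (cong -F_ (⟦*⟧ℕ m (suc n))) (-‿distribʳ-* _ _))
    ⟦*⟧ℤ (-[1+ m ]) (+ n) =
      trans (⟦◃-⟧ (suc m ℕ.* n)) (trans (cong -F_ (⟦*⟧ℕ (suc m) n)) (-‿distribˡ-* _ _))
    ⟦*⟧ℤ (-[1+ m ]) (-[1+ n ]) = begin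
      ⟦ suc m ℕ.* suc n ⟧ℕ                 ≡⟨ ⟦*⟧ℕ (suc m) (suc n) ⟩
      ⟦ suc m ⟧ℕ *F ⟦ suc n ⟧ℕ             ≡⟨ -‿involutive _ ⟨
      -F (-F (⟦ suc m ⟧ℕ *F ⟦ suc n ⟧ℕ))   ≡⟨ cong -F_ (-‿distribʳ-* _ _) ⟩
      -F (⟦ suc m ⟧ℕ *F -F ⟦ suc n ⟧ℕ)     ≡⟨ -‿distribˡ-* _ _ ⟩
      -F ⟦ suc m ⟧ℕ *F -F ⟦ suc n ⟧ℕ ∎
      where open ≡-Reasoning

    almostCommutativeRing : AlmostCommutativeRing _ _
    almostCommutativeRing = fromCommutativeRing commutativeRing

    morphism : ℤ.+-*-rawRing -Raw-AlmostCommutative⟶ almostCommutativeRing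
    morphism = record
      { ⟦_⟧ = ⟦_⟧ℤ ; +-homo = ⟦+⟧ℤ ; *-homo = ⟦*⟧ℤ ; -‿homo = ⟦-⟧ℤ ; 0-homo = refl ; 1-homo = refl }

  open Algebra.Solver.Ring ℤ.+-*-rawRing almostCommutativeRing morphism
    (λ i j → Maybe.map (cong ⟦_⟧ℤ) (dec⇒maybe (i ℤ.≟ j))) public
    using (solve; _:=_; _:+_; _:*_; :-_; con; Polynomial)

-- Field arithmetic and polynomials in one variable

module FieldProperties (F : Field) where
  open Field F public
  open FieldRing F public

  zeroˡ : ∀ x → 0F *F x ≡ 0F
  zeroˡ = CommutativeRing.zeroˡ commutativeRing

  zeroʳ : ∀ x → x *F 0F ≡ 0F
  zeroʳ = CommutativeRing.zeroʳ commutativeRing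

  1≢0 : 1F ≢ 0F
  1≢0 = 0≢1 ∘ sym

  *-cancelˡ : ∀ {x y z} → x ≢ 0F → x *F y ≡ x *F z → y ≡ z
  *-cancelˡ {x} {y} {z} x≢0 eq = trans (sym (unit y)) (trans (cong (inv x *F_) eq) (unit z))
    where
    unit : ∀ w → inv x *F (x *F w) ≡ w
    unit w = trans (sym (*-assoc _ _ _))
      (trans (cong (_*F w) (trans (*-comm _ _) (*-invʳ x x≢0))) (*-idˡ w))

  x*y≡0⇒y≡0 : ∀ {x y} → x ≢ 0F → x *F y ≡ 0F → y ≡ 0F
  x*y≡0⇒y≡0 {x} x≢0 eq = *-cancelˡ x≢0 (trans eq (sym (zeroʳ x)))

  *-≢0 : ∀ {x y} → x ≢ 0F → y ≢ 0F → x *F y ≢ 0F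
  *-≢0 x≢0 y≢0 eq = y≢0 (x*y≡0⇒y≡0 x≢0 eq)

  inv-≢0 : ∀ {x} → x ≢ 0F → inv x ≢ 0F
  inv-≢0 {x} x≢0 eq = 0≢1 (trans (sym (zeroʳ x)) (trans (cong (x *F_) (sym eq)) (*-invʳ x x≢0)))

  x-y≡0⇒x≡y : ∀ {x y} → x +F -F y ≡ 0F → x ≡ y
  x-y≡0⇒x≡y {x} {y} eq = trans (solve 2 (λ x y → x := (x :+ :- y) :+ y) refl x y)
    (trans (cong (_+F y) eq) (+-idˡ y))

  -x≡0⇒x≡0 : ∀ {x} → -F x ≡ 0F → x ≡ 0F
  -x≡0⇒x≡0 {x} eq = trans (sym (-‿involutive x)) (trans (cong -F_ eq) -0#≈0#)

  -- Ideal membership: `k` is the cofactor of the hypothesis `l ≡ r`, so that what remains is a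
  -- polynomial identity for the ring solver. Nested calls use several hypotheses at once.
  modulo : ∀ {s t l r} k → l ≡ r → s ≡ t +F k *F (l +F -F r) → s ≡ t
  modulo {t = t} {r = r} k refl eq =
    trans eq (solve 3 (λ t k r → t :+ k :* (r :+ :- r) := t) refl t k r)

  ≢-resp : ∀ {x y} → x ≢ 0F → y ≡ x → y ≢ 0F
  ≢-resp x≢0 y≡x y≡0 = x≢0 (trans (sym y≡x) y≡0)

  𝟘 𝟙 : ∀ {k} → Polynomial k
  𝟘 = con (+ 0)
  𝟙 = con (+ 1)

  pow-+ : ∀ x m n → pow F x (m ℕ.+ n) ≡ pow F x m *F pow F x n
  pow-+ x zero n = sym (*-idˡ _)
  pow-+ x (suc m) n = trans (cong (x *F_) (pow-+ x m n)) (sym (*-assoc _ _ _))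

  pow-1 : ∀ x → pow F x 1 ≡ x
  pow-1 = *-idʳ

  pow-+1 : ∀ x m → pow F x (m ℕ.+ 1) ≡ pow F x m *F x
  pow-+1 x m = trans (pow-+ x m 1) (cong (pow F x m *F_) (pow-1 x))

  pow-*-base : ∀ x y n → pow F (x *F y) n ≡ pow F x n *F pow F y n
  pow-*-base x y zero = sym (*-idʳ 1F)
  pow-*-base x y (suc n) = trans (cong ((x *F y) *F_) (pow-*-base x y n))
    (solve 4 (λ x y a b → (x :* y) :* (a :* b) := (x :* a) :* (y :* b)) refl x y _ _)

  pow-1-base : ∀ n → pow F 1F n ≡ 1F
  pow-1-base zero = refl
  pow-1-base (suc n) = trans (*-idˡ _) (pow-1-base n)

  pow-pow : ∀ x m n → pow F x (m ℕ.* n) ≡ pow F (pow F x m) n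
  pow-pow x zero n = sym (pow-1-base n)
  pow-pow x (suc m) n = trans (pow-+ x n (m ℕ.* n))
    (trans (cong (pow F x n *F_) (pow-pow x m n)) (sym (pow-*-base x (pow F x m) n)))

  pow-≢0 : ∀ {x} n → x ≢ 0F → pow F x n ≢ 0F
  pow-≢0 zero x≢0 = 1≢0
  pow-≢0 (suc n) x≢0 = *-≢0 x≢0 (pow-≢0 n x≢0)

  times-+ : ∀ m n x → times F (m ℕ.+ n) x ≡ times F m x +F times F n x
  times-+ zero n x = sym (+-idˡ _)
  times-+ (suc m) n x = trans (cong (x +F_) (times-+ m n x)) (sym (+-assoc _ _ _))

  times-*ˡ : ∀ n x y → times F n x *F y ≡ times F n (x *F y)
  times-*ˡ zero x y = zeroˡ y
  times-*ˡ (suc n) x y = trans (distribʳ _ _ _) (cong (x *F y +F_) (times-*ˡ n x y))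

  times-1 : ∀ n x → times F n x ≡ times F n 1F *F x
  times-1 n x = sym (trans (times-*ˡ n 1F x) (cong (times F n) (*-idˡ x)))

  times-* : ∀ m n → times F (m ℕ.* n) 1F ≡ times F m 1F *F times F n 1F
  times-* zero n = sym (zeroˡ _)
  times-* (suc m) n = trans (times-+ n (m ℕ.* n) 1F)
    (trans (cong (times F n 1F +F_) (times-* m n))
      (solve 2 (λ a b → b :+ a :* b := (con (+ 1) :+ a) :* b) refl _ _))

  times-^ : ∀ m n → times F (m ℕ.^ n) 1F ≡ pow F (times F m 1F) n
  times-^ m zero = +-idʳ 1F
  times-^ m (suc n) = trans (times-* m (m ℕ.^ n)) (cong (times F m 1F *F_) (times-^ m n))

  -- A vector c₀ ∷ … ∷ cₙ₋₁ ∷ [] is read either as the polynomial c₀ + … + cₙ₋₁ Xⁿ⁻¹ (polyVal)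
  -- or as the monic polynomial c₀ + … + cₙ₋₁ Xⁿ⁻¹ + Xⁿ (monicVal).
  monicVal : ∀ {n} → Vec Carrier n → Carrier → Carrier
  monicVal [] x = 1F
  monicVal (c ∷ cs) x = c +F x *F monicVal cs x

  polyVal : ∀ {n} → Vec Carrier n → Carrier → Carrier
  polyVal [] x = 0F
  polyVal (c ∷ cs) x = c +F x *F polyVal cs x

  monicVal-polyVal : ∀ {n} (cs : Vec Carrier n) x → monicVal cs x ≡ polyVal cs x +F pow F x n
  monicVal-polyVal [] x = sym (+-idˡ 1F)
  monicVal-polyVal {suc n} (c ∷ cs) x = trans (cong (λ z → c +F x *F z) (monicVal-polyVal cs x))
    (solve 4 (λ c x a b → c :+ x :* (a :+ b) := (c :+ x :* a) :+ x :* b) refl c x _ _)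

  -- Horner's scheme for the quotient by X - s: its coefficients are the values at s of the tails of
  -- `cs`. The quotient is again monic, so its leading 1 stays implicit.
  synthDiv : ∀ {n} → Vec Carrier (suc n) → Carrier → Vec Carrier n
  synthDiv (c ∷ []) s = []
  synthDiv (c ∷ cs@(_ ∷ _)) s = monicVal cs s ∷ synthDiv cs s

  monicVal-synthDiv : ∀ {n} (cs : Vec Carrier (suc n)) s x →
    monicVal cs x ≡ (x +F -F s) *F monicVal (synthDiv cs s) x +F monicVal cs s
  monicVal-synthDiv (c ∷ []) s x =
    solve 3 (λ c s x → c :+ x :* con (+ 1) := (x :+ :- s) :* con (+ 1) :+ (c :+ s :* con (+ 1))) refl c s x
  monicVal-synthDiv (c ∷ cs@(_ ∷ _)) s x = trans (cong (λ z → c +F x *F z) (monicVal-synthDiv cs s x))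
    (solve 5 (λ c s x v r → c :+ x :* ((x :+ :- s) :* v :+ r)
                         := (x :+ :- s) :* (r :+ x :* v) :+ (c :+ s :* r)) refl c s x _ _)

  synthDiv-root : ∀ {n} (cs : Vec Carrier (suc n)) {s x} → s ≢ x →
    monicVal cs s ≡ 0F → monicVal cs x ≡ 0F → monicVal (synthDiv cs s) x ≡ 0F
  synthDiv-root cs {s} {x} s≢x ps px =
    x*y≡0⇒y≡0 (s≢x ∘ sym ∘ x-y≡0⇒x≡y)
      (trans (sym (+-idʳ _)) (trans (cong (λ z → (x +F -F s) *F monicVal (synthDiv cs s) x +F z) (sym ps))
        (trans (sym (monicVal-synthDiv cs s x)) px)))

  -- Dividing by X - `r zero` lowers the degree and keeps the other points as roots; in degree zero
  -- the polynomial is the constant 1.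
  fewRoots : ∀ {n} (cs : Vec Carrier n) (r : Fin (suc n) → Carrier) → Injective _≡_ _≡_ r →
    ¬ (∀ i → monicVal cs (r i) ≡ 0F)
  fewRoots [] r inj roots = 1≢0 (roots zero)
  fewRoots cs@(_ ∷ _) r inj roots = fewRoots (synthDiv cs (r zero)) (r ∘ suc) (Fin.suc-injective ∘ inj)
    λ i → synthDiv-root cs (λ eq → Fin.0≢1+n (inj eq)) (roots zero) (roots (suc i))

  -- The bound `1 < n` keeps X apart from the implicit leading term Xⁿ.
  X^-X : ∀ n → 1 ℕ.< n → Vec Carrier n
  X^-X (suc zero) (ℕ.s≤s ())
  X^-X (suc (suc n)) _ = 0F ∷ -F 1F ∷ replicate n 0F

  monicVal-X^-X : ∀ n 1<n x → pow F x n ≡ x → monicVal (X^-X n 1<n) x ≡ 0F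
  monicVal-X^-X (suc zero) (ℕ.s≤s ())
  monicVal-X^-X (suc (suc n)) _ x eq = trans (cong (λ z → 0F +F x *F (-F 1F +F x *F z)) (monicVal-X^ n))
    (trans (solve 2 (λ x z → con (+ 0) :+ x :* (:- con (+ 1) :+ x :* z) := x :* (x :* z) :+ :- x) refl x _)
      (trans (cong (_+F -F x) eq) (+-invʳ x)))
    where
    monicVal-X^ : ∀ n → monicVal (replicate n 0F) x ≡ pow F x n
    monicVal-X^ zero = refl
    monicVal-X^ (suc n) = trans (+-idˡ _) (cong (x *F_) (monicVal-X^ n))

  -- A polynomial function of degree below n: with Xⁿ added it becomes monic and `fewRoots` applies.
  IsPoly : ℕ → (Carrier → Carrier) → Set
  IsPoly n g = Σ (Vec Carrier n) λ cs → ∀ x → polyVal cs x ≡ g x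

  isPoly-0 : ∀ n → IsPoly n (λ _ → 0F)
  isPoly-0 n = replicate n 0F , go n
    where
    go : ∀ n x → polyVal (replicate n 0F) x ≡ 0F
    go zero x = refl
    go (suc n) x = trans (+-idˡ _) (trans (cong (x *F_) (go n x)) (zeroʳ x))

  isPoly-+ : ∀ {n f g} → IsPoly n f → IsPoly n g → IsPoly n (λ x → f x +F g x)
  isPoly-+ (as , fa) (bs , gb) = zipWith _+F_ as bs , λ x → trans (go as bs x) (cong₂ _+F_ (fa x) (gb x))
    where
    go : ∀ {n} (as bs : Vec Carrier n) x →
      polyVal (zipWith _+F_ as bs) x ≡ polyVal as x +F polyVal bs x
    go [] [] x = sym (+-idˡ 0F)
    go (a ∷ as) (b ∷ bs) x = trans (cong (λ z → a +F b +F x *F z) (go as bs x))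
      (solve 5 (λ a b x u v → a :+ b :+ x :* (u :+ v) := (a :+ x :* u) :+ (b :+ x :* v)) refl a b x _ _)

  isPoly-pow : ∀ {n} i → i ℕ.< n → IsPoly n (λ x → pow F x i)
  isPoly-pow {suc n} zero _ = let (cs , eq) = isPoly-0 n in
    1F ∷ cs , λ x → trans (cong (λ z → 1F +F x *F z) (eq x)) (trans (cong (1F +F_) (zeroʳ x)) (+-idʳ 1F))
  isPoly-pow {suc n} (suc i) (ℕ.s≤s i<n) = let (cs , eq) = isPoly-pow i i<n in
    0F ∷ cs , λ x → trans (+-idˡ _) (cong (x *F_) (eq x))

-- Finite sets: decidability and the pigeonhole principle

module Finite {A : Set} {n : ℕ} (enum : A ↔ Fin n) where
  open Inverse enum using (to; from; strictlyInverseˡ; strictlyInverseʳ)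

  to-injective : Injective _≡_ _≡_ to
  to-injective {x} {y} eq = trans (sym (strictlyInverseʳ x)) (trans (cong from eq) (strictlyInverseʳ y))

  from-injective : Injective _≡_ _≡_ from
  from-injective {x} {y} eq = trans (sym (strictlyInverseˡ x)) (trans (cong to eq) (strictlyInverseˡ y))

  infix 4 _≟_
  _≟_ : DecidableEquality A
  x ≟ y = map′ to-injective (cong to) (to x Fin.≟ to y)

  any? : ∀ {ℓ} {P : Pred A ℓ} → Decidable P → Dec (∃ P)
  any? {P = P} P? = map′ (λ (i , p) → from i , p)
    (λ (x , p) → to x , subst P (sym (strictlyInverseʳ x)) p) (Fin.any? (P? ∘ from))

-- If `y` were missed, punching it out would leave an injection into a set with one element fewer.
Fin-injective⇒surjective : ∀ {n} (f : Fin n → Fin n) → Injective _≡_ _≡_ f → ∀ y → ∃ λ x → f x ≡ y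
Fin-injective⇒surjective {suc n} f inj y with Fin.any? (λ x → f x Fin.≟ y)
... | yes hit = hit
... | no miss = ⊥-elim (ℕ.1+n≰n (Fin.injective⇒≤ {f = λ x → Fin.punchOut (avoid x)}
    (λ eq → inj (Fin.punchOut-injective (avoid _) (avoid _) eq))))
  where
  avoid : ∀ x → y ≢ f x
  avoid x eq = miss (x , sym eq)

injective⇒surjective : ∀ {A B : Set} {n} → A ↔ Fin n → B ↔ Fin n → (f : A → B) →
  Injective _≡_ _≡_ f → ∀ y → ∃ λ x → f x ≡ y
injective⇒surjective enumA enumB f inj y =
  let (i , eq) = Fin-injective⇒surjective (Inverse.to enumB ∘ f ∘ Inverse.from enumA)
                   (FA.from-injective ∘ inj ∘ FB.to-injective) (Inverse.to enumB y)
  in Inverse.from enumA i , FB.to-injective eq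
  where
  module FA = Finite enumA
  module FB = Finite enumB

-- Finite fields

-- Multiplication by a nonzero `a` permutes the nonzero elements and hence keeps their product. The
-- product runs over the whole enumeration, so `nz` replaces zero by 1, and `h y` is the factor by
-- which `nz` changes at y: 1 at zero and `a` elsewhere. Removing the index of zero leaves `m`
-- factors `a`.
fermat : ∀ F n → HasSize F n → ∀ x → pow F x n ≡ x
fermat F zero enum x with () ← Inverse.to enum x
fermat F (suc m) enum a = case-zero (a ≟ 0F)
  where
  open FieldProperties F
  open Finite enum
  open Inverse enum using (to; from; strictlyInverseˡ; strictlyInverseʳ)
  module Π = CMSum (CommutativeRing.*-commutativeMonoid commutativeRing)
  open ≡-Reasoning

  orOne : ∀ {y} → Dec (y ≡ 0F) → Carrier → Carrier
  orOne (yes _) z = 1F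
  orOne (no _) z = z

  nz : Carrier → Carrier
  nz y = orOne (y ≟ 0F) y

  nz-≢0 : ∀ y → nz y ≢ 0F
  nz-≢0 y with y ≟ 0F
  ... | yes _ = 1≢0
  ... | no y≢0 = y≢0

  module _ (a≢0 : a ≢ 0F) where
    h : Carrier → Carrier
    h y = orOne (y ≟ 0F) a

    nz-* : ∀ y → nz (a *F y) ≡ h y *F nz y
    nz-* y with y ≟ 0F | a *F y ≟ 0F
    ... | yes _   | yes _ = sym (*-idʳ 1F)
    ... | yes y≡0 | no ay≢0 = ⊥-elim (ay≢0 (trans (cong (a *F_) y≡0) (zeroʳ a)))
    ... | no y≢0  | yes ay≡0 = ⊥-elim (*-≢0 a≢0 y≢0 ay≡0)
    ... | no _    | no _ = refl

    π : Permutation′ (suc m)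
    π = mk↔ₛ′ (λ i → to (a *F from i)) (λ i → to (inv a *F from i))
      (λ i → trans (cong (to ∘ (a *F_)) (strictlyInverseʳ _))
        (trans (cong to (cancel a (inv a) (*-invʳ a a≢0) _)) (strictlyInverseˡ i)))
      (λ i → trans (cong (to ∘ (inv a *F_)) (strictlyInverseʳ _))
        (trans (cong to (cancel (inv a) a (trans (*-comm _ _) (*-invʳ a a≢0)) _)) (strictlyInverseˡ i)))
      where
      cancel : ∀ b c → b *F c ≡ 1F → ∀ x → b *F (c *F x) ≡ x
      cancel b c bc≡1 x = trans (sym (*-assoc _ _ _)) (trans (cong (_*F x) bc≡1) (*-idˡ x))

    P H rest : Carrier
    P = Π.sum (nz ∘ from)
    H = Π.sum (h ∘ from)
    rest = Π.sum (λ j → h (from (punchIn (to 0F) j)))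

    prod-≢0 : ∀ {k} (t : Fin k → Carrier) → (∀ i → t i ≢ 0F) → Π.sum t ≢ 0F
    prod-≢0 {zero} t t≢0 = 1≢0
    prod-≢0 {suc k} t t≢0 = *-≢0 (t≢0 zero) (prod-≢0 (t ∘ suc) (t≢0 ∘ suc))

    P≡H*P : P ≡ H *F P
    P≡H*P = begin
      P                                          ≡⟨ Π.sum-permute (nz ∘ from) π ⟩
      Π.sum (λ i → nz (from (to (a *F from i))))
        ≡⟨ Π.sum-cong-≗ (λ i → trans (cong nz (strictlyInverseʳ _)) (nz-* (from i))) ⟩
      Π.sum (λ i → h (from i) *F nz (from i))    ≡⟨ Π.∑-distrib-+ (h ∘ from) (nz ∘ from) ⟩
      H *F P ∎

    H≡1 : H ≡ 1F
    H≡1 = *-cancelˡ (prod-≢0 (nz ∘ from) (λ i → nz-≢0 (from i)))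
      (trans (*-comm P H) (trans (sym P≡H*P) (sym (*-idʳ P))))

    h-at-0 : h (from (to 0F)) ≡ 1F
    h-at-0 with from (to 0F) ≟ 0F
    ... | yes _ = refl
    ... | no neq = ⊥-elim (neq (strictlyInverseʳ 0F))

    h-off-0 : ∀ j → h (from (punchIn (to 0F) j)) ≡ a
    h-off-0 j with from (punchIn (to 0F) j) ≟ 0F
    ... | yes eq = ⊥-elim (Fin.punchInᵢ≢i (to 0F) j (trans (sym (strictlyInverseˡ _)) (cong to eq)))
    ... | no _ = refl

    prod-const : ∀ k → Π.sum {k} (λ _ → a) ≡ pow F a k
    prod-const zero = refl
    prod-const (suc k) = cong (a *F_) (prod-const k)

    a^m≡1 : pow F a m ≡ 1F
    a^m≡1 = begin
      pow F a m                        ≡⟨ prod-const m ⟨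
      Π.sum {m} (λ _ → a)              ≡⟨ Π.sum-cong-≗ h-off-0 ⟨
      rest                             ≡⟨ *-idˡ rest ⟨
      1F *F rest                       ≡⟨ cong (_*F rest) h-at-0 ⟨
      h (from (to 0F)) *F rest         ≡⟨ Π.sum-remove {i = to 0F} (h ∘ from) ⟨
      H                                ≡⟨ H≡1 ⟩
      1F ∎

  case-zero : Dec (a ≡ 0F) → pow F a (suc m) ≡ a
  case-zero (yes a≡0) = trans (cong (_*F pow F a m) a≡0) (trans (zeroˡ _) (sym a≡0))
  case-zero (no a≢0) = trans (cong (a *F_) (a^m≡1 a≢0)) (*-idʳ a)

-- The additive counterpart: translation by 1 permutes the field, so the sum S of all elements
-- satisfies S = S + n · 1.
times-size : ∀ F n → HasSize F n → times F n (Field.1F F) ≡ Field.0F F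
times-size F n enum = begin
  times F n 1F                        ≡⟨ sum-const n ⟨
  ∑1                                  ≡⟨ solve 2 (λ s t → t := (s :+ t) :+ :- s) refl S ∑1 ⟩
  (S +F ∑1) +F -F S                   ≡⟨ cong (_+F -F S) (sym S≡S+∑1) ⟩
  S +F -F S                           ≡⟨ +-invʳ S ⟩
  0F ∎
  where
  open FieldProperties F
  open Inverse enum using (to; from; strictlyInverseˡ; strictlyInverseʳ)
  module Σ′ = CMSum (CommutativeRing.+-commutativeMonoid commutativeRing)
  open ≡-Reasoning

  S ∑1 : Carrier
  S = Σ′.sum from
  ∑1 = Σ′.sum {n} (λ _ → 1F)

  sum-const : ∀ k → Σ′.sum {k} (λ _ → 1F) ≡ times F k 1F
  sum-const zero = refl
  sum-const (suc k) = cong (1F +F_) (sum-const k)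

  π : Permutation′ n
  π = mk↔ₛ′ (λ i → to (from i +F 1F)) (λ i → to (from i +F -F 1F))
    (λ i → trans (cong (to ∘ (_+F 1F)) (strictlyInverseʳ _))
      (trans (cong to (solve 1 (λ x → (x :+ :- con (ℤ.+ 1)) :+ con (ℤ.+ 1) := x) refl _)) (strictlyInverseˡ i)))
    (λ i → trans (cong (to ∘ (_+F -F 1F)) (strictlyInverseʳ _))
      (trans (cong to (solve 1 (λ x → (x :+ con (ℤ.+ 1)) :+ :- con (ℤ.+ 1) := x) refl _)) (strictlyInverseˡ i)))

  S≡S+∑1 : S ≡ S +F ∑1
  S≡S+∑1 = begin
    S                                        ≡⟨ Σ′.sum-permute from π ⟩
    Σ′.sum (λ i → from (to (from i +F 1F)))  ≡⟨ Σ′.sum-cong-≗ {n} (λ i → strictlyInverseʳ _) ⟩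
    Σ′.sum (λ i → from i +F 1F)              ≡⟨ Σ′.∑-distrib-+ from (λ _ → 1F) ⟩
    S +F ∑1 ∎

-- Characteristic p and the additivity of Frobenius

prime∤k! : ∀ {p} → Prime p → ∀ k → k ℕ.< p → p ∤ k !
prime∤k! {p} pr zero k<p p∣1 = ℕ.<⇒≱ (ℕ.nonTrivial⇒n>1 p {{prime⇒nonTrivial pr}}) (∣.∣⇒≤ p∣1)
prime∤k! {p} pr (suc k) k<p p∣k! with euclidsLemma (suc k) (k !) pr p∣k!
... | inj₁ p∣k = ℕ.<⇒≱ k<p (∣.∣⇒≤ p∣k)
... | inj₂ p∣rest = prime∤k! pr k (ℕ.<-trans (ℕ.n<1+n k) k<p) p∣rest

-- The prime divides p! = C(p, k) · k! (p - k)!, but none of the factorials of smaller numbers.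
prime∣pCk : ∀ {p} → Prime p → ∀ k → 0 ℕ.< k → k ℕ.< p → p ∣ p choose k
prime∣pCk {p} pr k 0<k k<p with euclidsLemma (p choose k) (k ! ℕ.* (p ∸ k) !) pr p∣product
  where
  instance
    _ : NonZero (k ! ℕ.* (p ∸ k) !)
    _ = k ℕ.!* (p ∸ k) !≢0
    _ : NonZero p
    _ = prime⇒nonZero pr
  n∣n! : ∀ n → .{{NonZero n}} → n ∣ n !
  n∣n! (suc n) = ∣.m∣m*n (n !)
  p∣product : p ∣ (p choose k) ℕ.* (k ! ℕ.* (p ∸ k) !)
  p∣product = subst (p ∣_)
    (sym (trans (cong (ℕ._* (k ! ℕ.* (p ∸ k) !)) (nCk≡n!/k![n-k]! (ℕ.<⇒≤ k<p)))
      (m/n*n≡m (k![n∸k]!∣n! (ℕ.<⇒≤ k<p))))) (n∣n! p)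
... | inj₁ p∣C = p∣C
... | inj₂ p∣k!*r! with euclidsLemma (k !) ((p ∸ k) !) pr p∣k!*r!
...   | inj₁ p∣k! = ⊥-elim (prime∤k! pr k k<p p∣k!)
...   | inj₂ p∣r! = ⊥-elim (prime∤k! pr (p ∸ k) (ℕ.∸-monoʳ-< 0<k (ℕ.<⇒≤ k<p)) p∣r!)

module CharP (F : Field) {p : ℕ} (pr : Prime p) (p·1≡0 : times F p (Field.1F F) ≡ Field.0F F) where
  open FieldProperties F

  times-∣ : ∀ {n} → p ∣ n → ∀ x → times F n x ≡ 0F
  times-∣ (divides m refl) x = trans (times-1 (m ℕ.* p) x)
    (trans (cong (_*F x) (trans (times-* m p) (trans (cong (times F m 1F *F_) p·1≡0) (zeroʳ _)))) (zeroˡ x))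

  times-% : ∀ n → .{{_ : NonZero p}} → times F n 1F ≡ times F (n % p) 1F
  times-% n = trans (cong (λ k → times F k 1F) (m≡m%n+[m/n]*n n p))
    (trans (times-+ (n % p) (n / p ℕ.* p) 1F)
      (trans (cong (times F (n % p) 1F +F_) (times-∣ (∣.n∣m*n (n / p)) 1F)) (+-idʳ _)))

  multiple : ∀ k {m} → times F m 1F ≡ 0F → times F (k ℕ.* m) 1F ≡ 0F
  multiple k {m} m·1≡0 = trans (times-* k m) (trans (cong (times F k 1F *F_) m·1≡0) (zeroʳ _))

  -- A Bézout identity read in the field: both sides but the summand 1 vanish. It serves both
  -- orientations in which coprimality is delivered.
  1-vanishes : ∀ x y {m n} → times F m 1F ≡ 0F → times F n 1F ≡ 0F → 1 ℕ.+ x ℕ.* m ≡ y ℕ.* n → ⊥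
  1-vanishes x y m·1≡0 n·1≡0 eq = 0≢1 (sym (trans
    (trans (sym (+-idʳ 1F)) (cong (1F +F_) (sym (multiple x m·1≡0))))
    (trans (cong (λ k → times F k 1F) eq) (multiple y n·1≡0))))

  times-1-≢0 : ∀ n → .{{NonZero n}} → n ℕ.< p → times F n 1F ≢ 0F
  times-1-≢0 n n<p n·1≡0 with coprime-Bézout (prime⇒coprime pr n<p)
  ... | Bézout.+- x y eq = 1-vanishes y x n·1≡0 p·1≡0 eq
  ... | Bézout.-+ x y eq = 1-vanishes x y p·1≡0 n·1≡0 eq

  times-1-injective : ∀ {m n} → m ℕ.≤ n → n ℕ.< p → times F m 1F ≡ times F n 1F → m ≡ n
  times-1-injective {m} {n} m≤n n<p eq with n ∸ m in n∸m
  ... | zero = ℕ.≤-antisym m≤n (ℕ.m∸n≡0⇒m≤n n∸m)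
  ... | d@(suc _) = ⊥-elim (times-1-≢0 d (ℕ.≤-<-trans (subst (ℕ._≤ n) n∸m (ℕ.m∸n≤m n m)) n<p) d·1≡0)
    where
    open ≡-Reasoning
    d·1≡0 : times F d 1F ≡ 0F
    d·1≡0 = begin
      times F d 1F                                     ≡⟨ solve 2 (λ a b → a := (b :+ a) :+ :- b) refl _ (times F m 1F) ⟩
      (times F m 1F +F times F d 1F) +F -F times F m 1F ≡⟨ cong (_+F _) (times-+ m d 1F) ⟨
      times F (m ℕ.+ d) 1F +F -F times F m 1F
        ≡⟨ cong (λ k → times F k 1F +F -F times F m 1F)
             (trans (cong (m ℕ.+_) (sym n∸m)) (ℕ.m+[n∸m]≡n m≤n)) ⟩
      times F n 1F +F -F times F m 1F                  ≡⟨ cong (λ z → times F n 1F +F -F z) eq ⟩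
      times F n 1F +F -F times F n 1F                  ≡⟨ +-invʳ _ ⟩
      0F ∎

  times-1-unique : ∀ {m n} → .{{_ : NonZero p}} → m ℕ.< p → times F m 1F ≡ times F n 1F → m ≡ n % p
  times-1-unique {m} {n} m<p eq with ℕ.≤-total m (n % p)
  ... | inj₁ m≤r = times-1-injective m≤r (m%n<n n p) (trans eq (times-% n))
  ... | inj₂ r≤m = sym (times-1-injective r≤m m<p (sym (trans eq (times-% n))))

  frobenius-+ : ∀ x y → pow F (x +F y) p ≡ pow F x p +F pow F y p
  frobenius-+ x y = expand p pr p·1≡0 refl
    where
    open CommutativeRing commutativeRing using (commutativeSemiring; +-commutativeMonoid)
    module ∑ = CMSum +-commutativeMonoid
    open RawSemiring (CommutativeSemiring.rawSemiring commutativeSemiring) using ()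
      renaming (_×_ to infixr 8 _⋆_; _^_ to infixr 8 _↑_)
    open Binomial commutativeSemiring using (theorem; binomial; binomialTerm)
    open ≡-Reasoning

    ↑≡pow : ∀ z n → z ↑ n ≡ pow F z n
    ↑≡pow z zero = refl
    ↑≡pow z (suc n) = cong (z *F_) (↑≡pow z n)

    ⋆≡times : ∀ n z → n ⋆ z ≡ times F n z
    ⋆≡times zero z = refl
    ⋆≡times (suc n) z = cong (z +F_) (⋆≡times n z)

    -- `p` is generalised to `n` so that matching it with a successor exposes the first and last
    -- binomial terms; those in between have coefficients divisible by p.
    expand : ∀ n → Prime n → times F n 1F ≡ 0F → n ≡ p → pow F (x +F y) n ≡ pow F x n +F pow F y n
    expand (suc n) pr′ _ refl = begin
      pow F (x +F y) (suc n)                     ≡⟨ ↑≡pow (x +F y) (suc n) ⟨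
      (x +F y) ↑ suc n                           ≡⟨ theorem (suc n) x y ⟩
      term zero +F ∑.sum (term ∘ suc)            ≡⟨ cong (term zero +F_) (∑.sum-init-last (term ∘ suc)) ⟩
      term zero +F (∑.sum (λ i → term (suc (inject₁ i))) +F term (suc (fromℕ n)))
        ≡⟨ cong₂ (λ u v → u +F (v +F term (suc (fromℕ n)))) first-term middle ⟩
      pow F y (suc n) +F (0F +F term (suc (fromℕ n)))
        ≡⟨ cong (λ v → pow F y (suc n) +F (0F +F v)) last-term ⟩
      pow F y (suc n) +F (0F +F pow F x (suc n)) ≡⟨ cong (pow F y (suc n) +F_) (+-idˡ _) ⟩
      pow F y (suc n) +F pow F x (suc n)         ≡⟨ +-comm _ _ ⟩
      pow F x (suc n) +F pow F y (suc n) ∎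
      where
      term : Fin (suc (suc n)) → Carrier
      term = binomialTerm x y (suc n)

      first-term : term zero ≡ pow F y (suc n)
      first-term = trans (+-idʳ _) (trans (*-idˡ _) (↑≡pow y (suc n)))

      last-term : term (suc (fromℕ n)) ≡ pow F x (suc n)
      last-term = trans (cong (λ k → (suc n choose suc k) ⋆ (x ↑ suc k *F y ↑ (n ∸ k))) (Fin.toℕ-fromℕ n))
        (trans (cong₂ (λ c d → c ⋆ (x ↑ suc n *F y ↑ d)) (nCn≡1 (suc n)) (ℕ.n∸n≡0 n))
          (trans (+-idʳ _) (trans (*-idʳ _) (↑≡pow x (suc n)))))

      middle : ∑.sum (λ i → term (suc (inject₁ i))) ≡ 0F
      middle = trans (∑.sum-cong-≗ {n} λ i →
          let k = suc (inject₁ i) ; z = binomial x y (suc n) k in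
          trans (⋆≡times (suc n choose toℕ k) z)
            (times-∣ (prime∣pCk pr (toℕ k) (ℕ.s≤s ℕ.z≤n) (ℕ.s≤s (Fin.inject₁ℕ< i))) z))
        (∑.sum-replicate-zero n)

  frobenius^-+ : ∀ m x y → pow F (x +F y) (p ℕ.^ m) ≡ pow F x (p ℕ.^ m) +F pow F y (p ℕ.^ m)
  frobenius^-+ zero x y = trans (pow-1 _) (sym (cong₂ _+F_ (pow-1 x) (pow-1 y)))
  frobenius^-+ (suc m) x y = begin
    pow F (x +F y) (p ℕ.* p ℕ.^ m)                            ≡⟨ pow-pow (x +F y) p (p ℕ.^ m) ⟩
    pow F (pow F (x +F y) p) (p ℕ.^ m)                        ≡⟨ cong (λ z → pow F z (p ℕ.^ m)) (frobenius-+ x y) ⟩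
    pow F (pow F x p +F pow F y p) (p ℕ.^ m)                  ≡⟨ frobenius^-+ m _ _ ⟩
    pow F (pow F x p) (p ℕ.^ m) +F pow F (pow F y p) (p ℕ.^ m) ≡⟨ cong₂ _+F_ (pow-pow x p _) (pow-pow y p _) ⟨
    pow F x (p ℕ.* p ℕ.^ m) +F pow F y (p ℕ.* p ℕ.^ m) ∎
    where open ≡-Reasoning

prime⇒>1 : ∀ {p} → Prime p → 1 ℕ.< p
prime⇒>1 {p} pr = ℕ.nonTrivial⇒n>1 p {{prime⇒nonTrivial pr}}

1<p^ : ∀ {p} → Prime p → ∀ k → k ≢ 0 → 1 ℕ.< p ℕ.^ k
1<p^ pr zero k≢0 = ⊥-elim (k≢0 refl)
1<p^ {p} pr (suc k) _ = ℕ.<-≤-trans (prime⇒>1 pr) (ℕ.m≤m*n p (p ℕ.^ k) {{ℕ.m^n≢0 p k {{prime⇒nonZero pr}}}})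

-- The m-th power of p · 1 is p^m · 1, which is zero because p^m is the size; a field has no
-- nilpotent elements.
charP : ∀ F p m → HasSize F (p ℕ.^ m) → times F p (Field.1F F) ≡ Field.0F F
charP F p m size = decidable-stable (times F p 1F ≟ 0F)
  λ p·1≢0 → pow-≢0 m p·1≢0 (trans (sym (times-^ p m)) (times-size F (p ℕ.^ m) size))
  where
  open FieldProperties F
  open Finite size

-- A root outside the list would make more roots than the degree allows. This identifies the fixed
-- points of a Frobenius power with the elements of a subfield.
allRoots : ∀ F → let open FieldProperties F in DecidableEquality Carrier →
  ∀ {n} (cs : Vec Carrier n) (r : Fin n → Carrier) → Injective _≡_ _≡_ r →
  (∀ i → monicVal cs (r i) ≡ 0F) → ∀ x → monicVal cs x ≡ 0F → ∃ λ i → r i ≡ x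
allRoots F _≟_ {n} cs r inj roots x root with Fin.any? (λ i → r i ≟ x)
... | yes found = found
... | no missing = ⊥-elim (fewRoots cs r⁺ r⁺-injective λ { zero → root ; (suc i) → roots i })
  where
  open FieldProperties F
  r⁺ : Fin (suc n) → Carrier
  r⁺ zero = x
  r⁺ (suc i) = r i
  r⁺-injective : Injective _≡_ _≡_ r⁺
  r⁺-injective {zero} {zero} _ = refl
  r⁺-injective {zero} {suc j} eq = ⊥-elim (missing (j , sym eq))
  r⁺-injective {suc i} {zero} eq = ⊥-elim (missing (i , eq))
  r⁺-injective {suc i} {suc j} eq = cong suc (inj eq)

-- Embeddings of finite fields

-- apply cs is the value of the monic polynomial cs at the operator f ↦ f ∘ m.
module ShiftOperator (K : Field) {A : Set} (m : A → A) where
  open FieldProperties K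

  apply : ∀ {n} → Vec Carrier n → (A → Carrier) → A → Carrier
  apply [] f x = f x
  apply (c ∷ cs) f x = c *F f x +F apply cs f (m x)

  apply-synthDiv : ∀ {n} (cs : Vec Carrier (suc n)) s f x → let g = apply (synthDiv cs s) f in
    apply cs f x ≡ (g (m x) +F -F (s *F g x)) +F monicVal cs s *F f x
  apply-synthDiv (c ∷ []) s f x =
    solve 4 (λ c s u v → c :* u :+ v := (v :+ :- (s :* u)) :+ (c :+ s :* con (+ 1)) :* u) refl c s _ _
  apply-synthDiv (c ∷ cs@(_ ∷ _)) s f x = trans (cong (λ z → c *F f x +F z) (apply-synthDiv cs s f (m x)))
    (solve 7 (λ c s u v r g g′ → c :* u :+ ((g′ :+ :- (s :* g)) :+ r :* v)
        := ((r :* v :+ g′) :+ :- (s :* (r :* u :+ g))) :+ (c :+ s :* r) :* u)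
      refl c s (f x) (f (m x)) (monicVal cs s) _ _)

  -- Split off one linear factor X - s of the annihilating polynomial. If the cofactor applied to f
  -- is nonzero, it is an eigenvector with eigenvalue s; otherwise the cofactor annihilates f and
  -- has smaller degree. The result is returned as a polynomial `qs` in the operator, because this
  -- form preserves additivity and the eigenvalues of commuting operators.
  eigenvector : ∀ {k} → A ↔ Fin k → DecidableEquality Carrier →
    ∀ {n} (cs : Vec Carrier n) (r : Fin n → Carrier) → Injective _≡_ _≡_ r →
    (∀ i → monicVal cs (r i) ≡ 0F) → ∀ f → (∀ x → apply cs f x ≡ 0F) → ∃ (λ x → f x ≢ 0F) →
    Σ ℕ λ j → Σ (Vec Carrier j) λ qs → ∃ (λ x → apply qs f x ≢ 0F) ×
      ∃ λ s → ∀ x → apply qs f (m x) ≡ s *F apply qs f x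
  eigenvector enum _≟_ [] r inj roots f kills (x , fx≢0) = ⊥-elim (fx≢0 (kills x))
  eigenvector enum _≟_ cs@(_ ∷ _) r inj roots f kills f≢0
    with Finite.any? enum (λ x → ¬? (apply (synthDiv cs (r zero)) f x ≟ 0F))
  ... | yes nonzero = _ , synthDiv cs (r zero) , nonzero , r zero , λ x →
        let q = apply (synthDiv cs (r zero)) f in x-y≡0⇒x≡y
        (trans (sym (+-idʳ _)) (trans
          (cong (λ z → (q (m x) +F -F (r zero *F q x)) +F z) (sym (trans (cong (_*F f x) (roots zero)) (zeroˡ (f x)))))
          (trans (sym (apply-synthDiv cs (r zero) f x)) (kills x))))
  ... | no vanishes = eigenvector enum _≟_ (synthDiv cs (r zero)) (r ∘ suc) (Fin.suc-injective ∘ inj)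
        (λ i → synthDiv-root cs (λ eq → Fin.0≢1+n (inj eq)) (roots zero) (roots (suc i)))
        f (λ x → decidable-stable (_ ≟ 0F) λ ≢0 → vanishes (x , ≢0)) f≢0

record Embedding (L K : Field) : Set where
  private
    module L = Field L
    module K = Field K
  field
    χ : L.Carrier → K.Carrier
    χ-+ : ∀ a b → χ (a L.+F b) ≡ χ a K.+F χ b
    χ-* : ∀ a b → χ (a L.*F b) ≡ χ a K.*F χ b
    χ-1 : χ L.1F ≡ K.1F

  χ-pow : ∀ a n → χ (pow L a n) ≡ pow K (χ a) n
  χ-pow a zero = χ-1
  χ-pow a (suc n) = trans (χ-* a (pow L a n)) (cong (χ a K.*F_) (χ-pow a n))

module TraceMap {p} k (pr : Prime p) (L : Field) (sizeL : HasSize L (p ℕ.^ suc k)) where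
  open FieldProperties L
  open Finite sizeL
  open CharP L pr (charP L p (suc k) sizeL)

  -- At `suc k` this is the absolute trace x + x^p + ... + x^(p^k); the partial sums are kept for
  -- induction and for the degree bound.
  trace : ℕ → Carrier → Carrier
  trace zero x = 0F
  trace (suc j) x = trace j x +F pow L x (p ℕ.^ j)

  trace-+ : ∀ j x y → trace j (x +F y) ≡ trace j x +F trace j y
  trace-+ zero x y = sym (+-idʳ 0F)
  trace-+ (suc j) x y = trans (cong₂ _+F_ (trace-+ j x y) (frobenius^-+ j x y))
    (solve 4 (λ a b c d → (a :+ b) :+ (c :+ d) := (a :+ c) :+ (b :+ d)) refl _ _ _ _)

  pow-p-0 : pow L 0F p ≡ 0F
  pow-p-0 = x*0 p (prime⇒>1 pr)
    where
    x*0 : ∀ n → 1 ℕ.< n → pow L 0F n ≡ 0F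
    x*0 (suc n) _ = zeroˡ _

  -- Taking p-th powers shifts the summands by one, so the two sides differ only at the ends of the
  -- sum.
  trace-frobenius : ∀ j x → pow L (trace j x) p +F x ≡ trace j x +F pow L x (p ℕ.^ j)
  trace-frobenius zero x = trans (cong (_+F x) pow-p-0) (cong (0F +F_) (sym (pow-1 x)))
  trace-frobenius (suc j) x = begin
    pow L (trace j x +F xʲ) p +F x                   ≡⟨ cong (_+F x) (frobenius-+ (trace j x) xʲ) ⟩
    (pow L (trace j x) p +F pow L xʲ p) +F x          ≡⟨ solve 3 (λ a b c → (a :+ b) :+ c := (a :+ c) :+ b) refl _ _ _ ⟩
    (pow L (trace j x) p +F x) +F pow L xʲ p          ≡⟨ cong₂ _+F_ (trace-frobenius j x) (sym (pow-pow x (p ℕ.^ j) p)) ⟩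
    trace (suc j) x +F pow L x (p ℕ.^ j ℕ.* p)        ≡⟨ cong (λ n → trace (suc j) x +F pow L x n) (ℕ.*-comm (p ℕ.^ j) p) ⟩
    trace (suc j) x +F pow L x (p ℕ.^ suc j) ∎
    where
    open ≡-Reasoning
    xʲ : Carrier
    xʲ = pow L x (p ℕ.^ j)

  trace-fixed : ∀ x → pow L (trace (suc k) x) p ≡ trace (suc k) x
  trace-fixed x = trans (solve 2 (λ a x → a := (a :+ x) :+ :- x) refl _ x)
    (trans (cong (_+F -F x) (trans (trace-frobenius (suc k) x)
        (cong (trace (suc k) x +F_) (fermat L (p ℕ.^ suc k) sizeL x))))
      (solve 2 (λ a x → (a :+ x) :+ :- x := a) refl _ x))

  trace-isPoly : ∀ j n → (∀ {i} → i ℕ.< j → p ℕ.^ i ℕ.< n) → IsPoly n (trace j)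
  trace-isPoly zero n _ = isPoly-0 n
  trace-isPoly (suc j) n bound = isPoly-+ (trace-isPoly j n (λ i<j → bound (ℕ.<-trans i<j (ℕ.n<1+n j))))
    (isPoly-pow (p ℕ.^ j) (bound (ℕ.n<1+n j)))

  -- The trace is a monic polynomial of degree p^k, so it cannot vanish on all p^(k+1) elements of
  -- L.
  trace-≢0 : ∃ λ x → trace (suc k) x ≢ 0F
  trace-≢0 with any? (λ x → ¬? (trace (suc k) x ≟ 0F))
  ... | yes found = found
  ... | no vanishes = ⊥-elim (fewRoots cs (λ i → Inverse.from sizeL (Fin.inject≤ i p^k<p^[1+k]))
          (λ eq → Fin.inject≤-injective _ _ _ _ (from-injective eq))
          λ i → let x = Inverse.from sizeL (Fin.inject≤ i p^k<p^[1+k]) in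
            trans (monicVal-polyVal cs x) (trans (cong (_+F pow L x (p ℕ.^ k)) (cs-val x))
              (decidable-stable (trace (suc k) x ≟ 0F) λ ≢0 → vanishes (x , ≢0))))
    where
    p^k<p^[1+k] : p ℕ.^ k ℕ.< p ℕ.^ suc k
    p^k<p^[1+k] = ℕ.^-monoʳ-< p (prime⇒>1 pr) (ℕ.n<1+n k)
    poly : IsPoly (p ℕ.^ k) (trace k)
    poly = trace-isPoly k (p ℕ.^ k) (λ i<k → ℕ.^-monoʳ-< p (prime⇒>1 pr) i<k)
    cs : Vec Carrier (p ℕ.^ k)
    cs = proj₁ poly
    cs-val : ∀ x → polyVal cs x ≡ trace k x
    cs-val = proj₂ poly

  -- The p multiples of 1 are distinct roots of X^p - X and therefore all of them.
  primeSubfield : ∀ x → pow L x p ≡ x → ∃ λ i → times L (toℕ {p} i) 1F ≡ x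
  primeSubfield x x^p≡x = allRoots L _≟_ (X^-X p (prime⇒>1 pr)) (λ i → times L (toℕ i) 1F)
    injective (λ i → monicVal-X^-X p (prime⇒>1 pr) _ (fixed (toℕ i)))
    x (monicVal-X^-X p (prime⇒>1 pr) x x^p≡x)
    where
    fixed : ∀ n → pow L (times L n 1F) p ≡ times L n 1F
    fixed zero = pow-p-0
    fixed (suc n) = trans (frobenius-+ 1F (times L n 1F)) (cong₂ _+F_ (pow-1-base p) (fixed n))
    injective : Injective _≡_ _≡_ (λ (i : Fin p) → times L (toℕ i) 1F)
    injective {i} {j} eq with ℕ.≤-total (toℕ i) (toℕ j)
    ... | inj₁ i≤j = Fin.toℕ-injective (times-1-injective i≤j (Fin.toℕ<n j) eq)
    ... | inj₂ j≤i = Fin.toℕ-injective (sym (times-1-injective j≤i (Fin.toℕ<n i) (sym eq)))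

-- The additive maps L → K form a nonzero K-space on which L acts by the commuting operators
-- f ↦ f(a ·).  Since a^|K| = a, each of them is killed by X^|K| − X, which splits over K;
-- so there is a joint eigenvector f, and f / f(1) is multiplicative as well as additive.
module FieldEmbedding {p} k m (pr : Prime p) (m≢0 : m ≢ 0) (L K : Field)
  (sizeL : HasSize L (p ℕ.^ suc k)) (sizeK : HasSize K (p ℕ.^ m))
  (a^|K|≡a : ∀ a → pow L a (p ℕ.^ m) ≡ a) where

  private
    module L = FieldProperties L
    module FL = Finite sizeL
    module FK = Finite sizeK
    module LP = CharP L pr (charP L p (suc k) sizeL)
    open FieldProperties K
    open CharP K pr (charP K p m sizeK)
    open TraceMap k pr L sizeL

    record AdditiveMap : Set where
      field
        fun : L.Carrier → Carrier
        additive : ∀ x y → fun (x L.+F y) ≡ fun x +F fun y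
        nonzero : ∃ λ x → fun x ≢ 0F
    open AdditiveMap

    instance
      p-nonZero : NonZero p
      p-nonZero = prime⇒nonZero pr

    abstract
      -- The prime fields of L and K are connected only through natural numbers below p, so the
      -- trace is carried over by its residue. The resulting `functional` is the nonzero additive
      -- map from which the search for eigenvectors starts.
      digit : L.Carrier → ℕ
      digit x = toℕ (proj₁ (primeSubfield (trace (suc k) x) (trace-fixed x)))

      digit-trace : ∀ x → times L (digit x) L.1F ≡ trace (suc k) x
      digit-trace x = proj₂ (primeSubfield (trace (suc k) x) (trace-fixed x))

      digit<p : ∀ x → digit x ℕ.< p
      digit<p x = Fin.toℕ<n (proj₁ (primeSubfield (trace (suc k) x) (trace-fixed x)))

    digit-+ : ∀ x y → digit (x L.+F y) ≡ (digit x ℕ.+ digit y) % p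
    digit-+ x y = LP.times-1-unique (digit<p (x L.+F y)) (begin
      times L (digit (x L.+F y)) L.1F                      ≡⟨ digit-trace (x L.+F y) ⟩
      trace (suc k) (x L.+F y)                             ≡⟨ trace-+ (suc k) x y ⟩
      trace (suc k) x L.+F trace (suc k) y                 ≡⟨ cong₂ L._+F_ (digit-trace x) (digit-trace y) ⟨
      times L (digit x) L.1F L.+F times L (digit y) L.1F   ≡⟨ L.times-+ (digit x) (digit y) L.1F ⟨
      times L (digit x ℕ.+ digit y) L.1F ∎)
      where open ≡-Reasoning

    functional : AdditiveMap
    functional = record
      { fun = λ x → times K (digit x) 1F
      ; additive = λ x y → trans (cong (λ n → times K n 1F) (digit-+ x y))
          (trans (sym (times-% (digit x ℕ.+ digit y))) (times-+ (digit x) (digit y) 1F))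
      ; nonzero = let (x , tr≢0) = trace-≢0 in x , digit-≢0 (digit x) (digit-trace x) (digit<p x) tr≢0 }
      where
      digit-≢0 : ∀ d {t} → times L d L.1F ≡ t → d ℕ.< p → t ≢ L.0F → times K d 1F ≢ 0F
      digit-≢0 zero 0≡t _ t≢0 = ⊥-elim (t≢0 (sym 0≡t))
      digit-≢0 d@(suc _) _ d<p _ = times-1-≢0 d d<p

    EigenFor : (L.Carrier → Carrier) → L.Carrier → Set
    EigenFor f a = ∃ λ t → ∀ x → f (a L.*F x) ≡ t *F f x

    module _ (a : L.Carrier) where
      open ShiftOperator K (a L.*F_)

      apply-replicate : ∀ n f x → apply (replicate n 0F) f x ≡ f (pow L a n L.*F x)
      apply-replicate zero f x = cong f (sym (L.*-idˡ x))
      apply-replicate (suc n) f x = trans (cong₂ _+F_ (zeroˡ _) (apply-replicate n f (a L.*F x)))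
        (trans (+-idˡ _) (cong f (L.solve 3 (λ a b x → b L.:* (a L.:* x) L.:= (a L.:* b) L.:* x) refl a _ x)))

      apply-X^-X : ∀ n 1<n → pow L a n ≡ a → ∀ f x → apply (X^-X n 1<n) f x ≡ 0F
      apply-X^-X (suc zero) (ℕ.s≤s ())
      apply-X^-X (suc (suc n)) _ a^n≡a f x = begin
        0F *F f x +F (-F 1F *F f (a L.*F x) +F apply (replicate n 0F) f (a L.*F (a L.*F x)))
          ≡⟨ cong (λ z → 0F *F f x +F (-F 1F *F f (a L.*F x) +F z)) (trans (apply-replicate n f _) (cong f shift)) ⟩
        0F *F f x +F (-F 1F *F f (a L.*F x) +F f (a L.*F x))
          ≡⟨ solve 2 (λ u v → con (+ 0) :* u :+ (:- con (+ 1) :* v :+ v) := con (+ 0)) refl _ _ ⟩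
        0F ∎
        where
        open ≡-Reasoning
        shift : pow L a n L.*F (a L.*F (a L.*F x)) ≡ a L.*F x
        shift = trans (L.solve 3 (λ a b x → b L.:* (a L.:* (a L.:* x)) L.:= (a L.:* (a L.:* b)) L.:* x) refl a _ x)
          (cong (L._*F x) a^n≡a)

      apply-additive : ∀ {n} (cs : Vec Carrier n) f → (∀ x y → f (x L.+F y) ≡ f x +F f y) →
        ∀ x y → apply cs f (x L.+F y) ≡ apply cs f x +F apply cs f y
      apply-additive [] f f-+ x y = f-+ x y
      apply-additive (c ∷ cs) f f-+ x y = trans
        (cong₂ _+F_ (cong (c *F_) (f-+ x y))
          (trans (cong (apply cs f) (L.distribˡ a x y)) (apply-additive cs f f-+ _ _)))
        (solve 5 (λ c u v u′ v′ → c :* (u :+ v) :+ (u′ :+ v′) := (c :* u :+ u′) :+ (c :* v :+ v′)) refl c _ _ _ _)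

      -- The multiplications by a and b commute, so a polynomial in the one operator keeps the
      -- eigenvalue of the other; earlier eigenvalues are not lost.
      apply-eigen : ∀ {n} (cs : Vec Carrier n) f b → EigenFor f b → EigenFor (apply cs f) b
      apply-eigen cs f b (t , eig) = t , go cs
        where
        go : ∀ {n} (cs : Vec Carrier n) x → apply cs f (b L.*F x) ≡ t *F apply cs f x
        go [] x = eig x
        go (c ∷ cs) x = trans
          (cong₂ _+F_ (cong (c *F_) (eig x))
            (trans (cong (apply cs f) (L.solve 3 (λ a b x → a L.:* (b L.:* x) L.:= b L.:* (a L.:* x)) refl a b x))
              (go cs (a L.*F x))))
          (solve 4 (λ c t u v → c :* (t :* u) :+ t :* v := t :* (c :* u :+ v)) refl c t _ _)

      addEigen : ∀ (f : AdditiveMap) as → All (EigenFor (fun f)) as →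
        Σ AdditiveMap λ g → All (EigenFor (fun g)) (a ∷ as)
      addEigen f as eigs =
        let (_ , qs , ≢0 , eig) = eigenvector sizeL FK._≟_ (X^-X N 1<N) (Inverse.from sizeK)
              FK.from-injective (λ i → monicVal-X^-X N 1<N _ (fermat K N sizeK _))
              (fun f) (apply-X^-X N 1<N (a^|K|≡a a) (fun f)) (nonzero f)
        in record { fun = apply qs (fun f) ; additive = apply-additive qs (fun f) (additive f) ; nonzero = ≢0 }
           , eig ∷ All.map (λ {b} → apply-eigen qs (fun f) b) eigs
        where
        N : ℕ
        N = p ℕ.^ m
        1<N : 1 ℕ.< N
        1<N = 1<p^ pr m m≢0

    jointEigen : ∀ as → Σ AdditiveMap λ g → All (EigenFor (fun g)) as
    jointEigen [] = functional , []
    jointEigen (a ∷ as) = let (f , eigs) = jointEigen as in addEigen a f as eigs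

    elements : List L.Carrier
    elements = tabulate (Inverse.from sizeL)

    ∈-elements : ∀ a → a ∈ elements
    ∈-elements a = subst (_∈ elements) (Inverse.strictlyInverseʳ sizeL a) (∈-tabulate⁺ (Inverse.to sizeL a))

    f : AdditiveMap
    f = proj₁ (jointEigen elements)

    eigenvalue : ∀ a → EigenFor (fun f) a
    eigenvalue a = All.lookup (proj₂ (jointEigen elements)) (∈-elements a)

    χ : L.Carrier → Carrier
    χ a = proj₁ (eigenvalue a)

    χ-f : ∀ a x → fun f (a L.*F x) ≡ χ a *F fun f x
    χ-f a = proj₂ (eigenvalue a)

    f1 : Carrier
    f1 = fun f L.1F

    f-χ : ∀ a → fun f a ≡ χ a *F f1
    f-χ a = trans (cong (fun f) (sym (L.*-idʳ a))) (χ-f a L.1F)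

    f1≢0 : f1 ≢ 0F
    f1≢0 f1≡0 = let (x , fx≢0) = nonzero f in
      fx≢0 (trans (f-χ x) (trans (cong (χ x *F_) f1≡0) (zeroʳ _)))

    cancel-f1 : ∀ {u v} → u *F f1 ≡ v *F f1 → u ≡ v
    cancel-f1 eq = *-cancelˡ f1≢0 (trans (*-comm _ _) (trans eq (*-comm _ _)))

  embedding : Embedding L K
  embedding = record
    { χ = χ
    ; χ-+ = λ a b → cancel-f1 (trans (sym (f-χ _)) (trans (additive f a b)
              (trans (cong₂ _+F_ (f-χ a) (f-χ b)) (sym (distribʳ _ _ _)))))
    ; χ-* = λ a b → cancel-f1 (trans (sym (f-χ _)) (trans (χ-f a b)
              (trans (cong (χ a *F_) (f-χ b)) (sym (*-assoc _ _ _)))))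
    ; χ-1 = cancel-f1 (trans (sym (f-χ L.1F)) (sym (*-idˡ f1)))
    }

open AddSpace using (V)

-- Linear equivalence

-- An `AddSpace` carries no laws. These are the group laws and the enumeration that reduce an
-- `IsFpLinearBij` to additivity and a trivial kernel.
record FiniteSpace (S : AddSpace) (n : ℕ) : Set where
  open AddSpace S using (_⊕_; _·_)
  field
    0v : V S
    neg : V S → V S
    ⊕-assoc : ∀ x y z → (x ⊕ y) ⊕ z ≡ x ⊕ (y ⊕ z)
    ⊕-idʳ : ∀ x → x ⊕ 0v ≡ x
    ⊕-invʳ : ∀ x → x ⊕ neg x ≡ 0v
    ·-zero : ∀ x → 0 · x ≡ 0v
    ·-suc : ∀ n x → suc n · x ≡ x ⊕ (n · x)
    enum : V S ↔ Fin n

  ⊕-cancelʳ : ∀ {x y z} → x ⊕ z ≡ y ⊕ z → x ≡ y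
  ⊕-cancelʳ {x} {y} {z} eq = trans (sym (undo x)) (trans (cong (_⊕ neg z) eq) (undo y))
    where
    undo : ∀ w → (w ⊕ z) ⊕ neg z ≡ w
    undo w = trans (⊕-assoc _ _ _) (trans (cong (w ⊕_) (⊕-invʳ z)) (⊕-idʳ w))

  idempotent⇒0 : ∀ {x} → x ⊕ x ≡ x → x ≡ 0v
  idempotent⇒0 {x} eq = trans (sym undo) (trans (cong (_⊕ neg x) eq) (⊕-invʳ x))
    where
    undo : (x ⊕ x) ⊕ neg x ≡ x
    undo = trans (⊕-assoc _ _ _) (trans (cong (x ⊕_) (⊕-invʳ x)) (⊕-idʳ x))

fieldSpace : ∀ F {n} → HasSize F n → FiniteSpace (FieldSpace F) n
fieldSpace F size = record
  { 0v = 0F ; neg = -F_ ; ⊕-assoc = +-assoc ; ⊕-idʳ = +-idʳ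
  ; ⊕-invʳ = +-invʳ
  ; ·-zero = λ _ → refl ; ·-suc = λ _ _ → refl ; enum = size }
  where open Field F

pairSpace : ∀ F {n} → HasSize F n → FiniteSpace (PairSpace F) (n ℕ.* n)
pairSpace F {n} size = record
  { 0v = 0F , 0F ; neg = λ (x , y) → -F x , -F y
  ; ⊕-assoc = λ x y z → cong₂ _,_ (+-assoc _ _ _) (+-assoc _ _ _)
  ; ⊕-idʳ = λ x → cong₂ _,_ (+-idʳ _) (+-idʳ _)
  ; ⊕-invʳ = λ x → cong₂ _,_ (+-invʳ _) (+-invʳ _)
  ; ·-zero = λ _ → refl ; ·-suc = λ _ _ → refl
  ; enum = ↔-sym (Fin.*↔× {n} {n}) ↔-∘ (size ×-↔ size) }
  where open Field F

additive-0 : ∀ {S T m n} (A : FiniteSpace S m) (B : FiniteSpace T n) (L : V S → V T) →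
  (∀ x y → L (AddSpace._⊕_ S x y) ≡ AddSpace._⊕_ T (L x) (L y)) →
  L (FiniteSpace.0v A) ≡ FiniteSpace.0v B
additive-0 A B L L-⊕ =
  FiniteSpace.idempotent⇒0 B (trans (sym (L-⊕ _ _)) (cong L (FiniteSpace.⊕-idʳ A _)))

abstract
  -- Compatibility with the ℕ-action is iterated addition, and surjectivity is the pigeonhole
  -- principle for two spaces of the same size n.
  linearBij : ∀ {S T n} (A : FiniteSpace S n) (B : FiniteSpace T n) (L : V S → V T) →
    (∀ x y → L (AddSpace._⊕_ S x y) ≡ AddSpace._⊕_ T (L x) (L y)) →
    (∀ x → L x ≡ FiniteSpace.0v B → x ≡ FiniteSpace.0v A) → IsFpLinearBij S T L
  linearBij {S} {T} A B L L-⊕ kernel = L-⊕ , L-· , injective , surjective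
    where
    module A = FiniteSpace A
    module B = FiniteSpace B
    open AddSpace S using () renaming (_⊕_ to _⊕ˢ_; _·_ to _·ˢ_)
    open AddSpace T using () renaming (_⊕_ to _⊕ᵗ_; _·_ to _·ᵗ_)

    L-0 : L A.0v ≡ B.0v
    L-0 = additive-0 A B L L-⊕

    L-· : ∀ n x → L (n ·ˢ x) ≡ n ·ᵗ L x
    L-· zero x = trans (cong L (A.·-zero x)) (trans L-0 (sym (B.·-zero _)))
    L-· (suc n) x = trans (cong L (A.·-suc n x)) (trans (L-⊕ _ _)
      (trans (cong (L x ⊕ᵗ_) (L-· n x)) (sym (B.·-suc n _))))

    injective : Injective _≡_ _≡_ L
    injective {x} {y} Lx≡Ly = A.⊕-cancelʳ (trans x-y≡0 (sym (A.⊕-invʳ y)))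
      where
      L[x-y]≡L0 : L (x ⊕ˢ A.neg y) ≡ B.0v
      L[x-y]≡L0 = trans (L-⊕ _ _) (trans (cong (_⊕ᵗ L (A.neg y)) Lx≡Ly)
        (trans (sym (L-⊕ _ _)) (trans (cong L (A.⊕-invʳ y)) L-0)))
      x-y≡0 : x ⊕ˢ A.neg y ≡ A.0v
      x-y≡0 = kernel _ L[x-y]≡L0

    surjective : Surjective _≡_ _≡_ L
    surjective y = let (x , Lx≡y) = injective⇒surjective A.enum B.enum L injective y in
      x , λ { refl → Lx≡y }

id-bij : ∀ S → IsFpLinearBij S S id
id-bij S = (λ _ _ → refl) , (λ _ _ → refl) , id , λ y → y , id

∘-bij : ∀ S T U {L M} → IsFpLinearBij T U M → IsFpLinearBij S T L → IsFpLinearBij S U (M ∘ L)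
∘-bij S T U {L} {M} (M-⊕ , M-· , M-inj , M-surj) (L-⊕ , L-· , L-inj , L-surj) =
  (λ x y → trans (cong M (L-⊕ x y)) (M-⊕ _ _)) , (λ n x → trans (cong M (L-· n x)) (M-· n _)) ,
  L-inj ∘ M-inj , λ z → let (y , My≡z) = M-surj z ; (x , Lx≡y) = L-surj y in
    x , λ { refl → My≡z (Lx≡y refl) }

inverse-bij : ∀ {S T L} → IsFpLinearBij S T L →
  Σ (V T → V S) λ L⁻¹ → IsFpLinearBij T S L⁻¹ × (∀ y → L (L⁻¹ y) ≡ y)
inverse-bij {S} {T} {L} (L-⊕ , L-· , L-inj , L-surj) = L⁻¹ , linear , L-L⁻¹
  where
  L⁻¹ : V T → V S
  L⁻¹ y = proj₁ (L-surj y)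
  L-L⁻¹ : ∀ y → L (L⁻¹ y) ≡ y
  L-L⁻¹ y = proj₂ (L-surj y) refl
  linear : IsFpLinearBij T S L⁻¹
  linear =
    (λ x y → L-inj (trans (L-L⁻¹ _) (sym (trans (L-⊕ _ _) (cong₂ (AddSpace._⊕_ T) (L-L⁻¹ x) (L-L⁻¹ y)))))) ,
    (λ n x → L-inj (trans (L-L⁻¹ _) (sym (trans (L-· n _) (cong (AddSpace._·_ T n) (L-L⁻¹ x)))))) ,
    (λ {x} {y} eq → trans (sym (L-L⁻¹ x)) (trans (cong L eq) (L-L⁻¹ y))) ,
    λ x → L x , λ { refl → L-inj (L-L⁻¹ _) }

LinEquiv-step : ∀ S T U {f g h} → LinEquiv S T f g →
  ∀ {M₁ M₂} → IsFpLinearBij T U M₁ → IsFpLinearBij U T M₂ → (∀ x → h x ≡ M₁ (g (M₂ x))) →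
  LinEquiv S U f h
LinEquiv-step S T U (L₁ , L₂ , bij₁ , bij₂ , g≡) {M₁} {M₂} bijM₁ bijM₂ h≡ =
  M₁ ∘ L₁ , L₂ ∘ M₂ , ∘-bij S T U bijM₁ bij₁ , ∘-bij U T S bij₂ bijM₂ ,
  λ x → trans (h≡ x) (cong M₁ (g≡ (M₂ x)))

-- The invariant behind the classification: it excludes every degenerate intermediate form by
-- exhibiting a nonzero point where that form vanishes.
LinEquiv-nonvanishing : ∀ {S T m n f g} (A : FiniteSpace S m) (B : FiniteSpace T n) →
  let open FiniteSpace in (∀ x → f x ≡ 0v A → x ≡ 0v A) → LinEquiv S T f g → ∀ y → g y ≡ 0v B → y ≡ 0v B
LinEquiv-nonvanishing A B f-nonvanishing (L₁ , L₂ , (L₁-⊕ , _ , L₁-inj , _) , (L₂-⊕ , _ , L₂-inj , _) , g≡) y gy≡0 =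
  L₂-inj (trans (f-nonvanishing _ (L₁-inj (trans (sym (g≡ y)) (trans gy≡0 (sym (additive-0 A B L₁ L₁-⊕))))))
    (sym (additive-0 B A L₂ L₂-⊕)))

-- Pencils of forms

-- The form u m + v r has determinant A u² + B u v + C v².
module Pencil (F : Field) (m₁ m₂ m₃ m₄ r₁ r₂ r₃ r₄ : Field.Carrier F) where
  open FieldProperties F

  A B C δ : Carrier
  A = m₁ *F m₄ +F -F (m₂ *F m₃)
  B = (m₁ *F r₄ +F r₁ *F m₄) +F -F (m₂ *F r₃ +F r₂ *F m₃)
  C = r₁ *F r₄ +F -F (r₂ *F r₃)
  δ = B *F B +F -F ((1F +F 1F) *F (1F +F 1F) *F (A *F C))

  Singular : Carrier → Carrier → Set
  Singular u v = (u *F m₁ +F v *F r₁) *F (u *F m₄ +F v *F r₄) ≡ (u *F m₂ +F v *F r₂) *F (u *F m₃ +F v *F r₃)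

  determinant≡0⇒singular : ∀ u v → A *F (u *F u) +F B *F (u *F v) +F C *F (v *F v) ≡ 0F → Singular u v
  determinant≡0⇒singular u v eq = modulo 1F eq (solve 10 (λ m₁ m₂ m₃ m₄ r₁ r₂ r₃ r₄ u v →
      (u :* m₁ :+ v :* r₁) :* (u :* m₄ :+ v :* r₄) := (u :* m₂ :+ v :* r₂) :* (u :* m₃ :+ v :* r₃) :+
      𝟙 :* (((m₁ :* m₄ :+ :- (m₂ :* m₃)) :* (u :* u) :+
             ((m₁ :* r₄ :+ r₁ :* m₄) :+ :- (m₂ :* r₃ :+ r₂ :* m₃)) :* (u :* v) :+
             (r₁ :* r₄ :+ :- (r₂ :* r₃)) :* (v :* v)) :+ :- 𝟘))
    refl m₁ m₂ m₃ m₄ r₁ r₂ r₃ r₄ u v)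

  -- The quadratic formula v / u = (s - B) / 2C with the denominator cleared. For C = 0 the pair may
  -- be zero, which is why that case is treated apart.
  root⇒singular : ∀ s → s *F s ≡ δ → Singular ((1F +F 1F) *F C) (s +F -F B)
  root⇒singular s s²≡δ = determinant≡0⇒singular _ _ (modulo C s²≡δ (solve 4 (λ A B C s →
      let u = (𝟙 :+ 𝟙) :* C ; v = s :+ :- B in
      A :* (u :* u) :+ B :* (u :* v) :+ C :* (v :* v) :=
      𝟘 :+ C :* (s :* s :+ :- (B :* B :+ :- ((𝟙 :+ 𝟙) :* (𝟙 :+ 𝟙) :* (A :* C)))))
    refl A B C s))

-- The common shape of x ↦ x^Q on either field and of the conjugation x ↦ x^q on the larger one.
record Automorphism (L : Field) : Set where
  open FieldProperties L
  field
    Φ : Carrier → Carrier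
    Φ-+ : ∀ x y → Φ (x +F y) ≡ Φ x +F Φ y
    Φ-* : ∀ x y → Φ (x *F y) ≡ Φ x *F Φ y
    Φ-1 : Φ 1F ≡ 1F
    Φ-surjective : ∀ y → ∃ λ x → Φ x ≡ y

  Φ-0 : Φ 0F ≡ 0F
  Φ-0 = trans (solve 1 (λ a → a := (a :+ a) :+ :- a) refl (Φ 0F))
    (trans (cong (_+F -F Φ 0F) (trans (sym (Φ-+ 0F 0F)) (cong Φ (+-idʳ 0F)))) (+-invʳ _))

  Φ-neg : ∀ x → Φ (-F x) ≡ -F Φ x
  Φ-neg x = x-y≡0⇒x≡y (trans (cong (Φ (-F x) +F_) (-‿involutive (Φ x)))
    (trans (sym (Φ-+ _ _)) (trans (cong Φ (trans (+-comm _ _) (+-invʳ x))) Φ-0)))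

  Φ-≢0 : ∀ {x} → x ≢ 0F → Φ x ≢ 0F
  Φ-≢0 {x} x≢0 Φx≡0 = 1≢0 (trans (sym Φ-1) (trans (cong Φ (sym (*-invʳ x x≢0)))
    (trans (Φ-* _ _) (trans (cong (_*F Φ (inv x)) Φx≡0) (zeroˡ _)))))

  Φ-combo : ∀ a b x y → Φ (a *F x +F b *F y) ≡ Φ a *F Φ x +F Φ b *F Φ y
  Φ-combo a b x y = trans (Φ-+ _ _) (cong₂ _+F_ (Φ-* a x) (Φ-* b y))

  -- The matrix with rows (m₁, m₂) and (m₃, m₄): the row selects the argument under `Φ`, the column
  -- the plain one.
  form : Carrier → Carrier → Carrier → Carrier → Carrier → Carrier → Carrier
  form m₁ m₂ m₃ m₄ x y = m₁ *F (Φ x *F x) +F m₂ *F (Φ x *F y) +F m₃ *F (Φ y *F x) +F m₄ *F (Φ y *F y)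

  form-coeffs : ∀ {h₁ h₂ h₃ h₄ m₁ m₂ m₃ m₄} → h₁ ≡ m₁ → h₂ ≡ m₂ → h₃ ≡ m₃ → h₄ ≡ m₄ →
    ∀ x y → form h₁ h₂ h₃ h₄ x y ≡ form m₁ m₂ m₃ m₄ x y
  form-coeffs refl refl refl refl x y = refl

  form-combine : ∀ m₁ m₂ m₃ m₄ n₁ n₂ n₃ n₄ u v x y →
    form (u *F m₁ +F v *F n₁) (u *F m₂ +F v *F n₂) (u *F m₃ +F v *F n₃) (u *F m₄ +F v *F n₄) x y ≡
    u *F form m₁ m₂ m₃ m₄ x y +F v *F form n₁ n₂ n₃ n₄ x y
  form-combine m₁ m₂ m₃ m₄ n₁ n₂ n₃ n₄ u v x y =
    solve 14 (λ m₁ m₂ m₃ m₄ n₁ n₂ n₃ n₄ u v a b c d →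
        (u :* m₁ :+ v :* n₁) :* a :+ (u :* m₂ :+ v :* n₂) :* b :+ (u :* m₃ :+ v :* n₃) :* c :+ (u :* m₄ :+ v :* n₄) :* d :=
        u :* (m₁ :* a :+ m₂ :* b :+ m₃ :* c :+ m₄ :* d) :+ v :* (n₁ :* a :+ n₂ :* b :+ n₃ :* c :+ n₄ :* d))
      refl m₁ m₂ m₃ m₄ n₁ n₂ n₃ n₄ u v _ _ _ _

  IsForm : (Carrier → Carrier → Carrier) → Set
  IsForm g = ∃ λ m₁ → ∃ λ m₂ → ∃ λ m₃ → ∃ λ m₄ → ∀ x y → g x y ≡ form m₁ m₂ m₃ m₄ x y

  form-isForm : ∀ m₁ m₂ m₃ m₄ → IsForm (form m₁ m₂ m₃ m₄)
  form-isForm m₁ m₂ m₃ m₄ = m₁ , m₂ , m₃ , m₄ , λ _ _ → refl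

  isForm-+ : ∀ {f g} → IsForm f → IsForm g → IsForm (λ x y → f x y +F g x y)
  isForm-+ (m₁ , m₂ , m₃ , m₄ , f≡) (n₁ , n₂ , n₃ , n₄ , g≡) =
    m₁ +F n₁ , m₂ +F n₂ , m₃ +F n₃ , m₄ +F n₄ , λ x y → trans (cong₂ _+F_ (f≡ x y) (g≡ x y))
      (solve 12 (λ m₁ m₂ m₃ m₄ n₁ n₂ n₃ n₄ a b c d →
          (m₁ :* a :+ m₂ :* b :+ m₃ :* c :+ m₄ :* d) :+ (n₁ :* a :+ n₂ :* b :+ n₃ :* c :+ n₄ :* d) :=
          (m₁ :+ n₁) :* a :+ (m₂ :+ n₂) :* b :+ (m₃ :+ n₃) :* c :+ (m₄ :+ n₄) :* d)
        refl m₁ m₂ m₃ m₄ n₁ n₂ n₃ n₄ _ _ _ _)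

  isForm-* : ∀ c {f} → IsForm f → IsForm (λ x y → c *F f x y)
  isForm-* c (m₁ , m₂ , m₃ , m₄ , f≡) =
    c *F m₁ , c *F m₂ , c *F m₃ , c *F m₄ , λ x y → trans (cong (c *F_) (f≡ x y))
      (solve 9 (λ k m₁ m₂ m₃ m₄ a b c d → k :* (m₁ :* a :+ m₂ :* b :+ m₃ :* c :+ m₄ :* d) :=
          (k :* m₁) :* a :+ (k :* m₂) :* b :+ (k :* m₃) :* c :+ (k :* m₄) :* d)
        refl c m₁ m₂ m₃ m₄ _ _ _ _)

  product-expand : ∀ A₁ A₂ b₁ b₂ x y →
    (A₁ *F Φ x +F A₂ *F Φ y) *F (b₁ *F x +F b₂ *F y) ≡ form (A₁ *F b₁) (A₁ *F b₂) (A₂ *F b₁) (A₂ *F b₂) x y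
  product-expand A₁ A₂ b₁ b₂ x y =
    solve 8 (λ a b c d X Y x y → (a :* X :+ b :* Y) :* (c :* x :+ d :* y) :=
        (a :* c) :* (X :* x) :+ (a :* d) :* (X :* y) :+ (b :* c) :* (Y :* x) :+ (b :* d) :* (Y :* y))
      refl A₁ A₂ b₁ b₂ (Φ x) (Φ y) x y

  isForm-product : ∀ a b c d → IsForm (λ x y → Φ (a *F x +F b *F y) *F (c *F x +F d *F y))
  isForm-product a b c d = _ , _ , _ , _ , λ x y →
    trans (cong (_*F (c *F x +F d *F y)) (Φ-combo a b x y)) (product-expand (Φ a) (Φ b) c d x y)

  isForm-∘ : ∀ {f} → IsForm f → ∀ a b c d → IsForm (λ x y → f (a *F x +F b *F y) (c *F x +F d *F y))
  isForm-∘ (m₁ , m₂ , m₃ , m₄ , f≡) a b c d =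
    let (n₁ , n₂ , n₃ , n₄ , ≡n) = isForm-+ (isForm-+ (isForm-+
          (isForm-* m₁ (isForm-product a b a b)) (isForm-* m₂ (isForm-product a b c d)))
          (isForm-* m₃ (isForm-product c d a b))) (isForm-* m₄ (isForm-product c d c d))
    in n₁ , n₂ , n₃ , n₄ , λ x y → trans (f≡ _ _) (≡n x y)

  -- The column (A₁, A₂) times the row (b₁, b₂), read off from the first nonzero entry of the top
  -- row or, if that row is zero, from the bottom row. By `product-expand` the form becomes a
  -- product of two factors.
  rankOne : DecidableEquality Carrier → ∀ m₁ m₂ m₃ m₄ → m₁ *F m₄ ≡ m₂ *F m₃ →
    ∃ λ A₁ → ∃ λ A₂ → ∃ λ b₁ → ∃ λ b₂ →
      m₁ ≡ A₁ *F b₁ × m₂ ≡ A₁ *F b₂ × m₃ ≡ A₂ *F b₁ × m₄ ≡ A₂ *F b₂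
  rankOne _≟_ m₁ m₂ m₃ m₄ det with m₁ ≟ 0F
  ... | no m₁≢0 = m₁ , m₃ , 1F , inv m₁ *F m₂ , sym (*-idʳ _) ,
        sym (trans (sym (*-assoc _ _ _)) (trans (cong (_*F m₂) (*-invʳ m₁ m₁≢0)) (*-idˡ m₂))) ,
        sym (*-idʳ _) ,
        *-cancelˡ m₁≢0 (trans det (sym (trans
          (solve 4 (λ a i b c → a :* (c :* (i :* b)) := (a :* i) :* (b :* c)) refl m₁ (inv m₁) m₂ m₃)
          (trans (cong (_*F (m₂ *F m₃)) (*-invʳ m₁ m₁≢0)) (*-idˡ _)))))
  ... | yes m₁≡0 with m₂ ≟ 0F
  ...   | yes m₂≡0 = 0F , 1F , m₃ , m₄ , trans m₁≡0 (sym (zeroˡ _)) , trans m₂≡0 (sym (zeroˡ _)) ,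
          sym (*-idˡ _) , sym (*-idˡ _)
  ...   | no m₂≢0 = m₂ , m₄ , 0F , 1F , trans m₁≡0 (sym (zeroʳ _)) , sym (*-idʳ _) ,
          trans (x*y≡0⇒y≡0 m₂≢0 (trans (sym det) (trans (cong (_*F m₄) m₁≡0) (zeroˡ _)))) (sym (zeroʳ _)) ,
          sym (*-idʳ _)

-- Normal forms of pairs over the smaller field

module PairNormalForms (L : Field) {q} (sizeL : HasSize L q) (σ : Automorphism L)
  {S : AddSpace} (A : FiniteSpace S (q ℕ.* q))
  (f : V S → V S) (f-nonvanishing : ∀ x → f x ≡ FiniteSpace.0v A → x ≡ FiniteSpace.0v A) where

  open FieldProperties L
  open Automorphism σ

  open Finite sizeL using (_≟_)

  P : AddSpace
  P = PairSpace L

  B : FiniteSpace P (q ℕ.* q)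
  B = pairSpace L sizeL

  Reaches : (g₁ g₂ : Carrier → Carrier → Carrier) → Set
  Reaches g₁ g₂ = LinEquiv S P f (λ (x , y) → g₁ x y , g₂ x y)

  -- In this order P₀, P₁, P₂ and P₃, with `Φ x` for x^Q.
  NormalForm : Set
  NormalForm =
    Reaches (λ x y → Φ x *F x) (λ x y → Φ y *F y) ⊎
    Reaches (λ x y → Φ x *F x) (λ x y → x *F Φ y +F Φ y *F y) ⊎
    (∃ λ ε → ε ≢ 0F × Reaches (λ x y → Φ x *F y) (λ x y → Φ x *F x +F ε *F (Φ y *F y))) ⊎
    (∃ λ ε → ε ≢ 0F × ε ≢ -F 1F ×
      Reaches (λ x y → Φ x *F x +F -F (Φ x *F y)) (λ x y → x *F Φ y +F ε *F (Φ y *F y)))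

  nonvanishing : ∀ {g₁ g₂} → Reaches g₁ g₂ → ∀ x y → g₁ x y ≡ 0F → g₂ x y ≡ 0F → x ≡ 0F × y ≡ 0F
  nonvanishing R x y g₁≡0 g₂≡0 = cong proj₁ v≡0 , cong proj₂ v≡0
    where
    v≡0 : (x , y) ≡ (0F , 0F)
    v≡0 = LinEquiv-nonvanishing A B f-nonvanishing R (x , y) (cong₂ _,_ g₁≡0 g₂≡0)

  matrix-bij : ∀ a b c d → a *F d +F -F (b *F c) ≢ 0F →
    IsFpLinearBij P P (λ (x , y) → a *F x +F b *F y , c *F x +F d *F y)
  matrix-bij a b c d det≢0 = linearBij B B _ (λ _ _ → cong₂ _,_ (row-+ a b _ _ _ _) (row-+ c d _ _ _ _))
    λ (x , y) eq → kernel x y (cong proj₁ eq) (cong proj₂ eq)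
    where
    row-+ : ∀ a b x y x′ y′ →
      a *F (x +F x′) +F b *F (y +F y′) ≡ (a *F x +F b *F y) +F (a *F x′ +F b *F y′)
    row-+ a b x y x′ y′ = solve 6 (λ a b x y x′ y′ →
      a :* (x :+ x′) :+ b :* (y :+ y′) := (a :* x :+ b :* y) :+ (a :* x′ :+ b :* y′)) refl a b x y x′ y′
    kernel : ∀ x y → a *F x +F b *F y ≡ 0F → c *F x +F d *F y ≡ 0F → (x , y) ≡ (0F , 0F)
    kernel x y e₁ e₂ = cong₂ _,_
      (x*y≡0⇒y≡0 det≢0 (modulo d e₁ (modulo (-F b) e₂
        (solve 6 (λ a b c d x y → (a :* d :+ :- (b :* c)) :* x :=
            (con (+ 0) :+ d :* ((a :* x :+ b :* y) :+ :- con (+ 0))) :+ :- b :* ((c :* x :+ d :* y) :+ :- con (+ 0)))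
          refl a b c d x y))))
      (x*y≡0⇒y≡0 det≢0 (modulo (-F c) e₁ (modulo a e₂
        (solve 6 (λ a b c d x y → (a :* d :+ :- (b :* c)) :* y :=
            (con (+ 0) :+ :- c :* ((a :* x :+ b :* y) :+ :- con (+ 0))) :+ a :* ((c :* x :+ d :* y) :+ :- con (+ 0)))
          refl a b c d x y))))

  inner : ∀ {g₁ g₂ h₁ h₂} → Reaches g₁ g₂ → ∀ a b c d → a *F d +F -F (b *F c) ≢ 0F →
    (∀ x y → h₁ x y ≡ g₁ (a *F x +F b *F y) (c *F x +F d *F y)) →
    (∀ x y → h₂ x y ≡ g₂ (a *F x +F b *F y) (c *F x +F d *F y)) → Reaches h₁ h₂
  inner R a b c d det≢0 h₁≡ h₂≡ = LinEquiv-step S P P {f} R (id-bij P) (matrix-bij a b c d det≢0)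
    λ (x , y) → cong₂ _,_ (h₁≡ x y) (h₂≡ x y)

  outer : ∀ {g₁ g₂ h₁ h₂} → Reaches g₁ g₂ → ∀ a b c d → a *F d +F -F (b *F c) ≢ 0F →
    (∀ x y → h₁ x y ≡ a *F g₁ x y +F b *F g₂ x y) →
    (∀ x y → h₂ x y ≡ c *F g₁ x y +F d *F g₂ x y) → Reaches h₁ h₂
  outer R a b c d det≢0 h₁≡ h₂≡ = LinEquiv-step S P P {f} R (matrix-bij a b c d det≢0) (id-bij P)
    λ (x , y) → cong₂ _,_ (h₁≡ x y) (h₂≡ x y)

  Φ-row : ∀ {a b a′ b′} → Φ a ≡ a′ → Φ b ≡ b′ → ∀ x y → Φ (a *F x +F b *F y) ≡ a′ *F Φ x +F b′ *F Φ y
  Φ-row refl refl = Φ-combo _ _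

  -- In the solver's goals X and Y stand for Φ x and Φ y.
  formPoly : ∀ {k} → (m₁ m₂ m₃ m₄ X Y x y : Polynomial k) → Polynomial k
  formPoly m₁ m₂ m₃ m₄ X Y x y = m₁ :* (X :* x) :+ m₂ :* (X :* y) :+ m₃ :* (Y :* x) :+ m₄ :* (Y :* y)

  form-cong : ∀ m₁ m₂ m₃ m₄ {X Y} x y → Φ x ≡ X → Φ y ≡ Y → form m₁ m₂ m₃ m₄ x y ≡
    m₁ *F (X *F x) +F m₂ *F (X *F y) +F m₃ *F (Y *F x) +F m₄ *F (Y *F y)
  form-cong m₁ m₂ m₃ m₄ x y refl refl = refl

  form-at-01 : ∀ m₁ m₂ m₃ m₄ → form m₁ m₂ m₃ m₄ 0F 1F ≡ m₄
  form-at-01 m₁ m₂ m₃ m₄ = trans (form-cong m₁ m₂ m₃ m₄ 0F 1F Φ-0 Φ-1)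
    (solve 4 (λ a b c d → formPoly a b c d 𝟘 𝟙 𝟘 𝟙 := d) refl m₁ m₂ m₃ m₄)

  form-at-10 : ∀ m₁ m₂ m₃ m₄ → form m₁ m₂ m₃ m₄ 1F 0F ≡ m₁
  form-at-10 m₁ m₂ m₃ m₄ = trans (form-cong m₁ m₂ m₃ m₄ 1F 0F Φ-1 Φ-0)
    (solve 4 (λ a b c d → formPoly a b c d 𝟙 𝟘 𝟙 𝟘 := a) refl m₁ m₂ m₃ m₄)

  -- The first component is x^(Q+1); shear y so that Φ x · y disappears from the second.
  squareCase : ∀ m₁ m₂ m₃ m₄ → Reaches (λ x y → Φ x *F x) (form m₁ m₂ m₃ m₄) → NormalForm
  squareCase m₁ m₂ m₃ m₄ R = conclude (r ≟ 0F)
    where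
    -- The first component vanishes at (0, 1), so the second must not.
    m₄≢0 : m₄ ≢ 0F
    m₄≢0 m₄≡0 = 1≢0 (proj₂ (nonvanishing R 0F 1F (zeroʳ _) (trans (form-at-01 m₁ m₂ m₃ m₄) m₄≡0)))

    i s r c : Carrier
    i = inv m₄
    -- Under y ↦ s x + y the coefficient of `Φ x · y` becomes m₂ + m₄ Φ s, and s makes it zero.
    -- After division by m₄, the multiple `c` of the first component removes `Φ x · x`, and `r` is
    -- what is left at `x · Φ y`.
    s = proj₁ (Φ-surjective (-F (i *F m₂)))
    r = i *F (m₃ +F m₄ *F s)
    c = -F (i *F (m₁ +F m₂ *F s +F m₃ *F Φ s +F m₄ *F (Φ s *F s)))

    Φs : Φ s ≡ -F (i *F m₂)
    Φs = proj₂ (Φ-surjective (-F (i *F m₂)))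

    R₁ : Reaches (λ x y → Φ x *F x) (λ x y → form m₁ m₂ m₃ m₄ (1F *F x +F 0F *F y) (s *F x +F 1F *F y))
    R₁ = inner R 1F 0F s 1F
      (≢-resp 1≢0 (solve 1 (λ s → 𝟙 :* 𝟙 :+ :- (𝟘 :* s) := 𝟙) refl s))
      (λ x y → sym (trans (cong (_*F (1F *F x +F 0F *F y)) (Φ-row Φ-1 Φ-0 x y))
        (solve 4 (λ x y X Y → (𝟙 :* X :+ 𝟘 :* Y) :* (𝟙 :* x :+ 𝟘 :* y) := X :* x) refl x y _ _)))
      (λ _ _ → refl)

    R₂ : Reaches (λ x y → Φ x *F x) (λ x y → r *F (x *F Φ y) +F Φ y *F y)
    R₂ = outer R₁ 1F 0F c i
      (≢-resp (inv-≢0 m₄≢0) (solve 2 (λ i c → 𝟙 :* i :+ :- (𝟘 :* c) := i) refl i c))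
      (λ x y → solve 2 (λ u v → u := 𝟙 :* u :+ 𝟘 :* v) refl _ _)
      (λ x y → trans
        (modulo (-F (Φ x *F y)) Φs
        (modulo (-F (Φ s *F (Φ x *F y) +F Φ y *F y)) (*-invʳ m₄ m₄≢0)
          (solve 11 (λ m₁ m₂ m₃ m₄ i s S x y X Y →
              let r = i :* (m₃ :+ m₄ :* s)
                  c = :- (i :* (m₁ :+ m₂ :* s :+ m₃ :* S :+ m₄ :* (S :* s))) in
              r :* (x :* Y) :+ Y :* y :=
              ((c :* (X :* x) :+ i :* formPoly m₁ m₂ m₃ m₄ (𝟙 :* X :+ 𝟘 :* Y) (S :* X :+ 𝟙 :* Y)
                                                       (𝟙 :* x :+ 𝟘 :* y) (s :* x :+ 𝟙 :* y))
                :+ :- (X :* y) :* (S :+ :- :- (i :* m₂)))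
                :+ :- (S :* (X :* y) :+ Y :* y) :* (m₄ :* i :+ :- 𝟙))
            refl m₁ m₂ m₃ m₄ i s (Φ s) x y (Φ x) (Φ y))))
        (cong (λ z → c *F (Φ x *F x) +F i *F z)
          (sym (form-cong m₁ m₂ m₃ m₄ _ _ (Φ-row Φ-1 Φ-0 x y) (Φ-row refl Φ-1 x y)))))

    conclude : Dec (r ≡ 0F) → NormalForm
    conclude (yes r≡0) = inj₁ (outer R₂ 1F 0F 0F 1F
      (≢-resp 1≢0 (solve 0 (𝟙 :* 𝟙 :+ :- (𝟘 :* 𝟘) := 𝟙) refl))
      (λ x y → solve 2 (λ u v → u := 𝟙 :* u :+ 𝟘 :* v) refl _ _)
      (λ x y → modulo (-F (x *F Φ y)) r≡0 (solve 5 (λ r x y X Y →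
        Y :* y := (𝟘 :* (X :* x) :+ 𝟙 :* (r :* (x :* Y) :+ Y :* y)) :+ :- (x :* Y) :* (r :+ :- 𝟘))
        refl r x y (Φ x) (Φ y))))
    -- Replacing x by x / r normalises the mixed term and gives P₁; `t` undoes the effect on the
    -- first component.
    conclude (no r≢0) = inj₂ (inj₁ (outer R₃ t 0F 0F 1F
      (≢-resp t≢0 (solve 1 (λ t → t :* 𝟙 :+ :- (𝟘 :* 𝟘) := t) refl t))
      (λ x y → trans (modulo (-F (Φ x *F x)) (*-invʳ (Φ j *F j) Φjj≢0)
          (solve 6 (λ t j J x X v →
            X :* x := (t :* ((J :* X) :* (j :* x)) :+ 𝟘 :* v) :+ :- (X :* x) :* ((J :* j) :* t :+ :- 𝟙))
          refl t j (Φ j) x (Φ x) _))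
        (cong (λ z → t *F (z *F (j *F x)) +F 0F *F (r *F ((j *F x) *F Φ y) +F Φ y *F y)) (sym (Φ-* j x))))
      (λ x y → modulo (-F (x *F Φ y)) (*-invʳ r r≢0)
        (solve 6 (λ r j x y Y u →
            x :* Y :+ Y :* y := (𝟘 :* u :+ 𝟙 :* (r :* ((j :* x) :* Y) :+ Y :* y)) :+ :- (x :* Y) :* (r :* j :+ :- 𝟙))
          refl r j x y (Φ y) _))))
      where
      j t : Carrier
      j = inv r
      t = inv (Φ j *F j)
      Φjj≢0 : Φ j *F j ≢ 0F
      Φjj≢0 = *-≢0 (Φ-≢0 (inv-≢0 r≢0)) (inv-≢0 r≢0)
      t≢0 : t ≢ 0F
      t≢0 = inv-≢0 Φjj≢0
      R₃ : Reaches (λ x y → Φ (j *F x) *F (j *F x)) (λ x y → r *F ((j *F x) *F Φ y) +F Φ y *F y)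
      R₃ = inner R₂ j 0F 0F 1F
        (≢-resp (inv-≢0 r≢0) (solve 1 (λ t → t :* 𝟙 :+ :- (𝟘 :* 𝟘) := t) refl j))
        (λ x y → cong (λ z → Φ z *F z) (solve 3 (λ j x y → j :* x := j :* x :+ 𝟘 :* y) refl j x y))
        (λ x y → cong₂ (λ z w → r *F (z *F Φ w) +F Φ w *F w)
          (solve 3 (λ j x y → j :* x := j :* x :+ 𝟘 :* y) refl j x y)
          (solve 2 (λ x y → y := 𝟘 :* x :+ 𝟙 :* y) refl x y))

  -- The second component is made a product of two linear forms by adding a multiple of the first.
  mixedCase : ∀ m₁ m₂ m₃ m₄ → Reaches (λ x y → Φ x *F y) (form m₁ m₂ m₃ m₄) → NormalForm
  mixedCase m₁ m₂ m₃ m₄ R = conclude (m₃ ≟ 0F)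
    where
    -- `Φ x · y` vanishes at (0, 1) and at (1, 0), where the second component equals m₄ and m₁.
    m₄≢0 : m₄ ≢ 0F
    m₄≢0 m₄≡0 = 1≢0 (proj₂ (nonvanishing R 0F 1F
      (trans (cong (_*F 1F) Φ-0) (zeroˡ _)) (trans (form-at-01 m₁ m₂ m₃ m₄) m₄≡0)))

    m₁≢0 : m₁ ≢ 0F
    m₁≢0 m₁≡0 = 1≢0 (proj₁ (nonvanishing R 1F 0F (zeroʳ _) (trans (form-at-10 m₁ m₂ m₃ m₄) m₁≡0)))

    k : Carrier
    k = inv m₁

    conclude : Dec (m₃ ≡ 0F) → NormalForm
    -- Without a term `Φ y · x`, subtracting a multiple of the first component already leaves P₂.
    conclude (yes m₃≡0) = inj₂ (inj₂ (inj₁ (k *F m₄ , *-≢0 (inv-≢0 m₁≢0) m₄≢0 ,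
      outer R 1F 0F (-F (k *F m₂)) k
        (≢-resp (inv-≢0 m₁≢0) (solve 2 (λ k c → 𝟙 :* k :+ :- (𝟘 :* c) := k) refl k _))
        (λ x y → solve 2 (λ u v → u := 𝟙 :* u :+ 𝟘 :* v) refl _ _)
        (λ x y → modulo (-F (Φ x *F x)) (*-invʳ m₁ m₁≢0) (modulo (-F (k *F (Φ y *F x))) m₃≡0
          (solve 9 (λ m₁ m₂ m₃ m₄ k x y X Y →
              X :* x :+ (k :* m₄) :* (Y :* y) :=
              ((:- (k :* m₂) :* (X :* y) :+ k :* formPoly m₁ m₂ m₃ m₄ X Y x y)
                :+ :- (X :* x) :* (m₁ :* k :+ :- 𝟙)) :+ :- (k :* (Y :* x)) :* (m₃ :+ :- 𝟘))
            refl m₁ m₂ m₃ m₄ k x y (Φ x) (Φ y)))))))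
    conclude (no m₃≢0) = conclude′ (a ≟ 0F)
      where
      n₁ n₂ e j a b : Carrier
      n₁ = proj₁ (Φ-surjective m₁)
      n₂ = proj₁ (Φ-surjective m₃)
      -- Chosen so that m₃ Φ e = m₁, hence m₁ Φ x + m₃ Φ y = m₃ Φ (e x + y). The substitution y ↦ e
      -- (y - x) turns this factor into a multiple of Φ y and the other factor into a x + b y.
      e = n₁ *F inv n₂
      j = inv e
      a = m₃ +F -F (m₄ *F e)
      b = m₄ *F e

      Φn₁ : Φ n₁ ≡ m₁
      Φn₁ = proj₂ (Φ-surjective m₁)
      Φn₂ : Φ n₂ ≡ m₃
      Φn₂ = proj₂ (Φ-surjective m₃)

      n₁≢0 : n₁ ≢ 0F
      n₁≢0 n₁≡0 = m₁≢0 (trans (sym Φn₁) (trans (cong Φ n₁≡0) Φ-0))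
      n₂≢0 : n₂ ≢ 0F
      n₂≢0 n₂≡0 = m₃≢0 (trans (sym Φn₂) (trans (cong Φ n₂≡0) Φ-0))
      e≢0 : e ≢ 0F
      e≢0 = *-≢0 n₁≢0 (inv-≢0 n₂≢0)
      b≢0 : b ≢ 0F
      b≢0 = *-≢0 m₄≢0 e≢0

      m₃Φe : m₃ *F Φ e ≡ m₁
      m₃Φe = trans (cong (_*F Φ e) (sym Φn₂)) (trans (sym (Φ-* n₂ e)) (trans (cong Φ n₂e≡n₁) Φn₁))
        where
        n₂e≡n₁ : n₂ *F e ≡ n₁
        n₂e≡n₁ = modulo n₁ (*-invʳ n₂ n₂≢0)
          (solve 3 (λ n m i → m :* (n :* i) := n :+ n :* (m :* i :+ :- 𝟙)) refl n₁ n₂ (inv n₂))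

      R₂ : Reaches (λ x y → Φ x *F y) (λ x y → (m₁ *F Φ x +F m₃ *F Φ y) *F (m₃ *F x +F m₄ *F y))
      -- Scaling by m₃ and replacing the coefficient m₃ m₂ of `Φ x · y` by m₁ m₄ makes the
      -- coefficient matrix singular.
      R₂ = outer R 1F 0F (m₁ *F m₄ +F -F (m₃ *F m₂)) m₃
        (≢-resp m₃≢0 (solve 2 (λ k c → 𝟙 :* k :+ :- (𝟘 :* c) := k) refl m₃ _))
        (λ x y → solve 2 (λ u v → u := 𝟙 :* u :+ 𝟘 :* v) refl _ _)
        (λ x y → solve 8 (λ m₁ m₂ m₃ m₄ x y X Y →
            (m₁ :* X :+ m₃ :* Y) :* (m₃ :* x :+ m₄ :* y) :=
            (m₁ :* m₄ :+ :- (m₃ :* m₂)) :* (X :* y) :+ m₃ :* formPoly m₁ m₂ m₃ m₄ X Y x y)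
          refl m₁ m₂ m₃ m₄ x y (Φ x) (Φ y))

      R₃ : Reaches (λ x y → Φ x *F (-F e *F x +F e *F y))
        (λ x y → (m₁ *F Φ x +F m₃ *F (-F Φ e *F Φ x +F Φ e *F Φ y)) *F (m₃ *F x +F m₄ *F (-F e *F x +F e *F y)))
      R₃ = inner R₂ 1F 0F (-F e) e
        (≢-resp e≢0 (solve 1 (λ e → 𝟙 :* e :+ :- (𝟘 :* :- e) := e) refl e))
        (λ x y → cong (λ z → Φ z *F (-F e *F x +F e *F y)) (x≡ x y))
        (λ x y → cong₂ (λ z w → (m₁ *F Φ z +F m₃ *F w) *F (m₃ *F z +F m₄ *F (-F e *F x +F e *F y)))
          (x≡ x y) (sym (Φ-row (Φ-neg e) refl x y)))
        where
        x≡ : ∀ x y → x ≡ 1F *F x +F 0F *F y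
        x≡ x y = solve 2 (λ x y → x := 𝟙 :* x :+ 𝟘 :* y) refl x y

      R₄ : Reaches (λ x y → Φ x *F x +F -F (Φ x *F y)) (λ x y → a *F (x *F Φ y) +F b *F (Φ y *F y))
      R₄ = outer R₃ (-F j) 0F 0F k
        (≢-resp (*-≢0 (λ -j≡0 → inv-≢0 e≢0 (-x≡0⇒x≡0 -j≡0)) (inv-≢0 m₁≢0))
          (solve 2 (λ j k → :- j :* k :+ :- (𝟘 :* 𝟘) := :- j :* k) refl j k))
        (λ x y → modulo (-F (Φ x *F x +F -F (Φ x *F y))) (*-invʳ e e≢0)
          (solve 6 (λ e j x y X v → X :* x :+ :- (X :* y) :=
              (:- j :* (X :* (:- e :* x :+ e :* y)) :+ 𝟘 :* v) :+ :- (X :* x :+ :- (X :* y)) :* (e :* j :+ :- 𝟙))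
            refl e j x y (Φ x) _))
        (λ x y → let p = m₃ *F x +F m₄ *F (-F e *F x +F e *F y) in
          modulo (-F (Φ y *F p)) (*-invʳ m₁ m₁≢0)
          (modulo (-F (k *F ((Φ y +F -F Φ x) *F p))) m₃Φe
          (solve 11 (λ m₁ m₃ m₄ e E k x y X Y u →
              let p = m₃ :* x :+ m₄ :* (:- e :* x :+ e :* y) in
              (m₃ :+ :- (m₄ :* e)) :* (x :* Y) :+ (m₄ :* e) :* (Y :* y) :=
              ((𝟘 :* u :+ k :* ((m₁ :* X :+ m₃ :* (:- E :* X :+ E :* Y)) :* p))
                :+ :- (Y :* p) :* (m₁ :* k :+ :- 𝟙))
                :+ :- (k :* ((Y :+ :- X) :* p)) :* (m₃ :* E :+ :- m₁))
            refl m₁ m₃ m₄ e (Φ e) k x y (Φ x) (Φ y) _)))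

      conclude′ : Dec (a ≡ 0F) → NormalForm
      conclude′ (no a≢0) = inj₂ (inj₂ (inj₂ (ε , *-≢0 (inv-≢0 a≢0) b≢0 , ε≢-1 , R₅)))
        where
        ε : Carrier
        ε = inv a *F b
        R₅ : Reaches (λ x y → Φ x *F x +F -F (Φ x *F y)) (λ x y → x *F Φ y +F ε *F (Φ y *F y))
        R₅ = outer R₄ 1F 0F 0F (inv a)
          (≢-resp (inv-≢0 a≢0) (solve 1 (λ t → 𝟙 :* t :+ :- (𝟘 :* 𝟘) := t) refl (inv a)))
          (λ x y → solve 2 (λ u v → u := 𝟙 :* u :+ 𝟘 :* v) refl _ _)
          (λ x y → modulo (-F (x *F Φ y)) (*-invʳ a a≢0)
            (solve 7 (λ a b i x y Y u → x :* Y :+ (i :* b) :* (Y :* y) :=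
                (𝟘 :* u :+ i :* (a :* (x :* Y) :+ b :* (Y :* y))) :+ :- (x :* Y) :* (a :* i :+ :- 𝟙))
              refl a b (inv a) x y (Φ y) _))
        -- At (1, 1) the first component is zero and the second is 1 + ε.
        ε≢-1 : ε ≢ -F 1F
        ε≢-1 ε≡-1 = 1≢0 (proj₁ (nonvanishing R₅ 1F 1F (+-invʳ _)
          (trans (cong₂ (λ z w → 1F *F z +F w *F (z *F 1F)) Φ-1 ε≡-1)
            (solve 0 (𝟙 :* 𝟙 :+ :- 𝟙 :* (𝟙 :* 𝟙) := 𝟘) refl))))
      -- Now the second component is a multiple of `Φ y · y`. Exchanging the components and
      -- substituting (-y, x) gives P₁.
      conclude′ (yes a≡0) = inj₂ (inj₁ (outer R₅ 0F i 1F 0F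
          (≢-resp (λ -i≡0 → inv-≢0 b≢0 (-x≡0⇒x≡0 -i≡0)) (solve 1 (λ i → 𝟘 :* 𝟘 :+ :- (i :* 𝟙) := :- i) refl i))
          (λ x y → modulo (-F (Φ x *F x)) (*-invʳ b b≢0) (modulo (-F (i *F (-F y *F Φ x))) a≡0
            (solve 7 (λ a b i x y X u → X :* x :=
                ((𝟘 :* u :+ i :* (a :* (:- y :* X) :+ b :* (X :* x)))
                :+ :- (X :* x) :* (b :* i :+ :- 𝟙)) :+ :- (i :* (:- y :* X)) :* (a :+ :- 𝟘))
              refl a b i x y (Φ x) _)))
          (λ x y → trans
            (solve 5 (λ x y X Y v → x :* Y :+ Y :* y := 𝟙 :* (:- Y :* :- y :+ :- (:- Y :* x)) :+ 𝟘 :* v)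
              refl x y (Φ x) (Φ y) _)
            (cong (λ z → 1F *F (z *F -F y +F -F (z *F x)) +F 0F *F (a *F (-F y *F Φ x) +F b *F (Φ x *F x)))
              (sym (Φ-neg y))))))
        where
        i : Carrier
        i = inv b
        R₅ : Reaches (λ x y → Φ (-F y) *F -F y +F -F (Φ (-F y) *F x))
          (λ x y → a *F (-F y *F Φ x) +F b *F (Φ x *F x))
        R₅ = inner R₄ 0F (-F 1F) 1F 0F (≢-resp 1≢0 (solve 0 (𝟘 :* 𝟘 :+ :- (:- 𝟙 :* 𝟙) := 𝟙) refl))
          (λ x y → cong₂ (λ z w → Φ z *F z +F -F (Φ z *F w)) (-y≡ x y) (x≡ x y))
          (λ x y → cong₂ (λ z w → a *F (z *F Φ w) +F b *F (Φ w *F w)) (-y≡ x y) (x≡ x y))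
          where
          -y≡ : ∀ x y → -F y ≡ 0F *F x +F -F 1F *F y
          -y≡ = solve 2 (λ x y → :- y := 𝟘 :* x :+ :- 𝟙 :* y) refl
          x≡ : ∀ x y → x ≡ 1F *F x +F 0F *F y
          x≡ = solve 2 (λ x y → x := 𝟙 :* x :+ 𝟘 :* y) refl

  -- `X` and `Y` are the rows of the inverse matrix: substituting them makes a x + b y and c x + d y
  -- the new coordinates.
  module ChangeOfBasis (a b c d : Carrier) (δ≢0 : a *F d +F -F (b *F c) ≢ 0F) where
    δ i : Carrier
    δ = a *F d +F -F (b *F c)
    i = inv δ

    X Y : Carrier → Carrier → Carrier
    X x y = i *F d *F x +F -F (i *F b) *F y
    Y x y = -F (i *F c) *F x +F i *F a *F y

    row₁ : ∀ x y → a *F X x y +F b *F Y x y ≡ x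
    row₁ x y = modulo x (*-invʳ δ δ≢0) (solve 7 (λ a b c d i x y →
      a :* (i :* d :* x :+ :- (i :* b) :* y) :+ b :* (:- (i :* c) :* x :+ i :* a :* y) :=
      x :+ x :* ((a :* d :+ :- (b :* c)) :* i :+ :- 𝟙)) refl a b c d i x y)

    row₂ : ∀ x y → c *F X x y +F d *F Y x y ≡ y
    row₂ x y = modulo y (*-invʳ δ δ≢0) (solve 7 (λ a b c d i x y →
      c :* (i :* d :* x :+ :- (i :* b) :* y) :+ d :* (:- (i :* c) :* x :+ i :* a :* y) :=
      y :+ y :* ((a :* d :+ :- (b :* c)) :* i :+ :- 𝟙)) refl a b c d i x y)

    det≢0 : (i *F d) *F (i *F a) +F -F (-F (i *F b) *F -F (i *F c)) ≢ 0F
    det≢0 = ≢-resp (*-≢0 (inv-≢0 δ≢0) (*-≢0 (inv-≢0 δ≢0) δ≢0))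
      (solve 5 (λ a b c d i → (i :* d) :* (i :* a) :+ :- (:- (i :* b) :* :- (i :* c))
        := i :* (i :* (a :* d :+ :- (b :* c)))) refl a b c d i)

    change : ∀ {g₁ g₂ h₁} → Reaches g₁ g₂ → (∀ x y → h₁ x y ≡ g₁ (X x y) (Y x y)) → IsForm g₂ →
      ∃ λ m₁ → ∃ λ m₂ → ∃ λ m₃ → ∃ λ m₄ → Reaches h₁ (form m₁ m₂ m₃ m₄)
    change R h₁≡ g₂-form =
      let (m₁ , m₂ , m₃ , m₄ , g₂≡) = isForm-∘ g₂-form (i *F d) (-F (i *F b)) (-F (i *F c)) (i *F a)
      in m₁ , m₂ , m₃ , m₄ , inner R _ _ _ _ det≢0 h₁≡ (λ x y → sym (g₂≡ x y))

  module _ (α₁ α₂ b₁ b₂ : Carrier) {g₁ g₂} (R : Reaches g₁ g₂) (g₂-form : IsForm g₂)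
    (g₁≡ : ∀ x y → g₁ x y ≡ Φ (α₁ *F x +F α₂ *F y) *F (b₁ *F x +F b₂ *F y)) where

    independentCase : α₁ *F b₂ +F -F (α₂ *F b₁) ≢ 0F → NormalForm
    independentCase δ≢0 =
      let (m₁ , m₂ , m₃ , m₄ , R′) = change R
            (λ x y → sym (trans (g₁≡ (X x y) (Y x y)) (cong₂ (λ z w → Φ z *F w) (row₁ x y) (row₂ x y)))) g₂-form
      in mixedCase m₁ m₂ m₃ m₄ R′
      where open ChangeOfBasis α₁ α₂ b₁ b₂ δ≢0

    -- The second linear form is t times the first and cannot be the other coordinate; (c, d) is any
    -- row that completes the first to a basis.
    proportionalCase : ∀ t c d → α₁ *F d +F -F (α₂ *F c) ≢ 0F → t ≢ 0F →
      b₁ ≡ t *F α₁ → b₂ ≡ t *F α₂ → NormalForm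
    proportionalCase t c d δ≢0 t≢0 b₁≡ b₂≡ =
      let (m₁ , m₂ , m₃ , m₄ , R′) = change R
            (λ x y → sym (trans (g₁≡ (X x y) (Y x y)) (trans
              (cong₂ (λ b b′ → Φ (α₁ *F X x y +F α₂ *F Y x y) *F (b *F X x y +F b′ *F Y x y)) b₁≡ b₂≡)
              (trans (solve 6 (λ Z t a b x y → Z :* ((t :* a) :* x :+ (t :* b) :* y) := Z :* (t :* (a :* x :+ b :* y)))
                  refl _ t α₁ α₂ _ _)
                (cong (λ z → Φ z *F (t *F z)) (row₁ x y)))))) g₂-form
      in squareCase m₁ m₂ m₃ m₄ (outer R′ (inv t) 0F 0F 1F
        (≢-resp (inv-≢0 t≢0) (solve 1 (λ t → t :* 𝟙 :+ :- (𝟘 :* 𝟘) := t) refl (inv t)))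
        (λ x y → modulo (-F (Φ x *F x)) (*-invʳ t t≢0)
          (solve 5 (λ t i x X v → X :* x := (i :* (X :* (t :* x)) :+ 𝟘 :* v) :+ :- (X :* x) :* (t :* i :+ :- 𝟙))
            refl t (inv t) x (Φ x) _))
        (λ x y → solve 2 (λ u v → v := 𝟘 :* u :+ 𝟙 :* v) refl _ _))
      where open ChangeOfBasis α₁ α₂ c d δ≢0

    rankOneCase : ¬ (α₁ ≡ 0F × α₂ ≡ 0F) → ¬ (b₁ ≡ 0F × b₂ ≡ 0F) → NormalForm
    rankOneCase α≢0 b≢0 with (α₁ *F b₂ +F -F (α₂ *F b₁)) ≟ 0F | α₁ ≟ 0F | α₂ ≟ 0F
    ... | no δ≢0 | _ | _ = independentCase δ≢0
    ... | yes _ | yes α₁≡0 | yes α₂≡0 = ⊥-elim (α≢0 (α₁≡0 , α₂≡0))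
    ... | yes δ≡0 | no α₁≢0 | _ = proportionalCase t 0F 1F
          (≢-resp α₁≢0 (solve 2 (λ a b → a :* 𝟙 :+ :- (b :* 𝟘) := a) refl α₁ α₂))
          (λ t≡0 → b≢0 (trans b₁≡ (trans (cong (_*F α₁) t≡0) (zeroˡ _)) , trans b₂≡ (trans (cong (_*F α₂) t≡0) (zeroˡ _))))
          b₁≡ b₂≡
      where
      t : Carrier
      t = inv α₁ *F b₁
      b₁≡ : b₁ ≡ t *F α₁
      b₁≡ = modulo (-F b₁) (*-invʳ α₁ α₁≢0)
        (solve 3 (λ a b i → b := (i :* b) :* a :+ :- b :* (a :* i :+ :- 𝟙)) refl α₁ b₁ (inv α₁))
      b₂≡ : b₂ ≡ t *F α₂
      b₂≡ = modulo (-F b₂) (*-invʳ α₁ α₁≢0) (modulo (inv α₁) δ≡0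
        (solve 5 (λ a a′ b b′ i →
            b′ := ((i :* b) :* a′ :+ :- b′ :* (a :* i :+ :- 𝟙)) :+ i :* ((a :* b′ :+ :- (a′ :* b)) :+ :- 𝟘))
          refl α₁ α₂ b₁ b₂ (inv α₁)))
    ... | yes δ≡0 | yes _ | no α₂≢0 = proportionalCase t 1F 0F
          (≢-resp (λ -α₂≡0 → α₂≢0 (-x≡0⇒x≡0 -α₂≡0)) (solve 2 (λ a b → a :* 𝟘 :+ :- (b :* 𝟙) := :- b) refl α₁ α₂))
          (λ t≡0 → b≢0 (trans b₁≡ (trans (cong (_*F α₁) t≡0) (zeroˡ _)) , trans b₂≡ (trans (cong (_*F α₂) t≡0) (zeroˡ _))))
          b₁≡ b₂≡
      where
      t : Carrier
      t = inv α₂ *F b₂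
      b₂≡ : b₂ ≡ t *F α₂
      b₂≡ = modulo (-F b₂) (*-invʳ α₂ α₂≢0)
        (solve 3 (λ a b i → b := (i :* b) :* a :+ :- b :* (a :* i :+ :- 𝟙)) refl α₂ b₂ (inv α₂))
      b₁≡ : b₁ ≡ t *F α₁
      b₁≡ = modulo (-F b₁) (*-invʳ α₂ α₂≢0) (modulo (-F inv α₂) δ≡0
        (solve 5 (λ a a′ b b′ i →
            b := ((i :* b′) :* a :+ :- b :* (a′ :* i :+ :- 𝟙)) :+ :- i :* ((a :* b′ :+ :- (a′ :* b)) :+ :- 𝟘))
          refl α₁ α₂ b₁ b₂ (inv α₂)))

  -- Surjectivity of `Φ` writes the column of the rank-one factorisation as (Φ α₁, Φ α₂), so the
  -- form is `Φ` of a linear form times a linear form. Neither factor is zero because the form is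
  -- not.
  singularForm : ∀ h₁ h₂ h₃ h₄ {g₂} → Reaches (form h₁ h₂ h₃ h₄) g₂ → IsForm g₂ →
    h₁ *F h₄ ≡ h₂ *F h₃ → ¬ (h₁ ≡ 0F × h₂ ≡ 0F × h₃ ≡ 0F × h₄ ≡ 0F) → NormalForm
  singularForm h₁ h₂ h₃ h₄ R g₂-form det h≢0 =
    let (A₁ , A₂ , b₁ , b₂ , h₁≡ , h₂≡ , h₃≡ , h₄≡) = rankOne _≟_ h₁ h₂ h₃ h₄ det
        (α₁ , Φα₁) = Φ-surjective A₁
        (α₂ , Φα₂) = Φ-surjective A₂
        zero-row : ∀ {A α} → Φ α ≡ A → α ≡ 0F → A ≡ 0F
        zero-row Φα≡A α≡0 = trans (sym Φα≡A) (trans (cong Φ α≡0) Φ-0)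
        left : ∀ {h A b} → h ≡ A *F b → A ≡ 0F → h ≡ 0F
        left {b = b} h≡ A≡0 = trans h≡ (trans (cong (_*F b) A≡0) (zeroˡ b))
        right : ∀ {h A b} → h ≡ A *F b → b ≡ 0F → h ≡ 0F
        right {A = A} h≡ b≡0 = trans h≡ (trans (cong (A *F_) b≡0) (zeroʳ A))
    in rankOneCase α₁ α₂ b₁ b₂ R g₂-form
      (λ x y → trans
        (trans (form-coeffs h₁≡ h₂≡ h₃≡ h₄≡ x y) (sym (product-expand A₁ A₂ b₁ b₂ x y)))
        (cong (_*F (b₁ *F x +F b₂ *F y)) (sym (Φ-row Φα₁ Φα₂ x y))))
      (λ (α₁≡0 , α₂≡0) → h≢0 (left h₁≡ (zero-row Φα₁ α₁≡0) , left h₂≡ (zero-row Φα₁ α₁≡0) ,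
        left h₃≡ (zero-row Φα₂ α₂≡0) , left h₄≡ (zero-row Φα₂ α₂≡0)))
      (λ (b₁≡0 , b₂≡0) → h≢0 (right h₁≡ b₁≡0 , right h₂≡ b₂≡0 , right h₃≡ b₁≡0 , right h₄≡ b₂≡0))

  -- The singular combination becomes the first component. The original form kept beside it is the
  -- one whose partner has a nonzero coefficient, which makes the recombination invertible.
  singularPencil : ∀ m₁ m₂ m₃ m₄ n₁ n₂ n₃ n₄ → Reaches (form m₁ m₂ m₃ m₄) (form n₁ n₂ n₃ n₄) →
    ∀ u v → ¬ (u ≡ 0F × v ≡ 0F) →
    let h₁ = u *F m₁ +F v *F n₁ ; h₂ = u *F m₂ +F v *F n₂
        h₃ = u *F m₃ +F v *F n₃ ; h₄ = u *F m₄ +F v *F n₄ in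
    h₁ *F h₄ ≡ h₂ *F h₃ → ¬ (h₁ ≡ 0F × h₂ ≡ 0F × h₃ ≡ 0F × h₄ ≡ 0F) → NormalForm
  singularPencil m₁ m₂ m₃ m₄ n₁ n₂ n₃ n₄ R u v uv≢0 det h≢0 = by-cases (u ≟ 0F) (v ≟ 0F)
    where
    combine : ∀ x y → _
    combine = form-combine m₁ m₂ m₃ m₄ n₁ n₂ n₃ n₄ u v

    by-cases : Dec (u ≡ 0F) → Dec (v ≡ 0F) → NormalForm
    by-cases (yes u≡0) (yes v≡0) = ⊥-elim (uv≢0 (u≡0 , v≡0))
    by-cases (no u≢0) _ = singularForm _ _ _ _
      (outer R u v 0F 1F (≢-resp u≢0 (solve 2 (λ u v → u :* 𝟙 :+ :- (v :* 𝟘) := u) refl u v)) combine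
        (λ x y → solve 2 (λ a b → b := 𝟘 :* a :+ 𝟙 :* b) refl _ _))
      (form-isForm n₁ n₂ n₃ n₄) det h≢0
    by-cases (yes _) (no v≢0) = singularForm _ _ _ _
      (outer R u v 1F 0F (≢-resp (λ -v≡0 → v≢0 (-x≡0⇒x≡0 -v≡0))
          (solve 2 (λ u v → u :* 𝟘 :+ :- (v :* 𝟙) := :- v) refl u v)) combine
        (λ x y → solve 2 (λ a b → a := 𝟙 :* a :+ 𝟘 :* b) refl _ _))
      (form-isForm m₁ m₂ m₃ m₄) det h≢0

-- Frobenius automorphisms and square classes

module _ (F : Field) {p m : ℕ} (pr : Prime p) (size : HasSize F (p ℕ.^ m)) (l : ℕ) where
  open FieldProperties F
  open CharP F pr (charP F p m size)
  open Finite size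

  frobenius-injective : Injective _≡_ _≡_ (λ x → pow F x (p ℕ.^ l))
  frobenius-injective {x} {y} eq = x-y≡0⇒x≡y (decidable-stable ((x +F -F y) ≟ 0F)
    λ x-y≢0 → pow-≢0 (p ℕ.^ l) x-y≢0 (modulo 1F eq (trans
      (solve 3 (λ a b c → a := (con (+ 0) :+ con (+ 1) :* (b :+ :- c)) :+ (a :+ c :+ :- b)) refl
        (pow F (x +F -F y) (p ℕ.^ l)) (pow F x (p ℕ.^ l)) (pow F y (p ℕ.^ l)))
      (trans (cong (λ z → (0F +F 1F *F (pow F x (p ℕ.^ l) +F -F pow F y (p ℕ.^ l))) +F (z +F -F pow F x (p ℕ.^ l)))
          (trans (sym (frobenius^-+ l (x +F -F y) y)) (cong (λ z → pow F z (p ℕ.^ l)) x-y+y≡x)))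
        (solve 2 (λ a b → (a :+ (b :+ :- b)) := a) refl _ (pow F x (p ℕ.^ l)))))))
    where
    x-y+y≡x : (x +F -F y) +F y ≡ x
    x-y+y≡x = solve 2 (λ x y → (x :+ :- y) :+ y := x) refl x y

  frobeniusAutomorphism : Automorphism F
  frobeniusAutomorphism = record
    { Φ = λ x → pow F x (p ℕ.^ l)
    ; Φ-+ = frobenius^-+ l
    ; Φ-* = λ x y → pow-*-base x y (p ℕ.^ l)
    ; Φ-1 = pow-1-base (p ℕ.^ l)
    ; Φ-surjective = injective⇒surjective size size _ frobenius-injective }

-- No count of the squares is needed: an injection φ of F into itself with values x² or d x² is
-- onto. With d = θ² this makes every element of the smaller field a square in the larger one.
squareOrTwist : ∀ F {n} → HasSize F n → let open FieldProperties F in ∀ d →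
  (∀ s → s *F s ≢ d) → ∀ δ → ∃ λ x → x *F x ≡ δ ⊎ d *F (x *F x) ≡ δ
squareOrTwist F size d d-nonsquare δ =
  let (x , φx≡δ) = injective⇒surjective size size φ φ-injective δ in x , classify x φx≡δ
  where
  open FieldProperties F
  open Finite size
  open Inverse size using (to)

  -- Chooses one of x and −x, so that squares of chosen x and d times squares of the others
  -- are pairwise distinct and hence exhaust the field.
  chosen? : ∀ x → Dec (to x Fin.≤ to (-F x))
  chosen? x = to x Fin.≤? to (-F x)

  d≢0 : d ≢ 0F
  d≢0 d≡0 = d-nonsquare 0F (trans (zeroˡ 0F) (sym d≡0))

  value : ∀ {x} → Dec (to x Fin.≤ to (-F x)) → Carrier
  value {x} (yes _) = x *F x
  value {x} (no _) = d *F (x *F x)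

  φ : Carrier → Carrier
  φ x = value (chosen? x)

  classify : ∀ x → φ x ≡ δ → x *F x ≡ δ ⊎ d *F (x *F x) ≡ δ
  classify x with chosen? x
  ... | yes _ = inj₁
  ... | no _ = inj₂

  ±-root : ∀ {x y} → x *F x ≡ y *F y → x ≢ y → -F x ≡ y
  ±-root {x} {y} eq x≢y = sym (x-y≡0⇒x≡y (trans (solve 2 (λ x y → y :+ :- :- x := x :+ y) refl x y)
    (x*y≡0⇒y≡0 (x≢y ∘ x-y≡0⇒x≡y) (modulo 1F eq
      (solve 2 (λ x y → (x :+ :- y) :* (x :+ y) := con (+ 0) :+ con (+ 1) :* (x :* x :+ :- (y :* y))) refl x y)))))

  ±-root-sym : ∀ {x y} → -F x ≡ y → -F y ≡ x
  ±-root-sym {x} refl = -‿involutive x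

  twist-absurd : ∀ {x y} → ¬ (to y Fin.≤ to (-F y)) → x *F x ≢ d *F (y *F y)
  twist-absurd {x} {y} y-unchosen eq = d-nonsquare (x *F inv y)
    (modulo (inv y *F inv y) eq (modulo (d *F (y *F inv y +F 1F)) (*-invʳ y y≢0)
      (solve 4 (λ x y d i → (x :* i) :* (x :* i) :=
          (d :+ (i :* i) :* (x :* x :+ :- (d :* (y :* y)))) :+ (d :* (y :* i :+ con (+ 1))) :* (y :* i :+ :- con (+ 1)))
        refl x y d (inv y))))
    where
    -- Zero is always chosen because -0 = 0, so an unchosen element can be inverted.
    y≢0 : y ≢ 0F
    y≢0 refl = y-unchosen (ℕ.≤-reflexive (cong (Fin.toℕ ∘ to) (sym -0#≈0#)))

  φ-injective : Injective _≡_ _≡_ φ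
  φ-injective {x} {y} eq with x ≟ y
  ... | yes x≡y = x≡y
  ... | no x≢y with chosen? x | chosen? y
  ...   | yes x≤-x | yes y≤-y = to-injective (Fin.toℕ-injective (ℕ.≤-antisym
            (subst (λ z → to x Fin.≤ to z) -x≡y x≤-x)
            (subst (λ z → to y Fin.≤ to z) (±-root-sym -x≡y) y≤-y)))
    where
    -x≡y : -F x ≡ y
    -x≡y = ±-root eq x≢y
  ...   | no x≰-x | no y≰-y = ⊥-elim (ℕ.<-asym
            (subst (λ z → to z Fin.< to x) -x≡y (ℕ.≰⇒> x≰-x))
            (subst (λ z → to z Fin.< to y) (±-root-sym -x≡y) (ℕ.≰⇒> y≰-y)))
    where
    -x≡y : -F x ≡ y
    -x≡y = ±-root (*-cancelˡ d≢0 eq) x≢y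
  ...   | yes _ | no y≰-y = ⊥-elim (twist-absurd y≰-y eq)
  ...   | no x≰-x | yes _ = ⊥-elim (twist-absurd x≰-x (sym eq))

-- The quadratic extension K of L

module QuadraticExtension {p} (k l : ℕ) (pr : Prime p) (p≢2 : p ≢ 2) (L K : Field)
  (sizeL : HasSize L (p ℕ.^ suc k)) (sizeK : HasSize K (p ℕ.^ (2 ℕ.* suc k))) where

  q Q : ℕ
  q = p ℕ.^ suc k
  Q = p ℕ.^ l

  module L where
    open FieldProperties L public
    open Finite sizeL public
    open Automorphism (frobeniusAutomorphism L {m = suc k} pr sizeL l) public

  open FieldProperties K
  open Finite sizeK
  open CharP K pr (charP K p (2 ℕ.* suc k) sizeK)
  open Automorphism (frobeniusAutomorphism K {m = 2 ℕ.* suc k} pr sizeK l)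

  p^2k≡q*q : p ℕ.^ (2 ℕ.* suc k) ≡ q ℕ.* q
  p^2k≡q*q = trans (cong (λ m → p ℕ.^ (suc k ℕ.+ m)) (ℕ.+-identityʳ (suc k))) (ℕ.^-distribˡ-+-* p (suc k) (suc k))

  sizeK′ : HasSize K (q ℕ.* q)
  sizeK′ = subst (HasSize K) p^2k≡q*q sizeK

  1<q : 1 ℕ.< q
  1<q = 1<p^ pr (suc k) (λ ())

  abstract
    embedding : Embedding L K
    embedding = FieldEmbedding.embedding k (2 ℕ.* suc k) pr (λ ()) L K sizeL sizeK
      (λ a → trans (cong (pow L a) p^2k≡q*q) (trans (L.pow-pow a q q)
        (trans (cong (λ b → pow L b q) (fermat L q sizeL a)) (fermat L q sizeL a))))

  open Embedding embedding

  module Conj = Automorphism (frobeniusAutomorphism K {m = 2 ℕ.* suc k} pr sizeK (suc k))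
  open Conj using () renaming
    (Φ to conj; Φ-+ to conj-+; Φ-* to conj-*; Φ-1 to conj-1; Φ-0 to conj-0; Φ-neg to conj-neg; Φ-≢0 to conj-≢0)

  conj-conj : ∀ x → conj (conj x) ≡ x
  conj-conj x = trans (sym (pow-pow x q q)) (fermat K (q ℕ.* q) sizeK′ x)

  Φ-conj : ∀ x → Φ (conj x) ≡ conj (Φ x)
  Φ-conj x = trans (sym (pow-pow x q Q)) (trans (cong (pow K x) (ℕ.*-comm q Q)) (pow-pow x Q q))

  χ-0 : χ L.0F ≡ 0F
  χ-0 = trans (solve 1 (λ a → a := (a :+ a) :+ :- a) refl _)
    (trans (cong (_+F -F χ L.0F) (trans (sym (χ-+ _ _)) (cong χ (L.+-idʳ L.0F)))) (+-invʳ _))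

  χ-neg : ∀ a → χ (L.-F a) ≡ -F χ a
  χ-neg a = x-y≡0⇒x≡y (trans (cong (χ (L.-F a) +F_) (-‿involutive (χ a)))
    (trans (sym (χ-+ _ _)) (trans (cong χ (trans (L.+-comm _ _) (L.+-invʳ a))) χ-0)))

  χ-≢0 : ∀ {a} → a ≢ L.0F → χ a ≢ 0F
  χ-≢0 {a} a≢0 χa≡0 = 1≢0 (trans (sym χ-1) (trans (cong χ (sym (L.*-invʳ a a≢0)))
    (trans (χ-* _ _) (trans (cong (_*F χ (L.inv a)) χa≡0) (zeroˡ _)))))

  χ-≡0 : ∀ {a} → χ a ≡ 0F → a ≡ L.0F
  χ-≡0 {a} χa≡0 = decidable-stable (a L.≟ L.0F) (λ a≢0 → χ-≢0 a≢0 χa≡0)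

  χ-injective : Injective _≡_ _≡_ χ
  χ-injective {a} {b} eq = L.x-y≡0⇒x≡y (χ-≡0 (trans (χ-+ _ _)
    (trans (cong₂ _+F_ eq (χ-neg b)) (+-invʳ _))))

  χ-Φ : ∀ a → χ (L.Φ a) ≡ Φ (χ a)
  χ-Φ a = χ-pow a Q

  conj-χ : ∀ a → conj (χ a) ≡ χ a
  conj-χ a = trans (sym (χ-pow a q)) (cong χ (fermat L q sizeL a))

  -- The image of L already supplies q distinct roots of X^q - X.
  conj-fixed : ∀ x → conj x ≡ x → ∃ λ a → χ a ≡ x
  conj-fixed x x̄≡x =
    let (i , eq) = allRoots K _≟_ (X^-X q 1<q) (χ ∘ Inverse.from sizeL) (L.from-injective ∘ χ-injective)
          (λ i → monicVal-X^-X q 1<q _ (conj-χ _)) x (monicVal-X^-X q 1<q x x̄≡x)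
    in Inverse.from sizeL i , eq

  2≢0 : 1F +F 1F ≢ 0F
  2≢0 2≡0 = times-1-≢0 2 (ℕ.≤∧≢⇒< (prime⇒>1 pr) (p≢2 ∘ sym)) (trans (cong (1F +F_) (+-idʳ 1F)) 2≡0)

  x+x≢0 : ∀ {x} → x ≢ 0F → x +F x ≢ 0F
  x+x≢0 {x} x≢0 = ≢-resp (*-≢0 2≢0 x≢0) (solve 1 (λ x → x :+ x := (𝟙 :+ 𝟙) :* x) refl x)

  -- X^q - X has too few roots to vanish on all q² elements.
  moved : ∃ λ z → conj z ≢ z
  moved with any? (λ z → ¬? (conj z ≟ z))
  ... | yes found = found
  ... | no fixed = ⊥-elim (fewRoots (X^-X q 1<q) (λ i → Inverse.from sizeK′ (Fin.inject≤ i q<q*q))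
          (λ eq → Fin.inject≤-injective _ _ _ _ (Finite.from-injective sizeK′ eq))
          (λ i → monicVal-X^-X q 1<q _ (decidable-stable (_ ≟ _) λ ≢ → fixed (_ , ≢))))
    where
    q<q*q : q ℕ.< q ℕ.* q
    q<q*q = ℕ.m<m*n q q {{ℕ.>-nonZero (ℕ.<-trans (ℕ.n<1+n 0) 1<q)}} 1<q

  abstract
    -- A difference z - z̄ changes sign under conjugation. Hence its square descends to L, and as 2
    -- is invertible, 1 and θ are independent over L.
    θ : Carrier
    θ = proj₁ moved +F -F conj (proj₁ moved)

    conj-θ : conj θ ≡ -F θ
    conj-θ = let z = proj₁ moved in trans (conj-+ _ _) (trans
      (cong (conj z +F_) (trans (conj-neg (conj z)) (cong -F_ (conj-conj z))))
      (solve 2 (λ z z̄ → z̄ :+ :- z := :- (z :+ :- z̄)) refl z (conj z)))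

    θ≢0 : θ ≢ 0F
    θ≢0 θ≡0 = proj₂ moved (sym (x-y≡0⇒x≡y θ≡0))

  d∃ : ∃ λ d → χ d ≡ θ *F θ
  d∃ = conj-fixed (θ *F θ) (trans (conj-* θ θ) (trans (cong₂ _*F_ conj-θ conj-θ)
    (solve 1 (λ t → :- t :* :- t := t :* t) refl θ)))

  abstract
    d : L.Carrier
    d = proj₁ d∃

    χ-d : χ d ≡ θ *F θ
    χ-d = proj₂ d∃

  d≢0 : d ≢ L.0F
  d≢0 d≡0 = *-≢0 θ≢0 θ≢0 (trans (sym χ-d) (trans (cong χ d≡0) χ-0))

  -- A root s in L would give θ = ± χ s, which conjugation fixes, whereas it negates θ and 2 θ is
  -- nonzero.
  d-nonsquare : ∀ s → s L.*F s ≢ d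
  d-nonsquare s s²≡d = x+x≢0 θ≢0 (trans (cong (θ +F_) θ≡-θ) (+-invʳ θ))
    where
    [θ-s][θ+s]≡0 : (θ +F -F χ s) *F (θ +F χ s) ≡ 0F
    [θ-s][θ+s]≡0 = modulo 1F (trans (sym χ-d) (trans (cong χ (sym s²≡d)) (χ-* s s)))
      (solve 2 (λ t s → (t :+ :- s) :* (t :+ s) := 𝟘 :+ 𝟙 :* (t :* t :+ :- (s :* s))) refl θ (χ s))
    fixed⇒ : conj θ ≡ θ → θ ≡ -F θ
    fixed⇒ eq = trans (sym eq) conj-θ
    by-cases : Dec (θ +F -F χ s ≡ 0F) → θ ≡ -F θ
    by-cases (yes θ-s≡0) = fixed⇒ (trans (cong conj θ≡s) (trans (conj-χ s) (sym θ≡s)))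
      where
      θ≡s : θ ≡ χ s
      θ≡s = x-y≡0⇒x≡y θ-s≡0
    by-cases (no θ-s≢0) =
      fixed⇒ (trans (cong conj θ≡-s) (trans (conj-neg _) (trans (cong -F_ (conj-χ s)) (sym θ≡-s))))
      where
      θ≡-s : θ ≡ -F χ s
      θ≡-s = x-y≡0⇒x≡y (trans (cong (θ +F_) (-‿involutive (χ s))) (x*y≡0⇒y≡0 θ-s≢0 [θ-s][θ+s]≡0))
    θ≡-θ : θ ≡ -F θ
    θ≡-θ = by-cases (_ ≟ 0F)

  -- Coordinates of K over L

  VK P : AddSpace
  VK = FieldSpace K
  P = PairSpace L

  spaceK : FiniteSpace VK (q ℕ.* q)
  spaceK = fieldSpace K sizeK′

  spaceP : FiniteSpace P (q ℕ.* q)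
  spaceP = pairSpace L sizeL

  lin : Carrier → Carrier → V P → Carrier
  lin a b (x , y) = a *F χ x +F b *F χ y

  lin-bij : ∀ a b → (∀ v → lin a b v ≡ 0F → v ≡ (L.0F , L.0F)) → IsFpLinearBij P VK (lin a b)
  lin-bij a b = linearBij spaceP spaceK (lin a b) λ (x , y) (x′ , y′) →
    trans (cong₂ (λ u v → a *F u +F b *F v) (χ-+ x x′) (χ-+ y y′))
      (solve 6 (λ a b x y x′ y′ → a :* (x :+ x′) :+ b :* (y :+ y′) := (a :* x :+ b :* y) :+ (a :* x′ :+ b :* y′))
        refl a b _ _ _ _)

  ι : V P → Carrier
  ι = lin 1F θ

  conj-ι : ∀ x y → conj (ι (x , y)) ≡ 1F *F χ x +F -F θ *F χ y
  conj-ι x y = trans (Conj.Φ-combo 1F θ (χ x) (χ y))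
    (cong₂ _+F_ (cong₂ _*F_ conj-1 (conj-χ x)) (cong₂ _*F_ conj-θ (conj-χ y)))

  ι-kernel : ∀ v → ι v ≡ 0F → v ≡ (L.0F , L.0F)
  ι-kernel (x , y) ιv≡0 = cong₂ _,_ (χ-≡0 χx≡0) (χ-≡0 χy≡0)
    where
    conj≡0 : 1F *F χ x +F -F θ *F χ y ≡ 0F
    conj≡0 = trans (sym (conj-ι x y)) (trans (cong conj ιv≡0) conj-0)
    χx≡0 : χ x ≡ 0F
    χx≡0 = x*y≡0⇒y≡0 2≢0 (modulo 1F ιv≡0 (modulo 1F conj≡0
      (solve 3 (λ t x y → (𝟙 :+ 𝟙) :* x :=
          (𝟘 :+ 𝟙 :* ((𝟙 :* x :+ t :* y) :+ :- 𝟘)) :+ 𝟙 :* ((𝟙 :* x :+ :- t :* y) :+ :- 𝟘))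
        refl θ (χ x) (χ y))))
    χy≡0 : χ y ≡ 0F
    χy≡0 = x*y≡0⇒y≡0 θ≢0 (modulo 1F ιv≡0 (modulo (-F 1F) χx≡0
      (solve 3 (λ t x y → t :* y := (𝟘 :+ 𝟙 :* ((𝟙 :* x :+ t :* y) :+ :- 𝟘)) :+ :- 𝟙 :* (x :+ :- 𝟘))
        refl θ (χ x) (χ y))))

  ι-bij : IsFpLinearBij P VK ι
  ι-bij = lin-bij 1F θ ι-kernel

  abstract
    ι-inverse : Σ (Carrier → V P) λ ι⁻¹ → IsFpLinearBij VK P ι⁻¹ × (∀ z → ι (ι⁻¹ z) ≡ z)
    ι-inverse = inverse-bij ι-bij

  ι⁻¹ : Carrier → V P
  ι⁻¹ = proj₁ ι-inverse

  ι-ι⁻¹ : ∀ z → ι (ι⁻¹ z) ≡ z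
  ι-ι⁻¹ = proj₂ (proj₂ ι-inverse)

  χ-form : ∀ m₁ m₂ m₃ m₄ x y →
    χ (L.form m₁ m₂ m₃ m₄ x y) ≡ form (χ m₁) (χ m₂) (χ m₃) (χ m₄) (χ x) (χ y)
  χ-form m₁ m₂ m₃ m₄ x y = trans (χ-+ _ _) (cong₂ _+F_ (trans (χ-+ _ _) (cong₂ _+F_ (trans (χ-+ _ _) (cong₂ _+F_
    (term m₁ x x) (term m₂ x y))) (term m₃ y x))) (term m₄ y y))
    where
    term : ∀ m x y → χ (m L.*F (L.Φ x L.*F y)) ≡ χ m *F (Φ (χ x) *F χ y)
    term m x y = trans (χ-* _ _) (cong (χ m *F_) (trans (χ-* _ _) (cong (_*F χ y) (χ-Φ x))))

  -- A pair of forms over L is a single form with coefficients in K, evaluated at arguments from L;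
  -- this passes between pencils over L and factorisations over K.
  ι-form : ∀ m₁ m₂ m₃ m₄ n₁ n₂ n₃ n₄ x y →
    ι (L.form m₁ m₂ m₃ m₄ x y , L.form n₁ n₂ n₃ n₄ x y) ≡
    form (ι (m₁ , n₁)) (ι (m₂ , n₂)) (ι (m₃ , n₃)) (ι (m₄ , n₄)) (χ x) (χ y)
  ι-form m₁ m₂ m₃ m₄ n₁ n₂ n₃ n₄ x y = trans
    (cong₂ (λ u v → 1F *F u +F θ *F v) (χ-form m₁ m₂ m₃ m₄ x y) (χ-form n₁ n₂ n₃ n₄ x y))
    (solve 13 (λ t m₁ m₂ m₃ m₄ n₁ n₂ n₃ n₄ a b c d →
        𝟙 :* (m₁ :* a :+ m₂ :* b :+ m₃ :* c :+ m₄ :* d) :+ t :* (n₁ :* a :+ n₂ :* b :+ n₃ :* c :+ n₄ :* d) :=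
        (𝟙 :* m₁ :+ t :* n₁) :* a :+ (𝟙 :* m₂ :+ t :* n₂) :* b :+ (𝟙 :* m₃ :+ t :* n₃) :* c :+ (𝟙 :* m₄ :+ t :* n₄) :* d)
      refl θ (χ m₁) (χ m₂) (χ m₃) (χ m₄) (χ n₁) (χ n₂) (χ n₃) (χ n₄) _ _ _ _)

  open Paper K L q Q using (fc; Ac; inMu; f1; f2; gConstant; ANoRootsInMu; Conclusion)

  f1-conj : ∀ X → f1 X ≡ Φ X *F conj X
  f1-conj X = pow-+ X Q q

  f2-conj : ∀ ε X → f2 ε X ≡ Φ X *F conj X +F ε *F (Φ X *F X)
  f2-conj ε X = cong₂ (λ u v → u +F ε *F v) (pow-+ X Q q) (pow-+1 X Q)

  ε̄ε≡1 : ∀ ε → inMu ε → conj ε *F ε ≡ 1F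
  ε̄ε≡1 ε ε∈μ = trans (sym (pow-+1 ε q)) ε∈μ

  scale-bij : ∀ {c} → c ≢ 0F → IsFpLinearBij VK VK (c *F_)
  scale-bij c≢0 = linearBij spaceK spaceK _ (distribˡ _) (λ _ → x*y≡0⇒y≡0 c≢0)

  -- The map f in coordinates, and the independence of its components

  module _ (c₀ c₁ c₂ c₃ : Carrier) where

    f : Carrier → Carrier
    f = fc c₀ c₁ c₂ c₃

    f-conj : ∀ X → f X ≡ c₀ *F (Φ (conj X) *F conj X) +F c₁ *F (Φ (conj X) *F X) +F
                         c₂ *F (Φ X *F conj X) +F c₃ *F (Φ X *F X)
    f-conj X = cong₂ _+F_ (cong₂ _+F_ (cong₂ _+F_
      (cong (c₀ *F_) (trans (pow-+ X (q ℕ.* Q) q) (cong (_*F conj X) (pow-pow X q Q))))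
      (cong (c₁ *F_) (trans (pow-+1 X (q ℕ.* Q)) (cong (_*F X) (pow-pow X q Q)))))
      (cong (c₂ *F_) (pow-+ X Q q))) (cong (c₃ *F_) (pow-+1 X Q))

    -- f X = A(X̄/X) X^(Q+1), and X̄/X lies in μ.
    f-nonvanishing : ANoRootsInMu c₀ c₁ c₂ c₃ → ∀ X → f X ≡ 0F → X ≡ 0F
    f-nonvanishing noRoots X fX≡0 = decidable-stable (X ≟ 0F) λ X≢0 → absurd X≢0
      where
      absurd : X ≢ 0F → ⊥
      absurd X≢0 = noRoots t (trans (pow-+1 t q) t̄t≡1)
        (x*y≡0⇒y≡0 (*-≢0 (Φ-≢0 X≢0) X≢0) (trans A-f fX≡0))
        where
        t : Carrier
        t = conj X *F inv X
        tX≡X̄ : t *F X ≡ conj X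
        tX≡X̄ = modulo (conj X) (*-invʳ X X≢0)
          (solve 3 (λ X X̄ i → (X̄ :* i) :* X := X̄ :+ X̄ :* (X :* i :+ :- 𝟙)) refl X (conj X) (inv X))
        t̄t≡1 : conj t *F t ≡ 1F
        t̄t≡1 = *-cancelˡ X≢0 (begin
          X *F (conj t *F t)     ≡⟨ solve 3 (λ X t̄ t → X :* (t̄ :* t) := t̄ :* (t :* X)) refl X (conj t) t ⟩
          conj t *F (t *F X)     ≡⟨ cong (conj t *F_) tX≡X̄ ⟩
          conj t *F conj X       ≡⟨ conj-* t X ⟨
          conj (t *F X)          ≡⟨ cong conj tX≡X̄ ⟩
          conj (conj X)          ≡⟨ conj-conj X ⟩
          X                      ≡⟨ *-idʳ X ⟨
          X *F 1F ∎)
          where open ≡-Reasoning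
        ΦtΦX≡ΦX̄ : Φ t *F Φ X ≡ Φ (conj X)
        ΦtΦX≡ΦX̄ = trans (sym (Φ-* t X)) (cong Φ tX≡X̄)
        A-f : (Φ X *F X) *F Ac c₀ c₁ c₂ c₃ t ≡ f X
        A-f = begin
          (Φ X *F X) *F Ac c₀ c₁ c₂ c₃ t
            ≡⟨ cong (λ z → (Φ X *F X) *F (c₀ *F z +F c₁ *F Φ t +F c₂ *F t +F c₃)) (pow-+1 t Q) ⟩
          (Φ X *F X) *F (c₀ *F (Φ t *F t) +F c₁ *F Φ t +F c₂ *F t +F c₃)
            ≡⟨ solve 8 (λ a b c d X t Y u →
                 (Y :* X) :* (a :* (u :* t) :+ b :* u :+ c :* t :+ d) :=
                 a :* ((u :* Y) :* (t :* X)) :+ b :* ((u :* Y) :* X) :+ c :* (Y :* (t :* X)) :+ d :* (Y :* X))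
               refl c₀ c₁ c₂ c₃ X t (Φ X) (Φ t) ⟩
          c₀ *F ((Φ t *F Φ X) *F (t *F X)) +F c₁ *F ((Φ t *F Φ X) *F X) +F c₂ *F (Φ X *F (t *F X)) +F c₃ *F (Φ X *F X)
            ≡⟨ cong₂ (λ u v → c₀ *F (u *F v) +F c₁ *F (u *F X) +F c₂ *F (Φ X *F v) +F c₃ *F (Φ X *F X)) ΦtΦX≡ΦX̄ tX≡X̄ ⟩
          c₀ *F (Φ (conj X) *F conj X) +F c₁ *F (Φ (conj X) *F X) +F c₂ *F (Φ X *F conj X) +F c₃ *F (Φ X *F X)
            ≡⟨ f-conj X ⟨
          f X ∎
          where open ≡-Reasoning

    -- The coefficients of f at X = x + θ y and X̄ = x - θ y: each conjugated factor contributes a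
    -- minus sign to its y-part.
    n₁ n₂ n₃ n₄ : Carrier
    n₁ = c₀ +F c₁ +F c₂ +F c₃
    n₂ = θ *F (-F c₀ +F c₁ +F -F c₂ +F c₃)
    n₃ = Φ θ *F (-F c₀ +F -F c₁ +F c₂ +F c₃)
    n₄ = (Φ θ *F θ) *F (c₀ +F -F c₁ +F -F c₂ +F c₃)

    f-ι : ∀ x y → f (ι (x , y)) ≡ form n₁ n₂ n₃ n₄ (χ x) (χ y)
    f-ι x y = begin
      f X ≡⟨ f-conj X ⟩
      c₀ *F (Φ (conj X) *F conj X) +F c₁ *F (Φ (conj X) *F X) +F c₂ *F (Φ X *F conj X) +F c₃ *F (Φ X *F X)
        ≡⟨ cong₂ (λ Φz z → c₀ *F (Φz *F z) +F c₁ *F (Φz *F X) +F c₂ *F (Φ X *F z) +F c₃ *F (Φ X *F X)) ΦX̄ (conj-ι x y) ⟩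
      c₀ *F ((1F *F Φ a +F -F τ *F Φ b) *F X̄) +F c₁ *F ((1F *F Φ a +F -F τ *F Φ b) *F X) +F
      c₂ *F (Φ X *F X̄) +F c₃ *F (Φ X *F X)
        ≡⟨ cong (λ Φz → c₀ *F ((1F *F Φ a +F -F τ *F Φ b) *F X̄) +F c₁ *F ((1F *F Φ a +F -F τ *F Φ b) *F X) +F
             c₂ *F (Φz *F X̄) +F c₃ *F (Φz *F X)) ΦX ⟩
      c₀ *F ((1F *F Φ a +F -F τ *F Φ b) *F X̄) +F c₁ *F ((1F *F Φ a +F -F τ *F Φ b) *F X) +F
      c₂ *F ((1F *F Φ a +F τ *F Φ b) *F X̄) +F c₃ *F ((1F *F Φ a +F τ *F Φ b) *F X)
        ≡⟨ solve 10 (λ c₀ c₁ c₂ c₃ t T a b A B →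
             let X = 𝟙 :* a :+ t :* b ; X̄ = 𝟙 :* a :+ :- t :* b
                 Y = 𝟙 :* A :+ T :* B ; Ȳ = 𝟙 :* A :+ :- T :* B in
             c₀ :* (Ȳ :* X̄) :+ c₁ :* (Ȳ :* X) :+ c₂ :* (Y :* X̄) :+ c₃ :* (Y :* X) :=
             (c₀ :+ c₁ :+ c₂ :+ c₃) :* (A :* a) :+ (t :* (:- c₀ :+ c₁ :+ :- c₂ :+ c₃)) :* (A :* b) :+
             (T :* (:- c₀ :+ :- c₁ :+ c₂ :+ c₃)) :* (B :* a) :+ ((T :* t) :* (c₀ :+ :- c₁ :+ :- c₂ :+ c₃)) :* (B :* b))
           refl c₀ c₁ c₂ c₃ θ τ a b (Φ a) (Φ b) ⟩
      form n₁ n₂ n₃ n₄ a b ∎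
      where
      open ≡-Reasoning
      a b τ X X̄ : Carrier
      a = χ x
      b = χ y
      τ = Φ θ
      X = ι (x , y)
      X̄ = 1F *F a +F -F θ *F b
      ΦX : Φ X ≡ 1F *F Φ a +F τ *F Φ b
      ΦX = trans (Φ-combo 1F θ a b) (cong (λ z → z *F Φ a +F τ *F Φ b) Φ-1)
      ΦX̄ : Φ (conj X) ≡ 1F *F Φ a +F -F τ *F Φ b
      ΦX̄ = trans (cong Φ (conj-ι x y)) (trans (Φ-combo 1F (-F θ) a b)
        (cong₂ (λ u v → u *F Φ a +F v *F Φ b) Φ-1 (Φ-neg θ)))

    m m′ : Carrier → L.Carrier
    m z = proj₁ (ι⁻¹ z)
    m′ z = proj₂ (ι⁻¹ z)

    f-pair : LinEquiv VK P f (λ (x , y) →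
      L.form (m n₁) (m n₂) (m n₃) (m n₄) x y , L.form (m′ n₁) (m′ n₂) (m′ n₃) (m′ n₄) x y)
    f-pair = ι⁻¹ , ι , proj₁ (proj₂ ι-inverse) , ι-bij , λ (x , y) → proj₁ (proj₂ (proj₂ ι-bij)) (begin
      ι (L.form (m n₁) (m n₂) (m n₃) (m n₄) x y , L.form (m′ n₁) (m′ n₂) (m′ n₃) (m′ n₄) x y)
        ≡⟨ ι-form (m n₁) (m n₂) (m n₃) (m n₄) (m′ n₁) (m′ n₂) (m′ n₃) (m′ n₄) x y ⟩
      form (ι (ι⁻¹ n₁)) (ι (ι⁻¹ n₂)) (ι (ι⁻¹ n₃)) (ι (ι⁻¹ n₄)) (χ x) (χ y)
        ≡⟨ form-coeffs (ι-ι⁻¹ n₁) (ι-ι⁻¹ n₂) (ι-ι⁻¹ n₃) (ι-ι⁻¹ n₄) (χ x) (χ y) ⟩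
      form n₁ n₂ n₃ n₄ (χ x) (χ y) ≡⟨ f-ι x y ⟨
      f (ι (x , y))                ≡⟨ ι-ι⁻¹ _ ⟨
      ι (ι⁻¹ (f (ι (x , y)))) ∎)
      where open ≡-Reasoning

    -- A vanishing combination of the two forms says Tr(w nᵢ) = 0 for some w ≠ 0 and all i,
    -- which unravels to w cᵢ + w̄ c̄₃₋ᵢ = 0.
    pencil-≢0 : ¬ gConstant c₀ c₁ c₂ c₃ → ∀ u v → ¬ (u ≡ L.0F × v ≡ L.0F) →
      let h : Carrier → L.Carrier
          h z = u L.*F m z L.+F v L.*F m′ z in
      ¬ (h n₁ ≡ L.0F × h n₂ ≡ L.0F × h n₃ ≡ L.0F × h n₄ ≡ L.0F)
    pencil-≢0 nonconstant u v uv≢0 (h₁≡0 , h₂≡0 , h₃≡0 , h₄≡0) =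
      nonconstant (λ′ , constant w₀ , constant w₁ , constant w₂ , constant w₃)
      where
      w w̄ λ′ : Carrier
      -- For z = a + θ b, this w satisfies w z + w̄ z̄ = 2 θ² (u a + v b), so the functional given
      -- by u and v becomes a trace.
      w = ι (d L.*F u , v)
      w̄ = conj w
      λ′ = -F (w *F inv w̄)

      w̄≢0 : w̄ ≢ 0F
      w̄≢0 = conj-≢0 λ w≡0 → let dv≡0 = ι-kernel (d L.*F u , v) w≡0 in
        uv≢0 (L.x*y≡0⇒y≡0 d≢0 (cong proj₁ dv≡0) , cong proj₂ dv≡0)

      constant : ∀ {x y} → w *F x +F w̄ *F y ≡ 0F → y ≡ λ′ *F x
      constant {x} {y} eq = *-cancelˡ w̄≢0 (modulo 1F eq (modulo (w *F x) (*-invʳ w̄ w̄≢0)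
        (solve 5 (λ w v i x y → v :* y :=
            (v :* (:- (w :* i) :* x) :+ 𝟙 :* ((w :* x :+ v :* y) :+ :- 𝟘)) :+ (w :* x) :* (v :* i :+ :- 𝟙))
          refl w w̄ (inv w̄) x y)))

      trace≡0 : ∀ z → u L.*F m z L.+F v L.*F m′ z ≡ L.0F → w *F z +F w̄ *F conj z ≡ 0F
      trace≡0 z hz≡0 = begin
        w *F z +F w̄ *F conj z
          ≡⟨ cong₂ (λ z w̄ → w *F z +F w̄ *F conj z) (sym (ι-ι⁻¹ z)) (conj-ι (d L.*F u) v) ⟩
        w *F ι (m z , m′ z) +F (1F *F χ (d L.*F u) +F -F θ *F χ v) *F conj (ι (m z , m′ z))
          ≡⟨ cong (λ z̄ → w *F ι (m z , m′ z) +F (1F *F χ (d L.*F u) +F -F θ *F χ v) *F z̄) (conj-ι (m z) (m′ z)) ⟩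
        (1F *F χ (d L.*F u) +F θ *F χ v) *F ι (m z , m′ z) +F
        (1F *F χ (d L.*F u) +F -F θ *F χ v) *F (1F *F χ (m z) +F -F θ *F χ (m′ z))
          ≡⟨ cong (λ U → (1F *F U +F θ *F χ v) *F ι (m z , m′ z) +F
               (1F *F U +F -F θ *F χ v) *F (1F *F χ (m z) +F -F θ *F χ (m′ z))) χ-du ⟩
        (1F *F (θ *F θ *F χ u) +F θ *F χ v) *F (1F *F χ (m z) +F θ *F χ (m′ z)) +F
        (1F *F (θ *F θ *F χ u) +F -F θ *F χ v) *F (1F *F χ (m z) +F -F θ *F χ (m′ z))
          ≡⟨ modulo ((1F +F 1F) *F (θ *F θ)) χh≡0
               (solve 5 (λ t u v a b →
                 (𝟙 :* (t :* t :* u) :+ t :* v) :* (𝟙 :* a :+ t :* b) :+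
                 (𝟙 :* (t :* t :* u) :+ :- t :* v) :* (𝟙 :* a :+ :- t :* b) :=
                 𝟘 :+ ((𝟙 :+ 𝟙) :* (t :* t)) :* ((u :* a :+ v :* b) :+ :- 𝟘))
               refl θ (χ u) (χ v) (χ (m z)) (χ (m′ z))) ⟩
        0F ∎
        where
        open ≡-Reasoning
        χ-du : χ (d L.*F u) ≡ θ *F θ *F χ u
        χ-du = trans (χ-* d u) (cong (_*F χ u) χ-d)
        χh≡0 : χ u *F χ (m z) +F χ v *F χ (m′ z) ≡ 0F
        χh≡0 = trans (sym (trans (χ-+ _ _) (cong₂ _+F_ (χ-* _ _) (χ-* _ _)))) (trans (cong χ hz≡0) χ-0)

      conj-Φθ : conj (Φ θ) ≡ -F Φ θ
      conj-Φθ = trans (sym (Φ-conj θ)) (trans (cong Φ conj-θ) (Φ-neg θ))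

      conj-sum : ∀ {a b c d a′ b′ c′ d′} → conj a ≡ a′ → conj b ≡ b′ → conj c ≡ c′ → conj d ≡ d′ →
        conj (a +F b +F c +F d) ≡ a′ +F b′ +F c′ +F d′
      conj-sum refl refl refl refl = trans (conj-+ _ _) (cong (_+F _) (trans (conj-+ _ _) (cong (_+F _) (conj-+ _ _))))

      c̄₀ c̄₁ c̄₂ c̄₃ : Carrier
      c̄₀ = conj c₀
      c̄₁ = conj c₁
      c̄₂ = conj c₂
      c̄₃ = conj c₃

      e₁ : w *F n₁ +F w̄ *F (c̄₀ +F c̄₁ +F c̄₂ +F c̄₃) ≡ 0F
      e₁ = trans (cong (λ z → w *F n₁ +F w̄ *F z) (sym (conj-sum refl refl refl refl))) (trace≡0 n₁ h₁≡0)

      -- Cancelling a factor t with t̄ = -t turns the sum of conjugates into a difference. This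
      -- applies to n₂ and n₃; the two signs in n₄ compensate each other.
      untwist : ∀ t s s̄ → t ≢ 0F → conj t ≡ -F t → conj s ≡ s̄ →
        w *F (t *F s) +F w̄ *F conj (t *F s) ≡ 0F → w *F s +F -F (w̄ *F s̄) ≡ 0F
      untwist t s s̄ t≢0 t̄≡ s̄≡ eq = x*y≡0⇒y≡0 t≢0 (trans
        (solve 5 (λ w v t s s̄ → t :* (w :* s :+ :- (v :* s̄)) := w :* (t :* s) :+ v :* (:- t :* s̄)) refl w w̄ t s s̄)
        (trans (cong (λ z → w *F (t *F s) +F w̄ *F z) (sym (trans (conj-* t s) (cong₂ _*F_ t̄≡ s̄≡)))) eq))

      e₂ : w *F (-F c₀ +F c₁ +F -F c₂ +F c₃) +F -F (w̄ *F (-F c̄₀ +F c̄₁ +F -F c̄₂ +F c̄₃)) ≡ 0F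
      e₂ = untwist θ _ _ θ≢0 conj-θ (conj-sum (conj-neg c₀) refl (conj-neg c₂) refl) (trace≡0 n₂ h₂≡0)

      e₃ : w *F (-F c₀ +F -F c₁ +F c₂ +F c₃) +F -F (w̄ *F (-F c̄₀ +F -F c̄₁ +F c̄₂ +F c̄₃)) ≡ 0F
      e₃ = untwist (Φ θ) _ _ (Φ-≢0 θ≢0) conj-Φθ (conj-sum (conj-neg c₀) (conj-neg c₁) refl refl) (trace≡0 n₃ h₃≡0)

      e₄ : w *F (c₀ +F -F c₁ +F -F c₂ +F c₃) +F w̄ *F (c̄₀ +F -F c̄₁ +F -F c̄₂ +F c̄₃) ≡ 0F
      e₄ = x*y≡0⇒y≡0 (*-≢0 (Φ-≢0 θ≢0) θ≢0) (trans
        (solve 6 (λ w v t T s s̄ → (T :* t) :* (w :* s :+ v :* s̄) := w :* ((T :* t) :* s) :+ v :* ((:- T :* :- t) :* s̄))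
          refl w w̄ θ (Φ θ) _ _)
        (trans (cong (λ z → w *F n₄ +F w̄ *F z) (sym (trans (conj-* _ _) (cong₂ _*F_
          (trans (conj-* _ _) (cong₂ _*F_ conj-Φθ conj-θ))
          (conj-sum refl (conj-neg c₁) (conj-neg c₂) refl))))) (trace≡0 n₄ h₄≡0)))

      E₁ E₂ E₃ E₄ : ∀ {k} → (w v c₀ c₁ c₂ c₃ d₀ d₁ d₂ d₃ : Polynomial k) → Polynomial k
      E₁ w v c₀ c₁ c₂ c₃ d₀ d₁ d₂ d₃ = (w :* (c₀ :+ c₁ :+ c₂ :+ c₃) :+ v :* (d₀ :+ d₁ :+ d₂ :+ d₃)) :+ :- 𝟘
      E₂ w v c₀ c₁ c₂ c₃ d₀ d₁ d₂ d₃ =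
        (w :* (:- c₀ :+ c₁ :+ :- c₂ :+ c₃) :+ :- (v :* (:- d₀ :+ d₁ :+ :- d₂ :+ d₃))) :+ :- 𝟘
      E₃ w v c₀ c₁ c₂ c₃ d₀ d₁ d₂ d₃ =
        (w :* (:- c₀ :+ :- c₁ :+ c₂ :+ c₃) :+ :- (v :* (:- d₀ :+ :- d₁ :+ d₂ :+ d₃))) :+ :- 𝟘
      E₄ w v c₀ c₁ c₂ c₃ d₀ d₁ d₂ d₃ =
        (w :* (c₀ :+ :- c₁ :+ :- c₂ :+ c₃) :+ v :* (d₀ :+ :- d₁ :+ :- d₂ :+ d₃)) :+ :- 𝟘

      quarter : ∀ {x} → (1F +F 1F) *F ((1F +F 1F) *F x) ≡ 0F → x ≡ 0F
      quarter = x*y≡0⇒y≡0 2≢0 ∘ x*y≡0⇒y≡0 2≢0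

      -- The sign patterns of e₁, ..., e₄ in the cᵢ form a Hadamard matrix, so signed sums isolate
      -- four times a single relation; `quarter` divides by 4.
      w₀ : w *F c₀ +F w̄ *F c̄₃ ≡ 0F
      w₀ = quarter (modulo 1F e₁ (modulo (-F 1F) e₂ (modulo (-F 1F) e₃ (modulo 1F e₄
        (solve 10 (λ w v c₀ c₁ c₂ c₃ d₀ d₁ d₂ d₃ → (𝟙 :+ 𝟙) :* ((𝟙 :+ 𝟙) :* (w :* c₀ :+ v :* d₃)) :=
          (((𝟘 :+ 𝟙 :* E₁ w v c₀ c₁ c₂ c₃ d₀ d₁ d₂ d₃) :+ :- 𝟙 :* E₂ w v c₀ c₁ c₂ c₃ d₀ d₁ d₂ d₃)
            :+ :- 𝟙 :* E₃ w v c₀ c₁ c₂ c₃ d₀ d₁ d₂ d₃) :+ 𝟙 :* E₄ w v c₀ c₁ c₂ c₃ d₀ d₁ d₂ d₃)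
        refl w w̄ c₀ c₁ c₂ c₃ c̄₀ c̄₁ c̄₂ c̄₃)))))

      w₁ : w *F c₁ +F w̄ *F c̄₂ ≡ 0F
      w₁ = quarter (modulo 1F e₁ (modulo 1F e₂ (modulo (-F 1F) e₃ (modulo (-F 1F) e₄
        (solve 10 (λ w v c₀ c₁ c₂ c₃ d₀ d₁ d₂ d₃ → (𝟙 :+ 𝟙) :* ((𝟙 :+ 𝟙) :* (w :* c₁ :+ v :* d₂)) :=
          (((𝟘 :+ 𝟙 :* E₁ w v c₀ c₁ c₂ c₃ d₀ d₁ d₂ d₃) :+ 𝟙 :* E₂ w v c₀ c₁ c₂ c₃ d₀ d₁ d₂ d₃)
            :+ :- 𝟙 :* E₃ w v c₀ c₁ c₂ c₃ d₀ d₁ d₂ d₃) :+ :- 𝟙 :* E₄ w v c₀ c₁ c₂ c₃ d₀ d₁ d₂ d₃)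
        refl w w̄ c₀ c₁ c₂ c₃ c̄₀ c̄₁ c̄₂ c̄₃)))))

      w₂ : w *F c₂ +F w̄ *F c̄₁ ≡ 0F
      w₂ = quarter (modulo 1F e₁ (modulo (-F 1F) e₂ (modulo 1F e₃ (modulo (-F 1F) e₄
        (solve 10 (λ w v c₀ c₁ c₂ c₃ d₀ d₁ d₂ d₃ → (𝟙 :+ 𝟙) :* ((𝟙 :+ 𝟙) :* (w :* c₂ :+ v :* d₁)) :=
          (((𝟘 :+ 𝟙 :* E₁ w v c₀ c₁ c₂ c₃ d₀ d₁ d₂ d₃) :+ :- 𝟙 :* E₂ w v c₀ c₁ c₂ c₃ d₀ d₁ d₂ d₃)
            :+ 𝟙 :* E₃ w v c₀ c₁ c₂ c₃ d₀ d₁ d₂ d₃) :+ :- 𝟙 :* E₄ w v c₀ c₁ c₂ c₃ d₀ d₁ d₂ d₃)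
        refl w w̄ c₀ c₁ c₂ c₃ c̄₀ c̄₁ c̄₂ c̄₃)))))

      w₃ : w *F c₃ +F w̄ *F c̄₀ ≡ 0F
      w₃ = quarter (modulo 1F e₁ (modulo 1F e₂ (modulo 1F e₃ (modulo 1F e₄
        (solve 10 (λ w v c₀ c₁ c₂ c₃ d₀ d₁ d₂ d₃ → (𝟙 :+ 𝟙) :* ((𝟙 :+ 𝟙) :* (w :* c₃ :+ v :* d₀)) :=
          (((𝟘 :+ 𝟙 :* E₁ w v c₀ c₁ c₂ c₃ d₀ d₁ d₂ d₃) :+ 𝟙 :* E₂ w v c₀ c₁ c₂ c₃ d₀ d₁ d₂ d₃)
            :+ 𝟙 :* E₃ w v c₀ c₁ c₂ c₃ d₀ d₁ d₂ d₃) :+ 𝟙 :* E₄ w v c₀ c₁ c₂ c₃ d₀ d₁ d₂ d₃)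
        refl w w̄ c₀ c₁ c₂ c₃ c̄₀ c̄₁ c̄₂ c̄₃)))))

    -- Classification by the discriminant of the pencil

    module _ (nonconstant : ¬ gConstant c₀ c₁ c₂ c₃) (noRoots : ANoRootsInMu c₀ c₁ c₂ c₃) where

      open PairNormalForms L sizeL (frobeniusAutomorphism L {m = suc k} pr sizeL l)
        {FieldSpace K} spaceK f (f-nonvanishing noRoots)
        using (Reaches; NormalForm; nonvanishing; outer; singularPencil)

      fromNormalForm : NormalForm → Conclusion c₀ c₁ c₂ c₃
      fromNormalForm (inj₁ R) = inj₁ (LinEquiv-step VK P P {f} R (id-bij P) (id-bij P)
        λ (x , y) → cong₂ _,_ (L.pow-+1 x Q) (L.pow-+1 y Q))
      fromNormalForm (inj₂ (inj₁ R)) = inj₂ (inj₂ (inj₂ (inj₁ (LinEquiv-step VK P P {f} R (id-bij P) (id-bij P)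
        λ (x , y) → cong₂ _,_ (L.pow-+1 x Q) (cong (x L.*F L.Φ y L.+F_) (L.pow-+1 y Q))))))
      fromNormalForm (inj₂ (inj₂ (inj₁ (ε , ε≢0 , R)))) = inj₂ (inj₂ (inj₂ (inj₂ (inj₁ (ε , ε≢0 ,
        LinEquiv-step VK P P {f} R (id-bij P) (id-bij P)
        λ (x , y) → cong₂ _,_ refl (cong₂ (λ u v → u L.+F ε L.*F v) (L.pow-+1 x Q) (L.pow-+1 y Q)))))))
      fromNormalForm (inj₂ (inj₂ (inj₂ (ε , ε≢0 , ε≢-1 , R)))) = inj₂ (inj₂ (inj₂ (inj₂ (inj₂ (inj₁ (ε , ε≢0 , ε≢-1 ,
        LinEquiv-step VK P P {f} R (id-bij P) (id-bij P)
        λ (x , y) → cong₂ _,_ (cong (λ u → u L.+F L.-F (L.Φ x L.*F y)) (L.pow-+1 x Q))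
          (cong (λ v → x L.*F L.Φ y L.+F ε L.*F v) (L.pow-+1 y Q))))))))

      classifyTwisted : ∀ v w → LinEquiv VK VK f (λ X → Φ X *F (v *F X +F w *F conj X)) → Conclusion c₀ c₁ c₂ c₃
      classifyTwisted v w E = by-cases (v ≟ 0F) (w ≟ 0F)
        where
        H-nonvanishing : ∀ {g} → LinEquiv VK VK f g → ∀ X → g X ≡ 0F → X ≡ 0F
        H-nonvanishing = LinEquiv-nonvanishing spaceK spaceK (f-nonvanishing noRoots)

        by-cases : Dec (v ≡ 0F) → Dec (w ≡ 0F) → Conclusion c₀ c₁ c₂ c₃
        by-cases (yes v≡0) (yes w≡0) = ⊥-elim (1≢0 (H-nonvanishing E 1F
          (trans (cong₂ (λ v w → Φ 1F *F (v *F 1F +F w *F conj 1F)) v≡0 w≡0)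
            (solve 2 (λ a b → a :* (𝟘 :* 𝟙 :+ 𝟘 :* b) := 𝟘) refl _ _))))
        by-cases (no v≢0) (yes w≡0) = inj₂ (inj₁ (LinEquiv-step VK VK VK {f} E (scale-bij (inv-≢0 v≢0)) (id-bij VK)
          λ X → trans (pow-+1 X Q)
            (modulo (-F (Φ X *F X)) (*-invʳ v v≢0) (modulo (-F (inv v *F (Φ X *F conj X))) w≡0
            (solve 6 (λ v w i X Y X̄ → Y :* X :=
                (i :* (Y :* (v :* X :+ w :* X̄)) :+ :- (Y :* X) :* (v :* i :+ :- 𝟙)) :+ :- (i :* (Y :* X̄)) :* (w :+ :- 𝟘))
              refl v w (inv v) X (Φ X) (conj X))))))
        by-cases (yes v≡0) (no w≢0) = inj₂ (inj₂ (inj₁ (LinEquiv-step VK VK VK {f} E (scale-bij (inv-≢0 w≢0)) (id-bij VK)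
          λ X → trans (f1-conj X)
            (modulo (-F (Φ X *F conj X)) (*-invʳ w w≢0) (modulo (-F (inv w *F (Φ X *F X))) v≡0
            (solve 6 (λ v w i X Y X̄ → Y :* X̄ :=
                (i :* (Y :* (v :* X :+ w :* X̄)) :+ :- (Y :* X̄) :* (w :* i :+ :- 𝟙)) :+ :- (i :* (Y :* X)) :* (v :+ :- 𝟘))
              refl v w (inv w) X (Φ X) (conj X)))))))
        by-cases (no v≢0) (no w≢0) = inj₂ (inj₂ (inj₂ (inj₂ (inj₂ (inj₂
          (ε , *-≢0 (inv-≢0 w≢0) v≢0 , ε∉μ , E′))))))
          where
          ε : Carrier
          ε = inv w *F v
          E′ : LinEquiv VK VK f (f2 ε)
          E′ = LinEquiv-step VK VK VK {f} E (scale-bij (inv-≢0 w≢0)) (id-bij VK)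
            λ X → trans (f2-conj ε X) (modulo (-F (Φ X *F conj X)) (*-invʳ w w≢0)
              (solve 6 (λ v w i X Y X̄ → Y :* X̄ :+ (i :* v) :* (Y :* X) :=
                  i :* (Y :* (v :* X :+ w :* X̄)) :+ :- (Y :* X̄) :* (w :* i :+ :- 𝟙))
                refl v w (inv w) X (Φ X) (conj X)))
          -- If ε̄ε = 1 then every y − ε̄ȳ is a zero of X̄ + εX; take y = 1 and y = θ.
          ε∉μ : ¬ inMu ε
          ε∉μ ε∈μ = x+x≢0 θ≢0 (modulo 1F at-θ (modulo θ at-1
            (solve 2 (λ t e → t :+ t := (𝟘 :+ 𝟙 :* ((t :+ :- (e :* :- t)) :+ :- 𝟘)) :+ t :* ((𝟙 :+ :- (e :* 𝟙)) :+ :- 𝟘))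
              refl θ (conj ε))))
            where
            zero-at : ∀ y {ȳ} → conj y ≡ ȳ → y +F -F (conj ε *F ȳ) ≡ 0F
            zero-at y refl = H-nonvanishing E′ X (begin
              f2 ε X
                ≡⟨ f2-conj ε X ⟩
              Φ X *F conj X +F ε *F (Φ X *F X)
                ≡⟨ cong (λ z → Φ X *F z +F ε *F (Φ X *F X)) X̄≡ ⟩
              Φ X *F (conj y +F -F (ε *F y)) +F ε *F (Φ X *F X)
                ≡⟨ modulo (-F (Φ X *F conj y)) (ε̄ε≡1 ε ε∈μ)
                     (solve 5 (λ Y y ȳ e ē → Y :* (ȳ :+ :- (e :* y)) :+ e :* (Y :* (y :+ :- (ē :* ȳ))) :=
                       𝟘 :+ :- (Y :* ȳ) :* (ē :* e :+ :- 𝟙)) refl (Φ X) y (conj y) ε (conj ε)) ⟩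
              0F ∎)
              where
              open ≡-Reasoning
              X : Carrier
              X = y +F -F (conj ε *F conj y)
              X̄≡ : conj X ≡ conj y +F -F (ε *F y)
              X̄≡ = trans (conj-+ _ _) (cong (conj y +F_) (trans (conj-neg _) (cong -F_
                (trans (conj-* _ _) (cong₂ _*F_ (conj-conj ε) (conj-conj y))))))
            at-1 : 1F +F -F (conj ε *F 1F) ≡ 0F
            at-1 = zero-at 1F conj-1
            at-θ : θ +F -F (conj ε *F -F θ) ≡ 0F
            at-θ = zero-at θ conj-θ

      -- Over K the form a + θ b is the product of a Q-th power of a linear form α and a linear
      -- form β; α is a bijection P → K and becomes the new coordinate.
      twistedCase : ∀ a₁ a₂ a₃ a₄ b₁ b₂ b₃ b₄ → Reaches (L.form a₁ a₂ a₃ a₄) (L.form b₁ b₂ b₃ b₄) →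
        ι (a₁ , b₁) *F ι (a₄ , b₄) ≡ ι (a₂ , b₂) *F ι (a₃ , b₃) → Conclusion c₀ c₁ c₂ c₃
      twistedCase a₁ a₂ a₃ a₄ b₁ b₂ b₃ b₄ R det =
        from-factors (rankOne _≟_ (ι (a₁ , b₁)) (ι (a₂ , b₂)) (ι (a₃ , b₃)) (ι (a₄ , b₄)) det)
        where
        from-factors : (∃ λ A₁ → ∃ λ A₂ → ∃ λ β₁ → ∃ λ β₂ → ι (a₁ , b₁) ≡ A₁ *F β₁ × ι (a₂ , b₂) ≡ A₁ *F β₂ ×
          ι (a₃ , b₃) ≡ A₂ *F β₁ × ι (a₄ , b₄) ≡ A₂ *F β₂) → Conclusion c₀ c₁ c₂ c₃
        from-factors (A₁ , A₂ , β₁ , β₂ , h₁≡ , h₂≡ , h₃≡ , h₄≡) =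
          classifyTwisted v w (LinEquiv-step VK P VK {f} R ι-bij (proj₁ (proj₂ α-inverse)) H≡)
          where
          α₁ α₂ : Carrier
          α₁ = proj₁ (Φ-surjective A₁)
          α₂ = proj₁ (Φ-surjective A₂)

          G : V P → V P
          G (x , y) = L.form a₁ a₂ a₃ a₄ x y , L.form b₁ b₂ b₃ b₄ x y

          ι-G : ∀ z → ι (G z) ≡ Φ (lin α₁ α₂ z) *F lin β₁ β₂ z
          ι-G (x , y) = begin
            ι (G (x , y))
              ≡⟨ ι-form a₁ a₂ a₃ a₄ b₁ b₂ b₃ b₄ x y ⟩
            form (ι (a₁ , b₁)) (ι (a₂ , b₂)) (ι (a₃ , b₃)) (ι (a₄ , b₄)) (χ x) (χ y)
              ≡⟨ form-coeffs h₁≡ h₂≡ h₃≡ h₄≡ (χ x) (χ y) ⟩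
            form (A₁ *F β₁) (A₁ *F β₂) (A₂ *F β₁) (A₂ *F β₂) (χ x) (χ y)
              ≡⟨ product-expand A₁ A₂ β₁ β₂ (χ x) (χ y) ⟨
            (A₁ *F Φ (χ x) +F A₂ *F Φ (χ y)) *F lin β₁ β₂ (x , y)
              ≡⟨ cong₂ (λ u v → (u *F Φ (χ x) +F v *F Φ (χ y)) *F lin β₁ β₂ (x , y))
                   (proj₂ (Φ-surjective A₁)) (proj₂ (Φ-surjective A₂)) ⟨
            (Φ α₁ *F Φ (χ x) +F Φ α₂ *F Φ (χ y)) *F lin β₁ β₂ (x , y)
              ≡⟨ cong (_*F lin β₁ β₂ (x , y)) (Φ-combo α₁ α₂ (χ x) (χ y)) ⟨
            Φ (lin α₁ α₂ (x , y)) *F lin β₁ β₂ (x , y) ∎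
            where open ≡-Reasoning

          -- ι ∘ G is Φ(α) times β, so a zero of α is a zero of G, and G vanishes only at 0.
          α-kernel : ∀ z → lin α₁ α₂ z ≡ 0F → z ≡ (L.0F , L.0F)
          α-kernel z αz≡0 = LinEquiv-nonvanishing spaceK spaceP (f-nonvanishing noRoots) R z
            (ι-kernel (G z) (trans (ι-G z) (trans (cong (λ u → Φ u *F lin β₁ β₂ z) αz≡0)
              (trans (cong (_*F lin β₁ β₂ z) Φ-0) (zeroˡ _)))))

          abstract
            α-inverse : Σ (Carrier → V P) λ α⁻¹ → IsFpLinearBij VK P α⁻¹ × (∀ z → lin α₁ α₂ (α⁻¹ z) ≡ z)
            α-inverse = inverse-bij (lin-bij α₁ α₂ α-kernel)

          α⁻¹ : Carrier → V P
          α⁻¹ = proj₁ α-inverse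

          D v w : Carrier
          -- Cramer's rule for expressing β as v α + w ᾱ; `D` is the determinant of α and ᾱ.
          D = α₁ *F conj α₂ +F -F (α₂ *F conj α₁)
          v = inv D *F (β₁ *F conj α₂ +F -F (β₂ *F conj α₁))
          w = inv D *F (α₁ *F β₂ +F -F (α₂ *F β₁))

          α₂≢0 : α₂ ≢ 0F
          α₂≢0 α₂≡0 = L.1≢0 (cong proj₂ (α-kernel (L.0F , L.1F) (trans
            (cong₂ (λ o e → α₁ *F o +F α₂ *F e) χ-0 χ-1)
            (trans (solve 2 (λ a b → a :* 𝟘 :+ b :* 𝟙 := b) refl α₁ α₂) α₂≡0))))

          -- Otherwise α₁/α₂ lies in L and yields a kernel vector of α.
          D≢0 : D ≢ 0F
          D≢0 D≡0 = L.1≢0 (cong proj₁ (α-kernel (L.1F , L.-F ρ) (trans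
            (cong₂ (λ e s → α₁ *F e +F α₂ *F s) χ-1 (trans (χ-neg ρ) (cong -F_ χρ≡r)))
            (modulo (-F α₁) (*-invʳ α₂ α₂≢0)
              (solve 3 (λ a b i → a :* 𝟙 :+ b :* :- (a :* i) := 𝟘 :+ :- a :* (b :* i :+ :- 𝟙)) refl α₁ α₂ (inv α₂))))))
            where
            r : Carrier
            r = α₁ *F inv α₂
            rα₂≡α₁ : r *F α₂ ≡ α₁
            rα₂≡α₁ = modulo α₁ (*-invʳ α₂ α₂≢0)
              (solve 3 (λ a b i → (a :* i) :* b := a :+ a :* (b :* i :+ :- 𝟙)) refl α₁ α₂ (inv α₂))
            r̄ᾱ₂≡ᾱ₁ : conj r *F conj α₂ ≡ conj α₁
            r̄ᾱ₂≡ᾱ₁ = trans (sym (conj-* r α₂)) (cong conj rα₂≡α₁)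
            r̄≡r : conj r ≡ r
            r̄≡r = *-cancelˡ (*-≢0 α₂≢0 (conj-≢0 α₂≢0)) (modulo α₂ r̄ᾱ₂≡ᾱ₁ (modulo (-F conj α₂) rα₂≡α₁
              (modulo (-F 1F) D≡0 (solve 6 (λ r r̄ a b ā b̄ → (b :* b̄) :* r̄ :=
                  (((b :* b̄) :* r :+ b :* (r̄ :* b̄ :+ :- ā)) :+ :- b̄ :* (r :* b :+ :- a))
                    :+ :- 𝟙 :* ((a :* b̄ :+ :- (b :* ā)) :+ :- 𝟘))
                refl r (conj r) α₁ α₂ (conj α₁) (conj α₂)))))
            ρ : L.Carrier
            ρ = proj₁ (conj-fixed r r̄≡r)
            χρ≡r : χ ρ ≡ r
            χρ≡r = proj₂ (conj-fixed r r̄≡r)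

          lin-β : ∀ z → lin β₁ β₂ z ≡ v *F lin α₁ α₂ z +F w *F conj (lin α₁ α₂ z)
          lin-β (x , y) = trans
            (modulo (-F lin β₁ β₂ (x , y)) (*-invʳ D D≢0)
              (solve 9 (λ b₁ b₂ i a₁ a₂ ā₁ ā₂ x y →
                  let v = i :* (b₁ :* ā₂ :+ :- (b₂ :* ā₁)) ; w = i :* (a₁ :* b₂ :+ :- (a₂ :* b₁)) in
                  b₁ :* x :+ b₂ :* y := (v :* (a₁ :* x :+ a₂ :* y) :+ w :* (ā₁ :* x :+ ā₂ :* y))
                    :+ :- (b₁ :* x :+ b₂ :* y) :* ((a₁ :* ā₂ :+ :- (a₂ :* ā₁)) :* i :+ :- 𝟙))
                refl β₁ β₂ (inv D) α₁ α₂ (conj α₁) (conj α₂) (χ x) (χ y)))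
            (cong (λ z → v *F lin α₁ α₂ (x , y) +F w *F z)
              (sym (trans (Conj.Φ-combo α₁ α₂ (χ x) (χ y))
                (cong₂ (λ a b → conj α₁ *F a +F conj α₂ *F b) (conj-χ x) (conj-χ y)))))

          H≡ : ∀ X → Φ X *F (v *F X +F w *F conj X) ≡ ι (G (α⁻¹ X))
          H≡ X = sym (trans (ι-G (α⁻¹ X)) (trans (cong (Φ (lin α₁ α₂ (α⁻¹ X)) *F_) (lin-β (α⁻¹ X)))
            (cong (λ z → Φ z *F (v *F z +F w *F conj z)) (proj₂ (proj₂ α-inverse) X))))

      classification : Conclusion c₀ c₁ c₂ c₃
      classification = by-cases (C L.≟ L.0F)
        where
        m₁ m₂ m₃ m₄ r₁ r₂ r₃ r₄ : L.Carrier
        m₁ = m n₁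
        m₂ = m n₂
        m₃ = m n₃
        m₄ = m n₄
        r₁ = m′ n₁
        r₂ = m′ n₂
        r₃ = m′ n₃
        r₄ = m′ n₄

        open Pencil L m₁ m₂ m₃ m₄ r₁ r₂ r₃ r₄
        module ᴷ = Pencil K (χ m₁) (χ m₂) (χ m₃) (χ m₄) (χ r₁) (χ r₂) (χ r₃) (χ r₄)

        singular : ∀ u v → ¬ (u ≡ L.0F × v ≡ L.0F) → Singular u v → Conclusion c₀ c₁ c₂ c₃
        singular u v uv≢0 det = fromNormalForm
          (singularPencil m₁ m₂ m₃ m₄ r₁ r₂ r₃ r₄ f-pair u v uv≢0 det (pencil-≢0 nonconstant u v uv≢0))

        2C : L.Carrier
        2C = (L.1F L.+F L.1F) L.*F C

        χ-2 : χ (L.1F L.+F L.1F) ≡ 1F +F 1F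
        χ-2 = trans (χ-+ _ _) (cong₂ _+F_ χ-1 χ-1)

        2C≢0 : C ≢ L.0F → 2C ≢ L.0F
        2C≢0 = L.*-≢0 λ 2≡0 → 2≢0 (trans (sym χ-2) (trans (cong χ 2≡0) χ-0))

        rational : C ≢ L.0F → ∀ x → x L.*F x ≡ δ → Conclusion c₀ c₁ c₂ c₃
        rational C≢0 x x²≡δ =
          singular 2C (x L.+F L.-F B) (λ (2C≡0 , _) → 2C≢0 C≢0 2C≡0) (root⇒singular x x²≡δ)

        χ-minor : ∀ a b c d → χ (a L.*F b L.+F L.-F (c L.*F d)) ≡ χ a *F χ b +F -F (χ c *F χ d)
        χ-minor a b c d = trans (χ-+ _ _) (cong₂ _+F_ (χ-* a b) (trans (χ-neg _) (cong -F_ (χ-* c d))))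

        χ-B : χ B ≡ ᴷ.B
        χ-B = trans (χ-+ _ _) (cong₂ _+F_ (sum m₁ r₄ r₁ m₄) (trans (χ-neg _) (cong -F_ (sum m₂ r₃ r₂ m₃))))
          where
          sum : ∀ a b c d → χ (a L.*F b L.+F c L.*F d) ≡ χ a *F χ b +F χ c *F χ d
          sum a b c d = trans (χ-+ _ _) (cong₂ _+F_ (χ-* a b) (χ-* c d))

        χ-C : χ C ≡ ᴷ.C
        χ-C = χ-minor r₁ r₄ r₂ r₃

        χ-δ : χ δ ≡ ᴷ.δ
        χ-δ = trans (χ-minor B B ((L.1F L.+F L.1F) L.*F (L.1F L.+F L.1F)) (A L.*F C))
          (cong₂ (λ b s → b +F -F s) (cong₂ _*F_ χ-B χ-B)
            (cong₂ _*F_ (trans (χ-* _ _) (cong₂ _*F_ χ-2 χ-2))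
              (trans (χ-* A C) (cong₂ _*F_ (χ-minor m₁ m₄ m₂ m₃) χ-C))))

        -- The root (2C, θ x - B) over K is split along 1, θ into the combinations (2C, -B) and (0,
        -- x) of the two forms. They are an invertible recombination over L because C and x are
        -- nonzero.
        irrational : C ≢ L.0F → ∀ x → x ≢ L.0F → d L.*F (x L.*F x) ≡ δ → Conclusion c₀ c₁ c₂ c₃
        irrational C≢0 x x≢0 dx²≡δ = twistedCase
          (a m₁ r₁) (a m₂ r₂) (a m₃ r₃) (a m₄ r₄) (b m₁ r₁) (b m₂ r₂) (b m₃ r₃) (b m₄ r₄)
          (outer f-pair 2C (L.-F B) L.0F x
            (L.≢-resp (L.*-≢0 (2C≢0 C≢0) x≢0)
              (L.solve 3 (λ c b x → c L.:* x L.:+ L.:- (b L.:* L.𝟘) L.:= c L.:* x) refl 2C (L.-F B) x))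
            (L.form-combine m₁ m₂ m₃ m₄ r₁ r₂ r₃ r₄ 2C (L.-F B))
            (L.form-combine m₁ m₂ m₃ m₄ r₁ r₂ r₃ r₄ L.0F x))
          (trans (cong₂ _*F_ (ι-ab m₁ r₁) (ι-ab m₄ r₄)) (trans (ᴷ.root⇒singular s s²≡δ)
            (sym (cong₂ _*F_ (ι-ab m₂ r₂) (ι-ab m₃ r₃)))))
          where
          a b : L.Carrier → L.Carrier → L.Carrier
          a m r = 2C L.*F m L.+F L.-F B L.*F r
          b m r = L.0F L.*F m L.+F x L.*F r

          s : Carrier
          s = θ *F χ x

          s²≡δ : s *F s ≡ ᴷ.δ
          s²≡δ = trans (solve 2 (λ t x → (t :* x) :* (t :* x) := (t :* t) :* (x :* x)) refl θ (χ x))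
            (trans (cong₂ _*F_ (sym χ-d) (sym (χ-* x x)))
              (trans (sym (χ-* d (x L.*F x))) (trans (cong χ dx²≡δ) χ-δ)))

          ι-ab : ∀ m r → ι (a m r , b m r) ≡ (1F +F 1F) *F ᴷ.C *F χ m +F (s +F -F ᴷ.B) *F χ r
          ι-ab m r = trans (cong₂ (λ u v → 1F *F u +F θ *F v)
              (trans (χ-+ _ _) (cong₂ _+F_
                (trans (χ-* 2C m) (cong (_*F χ m) (trans (χ-* _ C) (cong₂ _*F_ χ-2 χ-C))))
                (trans (χ-* (L.-F B) r) (cong (_*F χ r) (trans (χ-neg B) (cong -F_ χ-B))))))
              (trans (χ-+ _ _) (cong₂ _+F_ (trans (χ-* _ m) (cong (_*F χ m) χ-0)) (χ-* x r))))
            (solve 6 (λ C B t x m r →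
                𝟙 :* ((𝟙 :+ 𝟙) :* C :* m :+ :- B :* r) :+ t :* (𝟘 :* m :+ x :* r) :=
                (𝟙 :+ 𝟙) :* C :* m :+ (t :* x :+ :- B) :* r)
              refl ᴷ.C ᴷ.B θ (χ x) (χ m) (χ r))

        by-discriminant : C ≢ L.0F → (∃ λ x → x L.*F x ≡ δ ⊎ d L.*F (x L.*F x) ≡ δ) → Conclusion c₀ c₁ c₂ c₃
        by-discriminant C≢0 (x , inj₁ x²≡δ) = rational C≢0 x x²≡δ
        by-discriminant C≢0 (x , inj₂ dx²≡δ) = on-zero (x L.≟ L.0F)
          where
          on-zero : Dec (x ≡ L.0F) → Conclusion c₀ c₁ c₂ c₃
          on-zero (no x≢0) = irrational C≢0 x x≢0 dx²≡δ
          -- Here the discriminant is zero and thus itself a square in L.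
          on-zero (yes refl) = rational C≢0 L.0F
            (trans (L.solve 1 (λ d → L.𝟘 L.:* L.𝟘 L.:= d L.:* (L.𝟘 L.:* L.𝟘)) refl d) dx²≡δ)

        by-cases : Dec (C ≡ L.0F) → Conclusion c₀ c₁ c₂ c₃
        -- C is the determinant of the second form, which is therefore singular by itself.
        by-cases (yes C≡0) = singular L.0F L.1F (λ (_ , 1≡0) → L.1≢0 1≡0)
          (determinant≡0⇒singular L.0F L.1F (trans
            (L.solve 3 (λ A B C → A L.:* (L.𝟘 L.:* L.𝟘) L.:+ B L.:* (L.𝟘 L.:* L.𝟙) L.:+ C L.:* (L.𝟙 L.:* L.𝟙) L.:= C)
              refl A B C) C≡0))
        by-cases (no C≢0) = by-discriminant C≢0 (squareOrTwist L sizeL d d-nonsquare δ)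

theorem5p2 : (p k l : ℕ) → Prime p → ¬ (p ≡ 2) → ¬ (k ≡ 0) → ¬ (l ≡ 0) →
    (K Fq : Field) → HasSize K (p ^ (2 * k)) → HasSize Fq (p ^ k) →
    (c0 c1 c2 c3 : Field.Carrier K) →
    Paper.NonZeroVec K Fq (p ^ k) (p ^ l) c0 c1 c2 c3 →
    ¬ Paper.gConstant K Fq (p ^ k) (p ^ l) c0 c1 c2 c3 →
    Paper.ANoRootsInMu K Fq (p ^ k) (p ^ l) c0 c1 c2 c3 →
    Paper.Conclusion K Fq (p ^ k) (p ^ l) c0 c1 c2 c3
theorem5p2 p zero l pr p≢2 k≢0 = ⊥-elim (k≢0 refl)
theorem5p2 p (suc k) l pr p≢2 _ _ K Fq sizeK sizeFq c0 c1 c2 c3 _ nonconstant noRoots =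
  QuadraticExtension.classification k l pr p≢2 Fq K sizeFq sizeK c0 c1 c2 c3 nonconstant noRoots
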